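{- Let $\frac{s_1 \quad \cdots \quad s_n}{s}$ be an instance of one of the HOL deduction rules REFL, TRANS, MK\_COMB, ABS, BETA, ASSUME, EQ\_MP, DEDUCT\_ANTISYM\_RULE, INST, INSTTYPE, ETA (listed in the context). Then the rule $\frac{\lceil s_1\rceil \quad \cdots \quad \lceil s_n\rceil}{\lceil s\rceil}$ is admissible in FOST: if each of the first-order sequents $\lceil s_1\rceil,\dots,\lceil s_n\rceil$ is provable in first-order sequent calculus from the ZFC axioms (with the definitional symbols listed below), then so is $\lceil s\rceil$.
   Context: HOL here is higher-order logic as in HOL Light: simply typed lambda calculus with top-level polymorphism. Types are built from type variables, the type $\mathcal B$ of Booleans, the type $i$ of individuals, and arrow types $A\to B$. Terms are typed variables $x:A$, constants (including the polymorphic equality $=^\lambda : A\to A\to\mathcal B$, written $s=_A t$), applications $f\,t$ and abstractions $\lambda x{:}A.\,t$. An HOL sequent is $t_1,\dots,t_n\vdash t$ with all $t_j,t$ of type $\mathcal B$. The rules are: REFL: $\vdash t=_A t$. TRANS: from $\Gamma\vdash s=_A t$ and $\Delta\vdash t=_A u$ infer $\Gamma,\Delta\vdash s=_A u$ (the two occurrences of $t$ need only be alpha-equivalent). MK\_COMB: from $\Gamma\vdash s=_{A\to B} t$ and $\Delta\vdash u=_A v$ infer $\Gamma,\Delta\vdash s(u)=_B t(v)$. ABS: from $\Gamma\vdash s=_B t$ infer $\Gamma\vdash(\lambda x{:}A.\,s)=_{A\to B}(\lambda x{:}A.\,t)$. BETA: $\vdash(\lambda x{:}A.\,t)\,x=_B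 t$. ASSUME: $p\vdash p$. EQ\_MP: from $\Gamma\vdash p=_{\mathcal B} q$ and $\Delta\vdash p$ infer $\Gamma,\Delta\vdash q$ (the two occurrences of $p$ need only be alpha-equivalent). DEDUCT\_ANTISYM\_RULE: from $\Gamma,q\vdash p$ and $\Delta,p\vdash q$ infer $\Gamma,\Delta\vdash p=_{\mathcal B} q$. INST: from $\Gamma\vdash p$ infer $\Gamma[\vec x:=\vec t]\vdash p[\vec x:=\vec t]$ (substitution of terms for term variables). INSTTYPE: from $\Gamma\vdash p$ infer $\Gamma[\vec X:=\vec A]\vdash p[\vec X:=\vec A]$ (substitution of types for type variables). ETA: $\vdash(\lambda x.\,t\,x)=t$. FOST is ZFC in first-order logic (sequent calculus), conservatively extended by definitions with: $\mathrm{app}(f,x)$, the unique $y$ with $(x,y)\in f$ when $f$ is a function; $A\Rightarrow B=\{r\in\mathcal P(A\times B)\mid r \text{ is a total functional relation from } A \text{ to } B\}$; $\mathbb N$ the natural numbers; $\bot=\emptyset$, $\top=\{\emptyset\}$, $\mathbb B=\{\bot,\top\}$; and $E(A)=\{(x,f)\in A\times(A\Rightarrow\mathbb B)\mid f=\{(y,b)\in A\times\mathbb B\mid (x=y\to b=\top)\wedge(x\neq y\to b=\bot)\}\}$. Application is written by juxtaposition and is curried: $f\,a\,b$ means $\mathrm{app}(\mathrm{app}(f,a),b)$. Embedding $\lceil\cdot\rceil$ of HOL into FOST: a reserved set of first-order variables $\lambda_1,\lambda_2,\dots$ is used, one associated to each abstraction term. Type variables $X$ are mapped to first-order variables $X$;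 $\lceil T_1\to T_2\rceil=\lceil T_1\rceil\Rightarrow\lceil T_2\rceil$; $\lceil\mathcal B\rceil=\mathbb B$; $\lceil i\rceil=\mathbb N$; $\lceil x{:}A\rceil=x$; $\lceil =^\lambda:A\to A\to\mathcal B\rceil=E(\lceil A\rceil)$; $\lceil f\,t\rceil=\lceil f\rceil\,\lceil t\rceil$; $\lceil\lambda x{:}A.\,t\rceil=\lambda_i\,y_1\cdots y_n$, where $y_1,\dots,y_n$ are the free variables of $\lambda x.\,t$ and $\lambda_i$ is the variable associated with $\lambda x.\,t$. The context of an HOL term $t$ is $\mathrm{ctx}(t)=\mathrm{ctx}^N(t)\cup\mathrm{ctx}^T(t)\cup\mathrm{ctx}^D(t)$, where: $\mathrm{ctx}^N(t)$ is the set of formulas $X\neq\emptyset$ for every type variable $X$ occurring in $t$ (including in types of polymorphic constants); $\mathrm{ctx}^T$ is given by $\mathrm{ctx}^T(x{:}T)=\{x\in\lceil T\rceil\}$, $\mathrm{ctx}^T(c)=\emptyset$ for constants, $\mathrm{ctx}^T(f\,t)=\mathrm{ctx}^T(f)\cup\mathrm{ctx}^T(t)$, $\mathrm{ctx}^T(\lambda x{:}T.\,t)=\mathrm{ctx}^T(t)\setminus\{x\in\lceil T\rceil\}$; and $\mathrm{ctx}^D$ is given by $\mathrm{ctx}^D(x{:}T)=\mathrm{ctx}^D(c)=\emptyset$, $\mathrm{ctx}^D(f\,t)=\mathrm{ctx}^D(f)\cup\mathrm{ctx}^D(t)$, and $\mathrm{ctx}^D(\lambda x{:}T.\,t)=\mathrm{ctx}^D(t)\cup\{\lambda_i\in(\lceil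 T_1\rceil\Rightarrow\cdots\Rightarrow\lceil T_n\rceil\Rightarrow\lceil T\rceil\Rightarrow\lceil\tau\rceil)\ \wedge\ \forall y_1\in\lceil T_1\rceil\cdots\forall y_n\in\lceil T_n\rceil\,\forall x\in\lceil T\rceil.\ \lambda_i\,y_1\cdots y_n\,x=\lceil t\rceil\}$, where $\tau$ is the type of $t$, $y_1{:}T_1,\dots,y_n{:}T_n$ are the free variables of $t$ other than $x$, and $\lambda_i$ is the variable associated with $\lambda x.\,t$. The embedding of an HOL sequent $s=(t_1,\dots,t_n\vdash t)$ is the first-order sequent $\lceil s\rceil:=\ \mathrm{ctx}(t_1),\dots,\mathrm{ctx}(t_n),\mathrm{ctx}(t),\ \lceil t_1\rceil=\top,\dots,\lceil t_n\rceil=\top\ \vdash\ \lceil t\rceil=\top$.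
   Formalization: The rule ABS is taken with the usual side condition that x is not free in Γ, and ETA with the condition that x is not free in t; without these conditions, which the rule list omits, the claim is false. -}

module Defs where

open import Data.Nat using (ℕ; zero; suc; _≡ᵇ_; _⊔_)
open import Data.Bool using (Bool; true; false; _∧_; _∨_; not; if_then_else_)
open import Data.Product using (_×_; _,_; proj₁; proj₂)
open import Data.List using (List; []; _∷_; _++_; map; concatMap; foldr; foldl)
open import Data.List.Relation.Unary.All using (All)
open import Data.List.Membership.Propositional using (_∈_)
open import Relation.Binary.PropositionalEquality using (_≡_)

infixr 30 _⇛_

data HType : Set where
  tvar : ℕ → HType
  bool : HType
  ind  : HType
  _⇛_  : HType → HType → HType

HVar : Set
HVar = ℕ × HType

data Term : Set where
  var : ℕ → HType → Term
  eqc : HType → Term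
  app : Term → Term → Term
  lam : ℕ → HType → Term → Term

data Typed : Term → HType → Set where
  tvarT : ∀ {x A} → Typed (var x A) A
  teqc  : ∀ {A} → Typed (eqc A) (A ⇛ (A ⇛ bool))
  tapp  : ∀ {f u A B} → Typed f (A ⇛ B) → Typed u A → Typed (app f u) B
  tlam  : ∀ {x A t B} → Typed t B → Typed (lam x A t) (A ⇛ B)

mkEq : HType → Term → Term → Term
mkEq A s t = app (app (eqc A) s) t

-- the type of a term (correct for well-typed terms)
cod : HType → HType
cod (A ⇛ B) = B
cod _       = bool

ty : Term → HType
ty (var x A)   = A
ty (eqc A)     = A ⇛ (A ⇛ bool)
ty (app f u)   = cod (ty f)
ty (lam x A t) = A ⇛ ty t

eqTy : HType → HType → Bool
eqTy (tvar m) (tvar n) = m ≡ᵇ n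
eqTy bool bool = true
eqTy ind ind = true
eqTy (a ⇛ b) (c ⇛ d) = eqTy a c ∧ eqTy b d
eqTy _ _ = false

eqHV : HVar → HVar → Bool
eqHV (x , A) (y , B) = (x ≡ᵇ y) ∧ eqTy A B

eqTm : Term → Term → Bool
eqTm (var x A) (var y B) = (x ≡ᵇ y) ∧ eqTy A B
eqTm (eqc A) (eqc B) = eqTy A B
eqTm (app f t) (app g u) = eqTm f g ∧ eqTm t u
eqTm (lam x A s) (lam y B t) = (x ≡ᵇ y) ∧ eqTy A B ∧ eqTm s t
eqTm _ _ = false

elemHV : HVar → List HVar → Bool
elemHV v [] = false
elemHV v (w ∷ ws) = eqHV v w ∨ elemHV v ws

removeHV : HVar → List HVar → List HVar
removeHV v [] = []
removeHV v (w ∷ ws) = if eqHV v w then removeHV v ws else w ∷ removeHV v ws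

addHV : List HVar → HVar → List HVar
addHV l v = if elemHV v l then l else l ++ (v ∷ [])

unionHV : List HVar → List HVar → List HVar
unionHV xs ys = foldl addHV xs ys

-- Free variables, without repetition, in order of first occurrence
-- (left to right).  This fixes the order y₁,…,yₙ used by the embedding.
fv : Term → List HVar
fv (var x A)   = (x , A) ∷ []
fv (eqc A)     = []
fv (app f u)   = unionHV (fv f) (fv u)
fv (lam x A t) = removeHV (x , A) (fv t)

tvsTy : HType → List ℕ
tvsTy (tvar X) = X ∷ []
tvsTy bool = []
tvsTy ind = []
tvsTy (A ⇛ B) = tvsTy A ++ tvsTy B

tvsTm : Term → List ℕ
tvsTm (var x A) = tvsTy A
tvsTm (eqc A) = tvsTy A
tvsTm (app f u) = tvsTm f ++ tvsTm u
tvsTm (lam x A t) = tvsTy A ++ tvsTm t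

tsub : (ℕ → HType) → HType → HType
tsub θ (tvar X) = θ X
tsub θ bool = bool
tsub θ ind = ind
tsub θ (A ⇛ B) = tsub θ A ⇛ tsub θ B

maxName : List HVar → ℕ
maxName [] = 0
maxName ((x , A) ∷ vs) = x ⊔ maxName vs

-- Simultaneous capture-avoiding instantiation of type variables (θ) and
-- term variables (σ, indexed by the ORIGINAL variable).  A bound variable
-- is renamed (to a fresh name) exactly when it would capture a free
-- variable of the substituted body, as HOL Light's INST / INST_TYPE do.
sub : (ℕ → HType) → (ℕ → HType → Term) → Term → Term
sub θ σ (var x A)   = σ x A
sub θ σ (eqc A)     = eqc (tsub θ A)
sub θ σ (app f u)   = app (sub θ σ f) (sub θ σ u)
sub θ σ (lam x A t) = lam x' A' (sub θ σ' t)
  where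
  A' : HType
  A' = tsub θ A
  avoid : List HVar
  avoid = concatMap (λ v → fv (σ (proj₁ v) (proj₂ v))) (fv (lam x A t))
  x' : ℕ
  x' = if elemHV (x , A') avoid then suc (maxName avoid) else x
  σ' : ℕ → HType → Term
  σ' y B = if eqHV (y , B) (x , A) then var x' A' else σ y B

instLookup : List (Term × HVar) → ℕ → HType → Term
instLookup [] y B = var y B
instLookup ((t , v) ∷ ps) y B = if eqHV (y , B) v then t else instLookup ps y B

inst : List (Term × HVar) → Term → Term
inst ps = sub tvar (instLookup ps)

tyLookup : List (HType × ℕ) → ℕ → HType
tyLookup [] X = tvar X
tyLookup ((A , Y) ∷ ps) X = if X ≡ᵇ Y then A else tyLookup ps X

instT : List (HType × ℕ) → Term → Term
instT ps = sub (tyLookup ps) (λ y B → var y (tsub (tyLookup ps) B))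

aeqV : List (HVar × HVar) → HVar → HVar → Bool
aeqV [] v w = eqHV v w
aeqV ((a , b) ∷ Γ) v w =
  if eqHV v a ∨ eqHV w b then eqHV v a ∧ eqHV w b else aeqV Γ v w

aeq : List (HVar × HVar) → Term → Term → Bool
aeq Γ (var x A) (var y B) = aeqV Γ (x , A) (y , B)
aeq Γ (eqc A) (eqc B) = eqTy A B
aeq Γ (app f t) (app g u) = aeq Γ f g ∧ aeq Γ t u
aeq Γ (lam x A s) (lam y B t) = eqTy A B ∧ aeq (((x , A) , (y , B)) ∷ Γ) s t
aeq Γ _ _ = false

Alpha : Term → Term → Set
Alpha s t = aeq [] s t ≡ true

HSeq : Set
HSeq = List Term × Term

WfSeq : HSeq → Set
WfSeq (hs , c) = All (λ h → Typed h bool) hs × Typed c bool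

-- Instances of the HOL rules:  HRule premises conclusion.
-- (Well-typedness of all sequents is imposed separately via WfSeq.)
data HRule : List HSeq → HSeq → Set where
  REFL  : ∀ A t → HRule [] ([] , mkEq A t t)
  TRANS : ∀ Γ Δ A s t t' u → Alpha t t' →
          HRule ((Γ , mkEq A s t) ∷ (Δ , mkEq A t' u) ∷ [])
                (Γ ++ Δ , mkEq A s u)
  MK-COMB : ∀ Γ Δ A B s t u v →
          HRule ((Γ , mkEq (A ⇛ B) s t) ∷ (Δ , mkEq A u v) ∷ [])
                (Γ ++ Δ , mkEq B (app s u) (app t v))
  ABS   : ∀ Γ A B x s t → elemHV (x , A) (concatMap fv Γ) ≡ false →
          HRule ((Γ , mkEq B s t) ∷ [])
                (Γ , mkEq (A ⇛ B) (lam x A s) (lam x A t))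
  BETA  : ∀ A B x t → HRule [] ([] , mkEq B (app (lam x A t) (var x A)) t)
  ASSUME : ∀ p → HRule [] (p ∷ [] , p)
  EQ-MP : ∀ Γ Δ p p' q → Alpha p p' →
          HRule ((Γ , mkEq bool p q) ∷ (Δ , p') ∷ []) (Γ ++ Δ , q)
  DEDUCT-ANTISYM : ∀ Γ Δ p q →
          HRule ((q ∷ Γ , p) ∷ (p ∷ Δ , q) ∷ []) (Γ ++ Δ , mkEq bool p q)
  INST  : ∀ Γ p (σ : List (Term × HVar)) →
          All (λ e → Typed (proj₁ e) (proj₂ (proj₂ e))) σ →
          HRule ((Γ , p) ∷ []) (map (inst σ) Γ , inst σ p)
  INSTTYPE : ∀ Γ p (θ : List (HType × ℕ)) →
          HRule ((Γ , p) ∷ []) (map (instT θ) Γ , instT θ p)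
  ETA   : ∀ A B x t → elemHV (x , A) (fv t) ≡ false →
          HRule [] ([] , mkEq (A ⇛ B) (lam x A (app t (var x A))) t)

-- first-order variables: type variables X, HOL term variables x:A,
-- the reserved variables λ_i (one per abstraction term), and others.
data FVar : Set where
  tyV  : ℕ → FVar
  hV   : ℕ → HType → FVar
  lamV : Term → FVar
  oV   : ℕ → FVar

eqFV : FVar → FVar → Bool
eqFV (tyV m) (tyV n) = m ≡ᵇ n
eqFV (hV x A) (hV y B) = (x ≡ᵇ y) ∧ eqTy A B
eqFV (lamV s) (lamV t) = eqTm s t
eqFV (oV m) (oV n) = m ≡ᵇ n
eqFV _ _ = false

elemFV : FVar → List FVar → Bool
elemFV v [] = false
elemFV v (w ∷ ws) = eqFV v w ∨ elemFV v ws

data FTm : Set where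
  fvar  : FVar → FTm
  bvar  : ℕ → FTm
  appS  : FTm → FTm → FTm
  arrS  : FTm → FTm → FTm
  natS  : FTm
  botS  : FTm
  topS  : FTm
  boolS : FTm
  eS    : FTm → FTm

infixr 4 _⟹_
infixr 6 _∧'_
infixr 5 _∨'_
infix 8 _∈'_ _≐_

data Fm : Set where
  _∈'_ : FTm → FTm → Fm
  _≐_  : FTm → FTm → Fm
  ⊥'   : Fm
  _⟹_  : Fm → Fm → Fm
  _∧'_ : Fm → Fm → Fm
  _∨'_ : Fm → Fm → Fm
  ∀'   : Fm → Fm
  ∃'   : Fm → Fm

¬' : Fm → Fm
¬' φ = φ ⟹ ⊥'

infix 3 _⟺_
_⟺_ : Fm → Fm → Fm
φ ⟺ ψ = (φ ⟹ ψ) ∧' (ψ ⟹ φ)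

closeT : ℕ → FVar → FTm → FTm
closeT k v (fvar w) = if eqFV v w then bvar k else fvar w
closeT k v (bvar i) = bvar i
closeT k v (appS s t) = appS (closeT k v s) (closeT k v t)
closeT k v (arrS s t) = arrS (closeT k v s) (closeT k v t)
closeT k v natS = natS
closeT k v botS = botS
closeT k v topS = topS
closeT k v boolS = boolS
closeT k v (eS s) = eS (closeT k v s)

closeF : ℕ → FVar → Fm → Fm
closeF k v (s ∈' t) = closeT k v s ∈' closeT k v t
closeF k v (s ≐ t) = closeT k v s ≐ closeT k v t
closeF k v ⊥' = ⊥'
closeF k v (φ ⟹ ψ) = closeF k v φ ⟹ closeF k v ψ
closeF k v (φ ∧' ψ) = closeF k v φ ∧' closeF k v ψ
closeF k v (φ ∨' ψ) = closeF k v φ ∨' closeF k v ψ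
closeF k v (∀' φ) = ∀' (closeF (suc k) v φ)
closeF k v (∃' φ) = ∃' (closeF (suc k) v φ)

openT : ℕ → FTm → FTm → FTm
openT k u (fvar w) = fvar w
openT k u (bvar i) = if i ≡ᵇ k then u else bvar i
openT k u (appS s t) = appS (openT k u s) (openT k u t)
openT k u (arrS s t) = arrS (openT k u s) (openT k u t)
openT k u natS = natS
openT k u botS = botS
openT k u topS = topS
openT k u boolS = boolS
openT k u (eS s) = eS (openT k u s)

openF : ℕ → FTm → Fm → Fm
openF k u (s ∈' t) = openT k u s ∈' openT k u t
openF k u (s ≐ t) = openT k u s ≐ openT k u t
openF k u ⊥' = ⊥'
openF k u (φ ⟹ ψ) = openF k u φ ⟹ openF k u ψ
openF k u (φ ∧' ψ) = openF k u φ ∧' openF k u ψ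
openF k u (φ ∨' ψ) = openF k u φ ∨' openF k u ψ
openF k u (∀' φ) = ∀' (openF (suc k) u φ)
openF k u (∃' φ) = ∃' (openF (suc k) u φ)

ltᵇ : ℕ → ℕ → Bool
ltᵇ i zero = false
ltᵇ zero (suc k) = true
ltᵇ (suc i) (suc k) = ltᵇ i k

lcT : ℕ → FTm → Bool
lcT k (fvar w) = true
lcT k (bvar i) = ltᵇ i k
lcT k (appS s t) = lcT k s ∧ lcT k t
lcT k (arrS s t) = lcT k s ∧ lcT k t
lcT k natS = true
lcT k botS = true
lcT k topS = true
lcT k boolS = true
lcT k (eS s) = lcT k s

lcF : ℕ → Fm → Bool
lcF k (s ∈' t) = lcT k s ∧ lcT k t
lcF k (s ≐ t) = lcT k s ∧ lcT k t
lcF k ⊥' = true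
lcF k (φ ⟹ ψ) = lcF k φ ∧ lcF k ψ
lcF k (φ ∧' ψ) = lcF k φ ∧ lcF k ψ
lcF k (φ ∨' ψ) = lcF k φ ∧ lcF k ψ
lcF k (∀' φ) = lcF (suc k) φ
lcF k (∃' φ) = lcF (suc k) φ

fvT : FTm → List FVar
fvT (fvar w) = w ∷ []
fvT (bvar i) = []
fvT (appS s t) = fvT s ++ fvT t
fvT (arrS s t) = fvT s ++ fvT t
fvT natS = []
fvT botS = []
fvT topS = []
fvT boolS = []
fvT (eS s) = fvT s

fvF : Fm → List FVar
fvF (s ∈' t) = fvT s ++ fvT t
fvF (s ≐ t) = fvT s ++ fvT t
fvF ⊥' = []
fvF (φ ⟹ ψ) = fvF φ ++ fvF ψ
fvF (φ ∧' ψ) = fvF φ ++ fvF ψ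
fvF (φ ∨' ψ) = fvF φ ++ fvF ψ
fvF (∀' φ) = fvF φ
fvF (∃' φ) = fvF φ

-- named-binder notation, used only to write the (closed) axioms below;
-- all names used there are reserved o-variables, so no capture occurs.
Aℓ : ℕ → Fm → Fm
Aℓ n φ = ∀' (closeF 0 (oV n) φ)

Ex : ℕ → Fm → Fm
Ex n φ = ∃' (closeF 0 (oV n) φ)

o : ℕ → FTm
o n = fvar (oV n)

-- p = (a , b)  (Kuratowski pair {{a},{a,b}})
IsPair : FTm → FTm → FTm → Fm
IsPair p a b =
  Aℓ 1000 (o 1000 ∈' p ⟺
    (Aℓ 1001 (o 1001 ∈' o 1000 ⟺ o 1001 ≐ a)
     ∨' Aℓ 1001 (o 1001 ∈' o 1000 ⟺ (o 1001 ≐ a ∨' o 1001 ≐ b))))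

PairIn : FTm → FTm → FTm → Fm
PairIn a b r = Ex 1002 (IsPair (o 1002) a b ∧' o 1002 ∈' r)

IsFun : FTm → Fm
IsFun f =
  Aℓ 1003 (o 1003 ∈' f ⟹ Ex 1004 (Ex 1005 (IsPair (o 1003) (o 1004) (o 1005))))
  ∧' Aℓ 1004 (Aℓ 1005 (Aℓ 1006
       ((PairIn (o 1004) (o 1005) f ∧' PairIn (o 1004) (o 1006) f) ⟹ o 1005 ≐ o 1006)))

Inductive : FTm → Fm
Inductive I =
  botS ∈' I
  ∧' Aℓ 1010 (o 1010 ∈' I ⟹
       Ex 1011 (o 1011 ∈' I ∧' Aℓ 1012 (o 1012 ∈' o 1011 ⟺ (o 1012 ∈' o 1010 ∨' o 1012 ≐ o 1010))))

data Ax : Fm → Set where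
  extensionality : Ax (Aℓ 0 (Aℓ 1 (Aℓ 2 (o 2 ∈' o 0 ⟺ o 2 ∈' o 1) ⟹ o 0 ≐ o 1)))
  foundation : Ax (Aℓ 0 (Ex 1 (o 1 ∈' o 0) ⟹
                  Ex 1 (o 1 ∈' o 0 ∧' ¬' (Ex 2 (o 2 ∈' o 1 ∧' o 2 ∈' o 0)))))
  pairing : Ax (Aℓ 0 (Aℓ 1 (Ex 2 (o 0 ∈' o 2 ∧' o 1 ∈' o 2))))
  union : Ax (Aℓ 0 (Ex 1 (Aℓ 2 (Aℓ 3 ((o 3 ∈' o 2 ∧' o 2 ∈' o 0) ⟹ o 3 ∈' o 1)))))
  powerset : Ax (Aℓ 0 (Ex 1 (Aℓ 2 (Aℓ 3 (o 3 ∈' o 2 ⟹ o 3 ∈' o 0) ⟹ o 2 ∈' o 1))))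
  infinity : Ax (Ex 0 (Ex 1 (o 1 ∈' o 0 ∧' Aℓ 2 (¬' (o 2 ∈' o 1)))
                ∧' Aℓ 3 (o 3 ∈' o 0 ⟹
                     Ex 4 (o 4 ∈' o 0 ∧' Aℓ 2 (o 2 ∈' o 4 ⟺ (o 2 ∈' o 3 ∨' o 2 ≐ o 3))))))
  choice : Ax (Aℓ 0
    ((Aℓ 1 (o 1 ∈' o 0 ⟹ Ex 2 (o 2 ∈' o 1))
      ∧' Aℓ 1 (Aℓ 3 ((o 1 ∈' o 0 ∧' o 3 ∈' o 0 ∧' ¬' (o 1 ≐ o 3)) ⟹
                       ¬' (Ex 2 (o 2 ∈' o 1 ∧' o 2 ∈' o 3)))))
     ⟹ Ex 4 (Aℓ 1 (o 1 ∈' o 0 ⟹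
            Ex 2 ((o 2 ∈' o 1 ∧' o 2 ∈' o 4)
                  ∧' Aℓ 5 ((o 5 ∈' o 1 ∧' o 5 ∈' o 4) ⟹ o 5 ≐ o 2))))))
  -- ∀A ∃B ∀x (x ∈ B ↔ x ∈ A ∧ φ(x)),  φ arbitrary (other free variables
  -- are parameters)
  separation : ∀ (φ : Fm) (x : FVar) → lcF 0 φ ≡ true →
    Ax (∀' (∃' (∀' (bvar 0 ∈' bvar 1 ⟺ (bvar 0 ∈' bvar 2 ∧' closeF 0 x φ)))))
  replacement : ∀ (φ : Fm) (x y : FVar) → lcF 0 φ ≡ true →
    Ax (∀' ((∀' (bvar 0 ∈' bvar 1 ⟹
                ∃' (closeF 0 y (closeF 1 x φ)
                    ∧' ∀' (closeF 0 y (closeF 2 x φ) ⟹ bvar 0 ≐ bvar 1))))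
            ⟹ ∃' (∀' (bvar 0 ∈' bvar 2 ⟹
                       ∃' (bvar 0 ∈' bvar 2 ∧' closeF 0 y (closeF 1 x φ))))))
  def-bot  : Ax (Aℓ 0 (¬' (o 0 ∈' botS)))
  def-top  : Ax (Aℓ 0 (o 0 ∈' topS ⟺ o 0 ≐ botS))
  def-bool : Ax (Aℓ 0 (o 0 ∈' boolS ⟺ (o 0 ≐ botS ∨' o 0 ≐ topS)))
  def-nat  : Ax (Aℓ 0 (o 0 ∈' natS ⟺ Aℓ 1 (Inductive (o 1) ⟹ o 0 ∈' o 1)))
  -- app(f,x) = the unique y with (x,y) ∈ f when f is a function and x is
  -- in its domain; ∅ otherwise
  def-app  : Ax (Aℓ 0 (Aℓ 1 (Aℓ 2 (appS (o 0) (o 1) ≐ o 2 ⟺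
               ((IsFun (o 0) ∧' PairIn (o 1) (o 2) (o 0))
                ∨' (¬' (IsFun (o 0) ∧' Ex 3 (PairIn (o 1) (o 3) (o 0))) ∧' o 2 ≐ botS))))))
  def-arr  : Ax (Aℓ 0 (Aℓ 1 (Aℓ 2 (o 2 ∈' arrS (o 0) (o 1) ⟺
               (Aℓ 3 (o 3 ∈' o 2 ⟹ Ex 4 (Ex 5 (o 4 ∈' o 0 ∧' o 5 ∈' o 1 ∧' IsPair (o 3) (o 4) (o 5))))
                ∧' Aℓ 4 (o 4 ∈' o 0 ⟹ Ex 5 (PairIn (o 4) (o 5) (o 2)))
                ∧' Aℓ 4 (Aℓ 5 (Aℓ 6 ((PairIn (o 4) (o 5) (o 2) ∧' PairIn (o 4) (o 6) (o 2)) ⟹ o 5 ≐ o 6))))))))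
  def-E    : Ax (Aℓ 0 (Aℓ 1 (o 1 ∈' eS (o 0) ⟺
               Ex 2 (Ex 3 (IsPair (o 1) (o 2) (o 3) ∧' o 2 ∈' o 0 ∧' o 3 ∈' arrS (o 0) boolS
                 ∧' Aℓ 4 (o 4 ∈' o 3 ⟺
                      Ex 5 (Ex 6 (IsPair (o 4) (o 5) (o 6) ∧' o 5 ∈' o 0 ∧' o 6 ∈' boolS
                        ∧' (o 2 ≐ o 5 ⟹ o 6 ≐ topS) ∧' (¬' (o 2 ≐ o 5) ⟹ o 6 ≐ botS)))))))))

infix 2 _⊢ᶠ_
data _⊢ᶠ_ : List Fm → Fm → Set where
  hyp  : ∀ {Γ φ} → φ ∈ Γ → Γ ⊢ᶠ φ
  axm  : ∀ {Γ φ} → Ax φ → Γ ⊢ᶠ φ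
  raa  : ∀ {Γ φ} → (¬' φ ∷ Γ) ⊢ᶠ ⊥' → Γ ⊢ᶠ φ
  ⟹I  : ∀ {Γ φ ψ} → (φ ∷ Γ) ⊢ᶠ ψ → Γ ⊢ᶠ φ ⟹ ψ
  ⟹E  : ∀ {Γ φ ψ} → Γ ⊢ᶠ φ ⟹ ψ → Γ ⊢ᶠ φ → Γ ⊢ᶠ ψ
  ∧I   : ∀ {Γ φ ψ} → Γ ⊢ᶠ φ → Γ ⊢ᶠ ψ → Γ ⊢ᶠ φ ∧' ψ
  ∧E₁  : ∀ {Γ φ ψ} → Γ ⊢ᶠ φ ∧' ψ → Γ ⊢ᶠ φ
  ∧E₂  : ∀ {Γ φ ψ} → Γ ⊢ᶠ φ ∧' ψ → Γ ⊢ᶠ ψ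
  ∨I₁  : ∀ {Γ φ ψ} → Γ ⊢ᶠ φ → Γ ⊢ᶠ φ ∨' ψ
  ∨I₂  : ∀ {Γ φ ψ} → Γ ⊢ᶠ ψ → Γ ⊢ᶠ φ ∨' ψ
  ∨E   : ∀ {Γ φ ψ χ} → Γ ⊢ᶠ φ ∨' ψ → (φ ∷ Γ) ⊢ᶠ χ → (ψ ∷ Γ) ⊢ᶠ χ → Γ ⊢ᶠ χ
  ∀I   : ∀ {Γ φ} (y : FVar) → elemFV y (fvF φ ++ concatMap fvF Γ) ≡ false →
         Γ ⊢ᶠ openF 0 (fvar y) φ → Γ ⊢ᶠ ∀' φ
  ∀E   : ∀ {Γ φ} (t : FTm) → lcT 0 t ≡ true → Γ ⊢ᶠ ∀' φ → Γ ⊢ᶠ openF 0 t φ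
  ∃I   : ∀ {Γ φ} (t : FTm) → lcT 0 t ≡ true → Γ ⊢ᶠ openF 0 t φ → Γ ⊢ᶠ ∃' φ
  ∃E   : ∀ {Γ φ ψ} (y : FVar) → elemFV y (fvF φ ++ fvF ψ ++ concatMap fvF Γ) ≡ false →
         Γ ⊢ᶠ ∃' φ → (openF 0 (fvar y) φ ∷ Γ) ⊢ᶠ ψ → Γ ⊢ᶠ ψ
  ≐refl : ∀ {Γ} (t : FTm) → lcT 0 t ≡ true → Γ ⊢ᶠ t ≐ t
  ≐subst : ∀ {Γ t u} (φ : Fm) → lcT 0 t ≡ true → lcT 0 u ≡ true →
         Γ ⊢ᶠ t ≐ u → Γ ⊢ᶠ openF 0 t φ → Γ ⊢ᶠ openF 0 u φ

FSeq : Set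
FSeq = List Fm × Fm

Provable : FSeq → Set
Provable (Γ , φ) = Γ ⊢ᶠ φ

⌈_⌉ty : HType → FTm
⌈ tvar X ⌉ty = fvar (tyV X)
⌈ bool ⌉ty = boolS
⌈ ind ⌉ty = natS
⌈ A ⇛ B ⌉ty = arrS ⌈ A ⌉ty ⌈ B ⌉ty

hvT : HVar → FTm
hvT (y , B) = fvar (hV y B)

λvar : Term → FTm
λvar t = fvar (lamV t)

⌈_⌉ : Term → FTm
⌈ var x A ⌉ = fvar (hV x A)
⌈ eqc A ⌉ = eS ⌈ A ⌉ty
⌈ app f u ⌉ = appS ⌈ f ⌉ ⌈ u ⌉
⌈ lam x A t ⌉ = foldl appS (λvar (lam x A t)) (map hvT (fv (lam x A t)))

ctxN : Term → List Fm
ctxN t = map (λ X → ¬' (fvar (tyV X) ≐ botS)) (tvsTm t)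

ctxTvars : Term → List HVar
ctxTvars (var x A) = (x , A) ∷ []
ctxTvars (eqc A) = []
ctxTvars (app f u) = ctxTvars f ++ ctxTvars u
ctxTvars (lam x A t) = removeHV (x , A) (ctxTvars t)

ctxT : Term → List Fm
ctxT t = map (λ v → hvT v ∈' ⌈ proj₂ v ⌉ty) (ctxTvars t)

bAll : HVar → Fm → Fm
bAll (y , B) φ = ∀' (closeF 0 (hV y B) (fvar (hV y B) ∈' ⌈ B ⌉ty ⟹ φ))

defλ : ℕ → HType → Term → Fm
defλ x A t =
  (λvar (lam x A t) ∈' foldr (λ v R → arrS ⌈ proj₂ v ⌉ty R) ⌈ ty t ⌉ty vs)
  ∧' foldr bAll (foldl appS (λvar (lam x A t)) (map hvT vs) ≐ ⌈ t ⌉) vs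
  where
  vs : List HVar
  vs = removeHV (x , A) (fv t) ++ ((x , A) ∷ [])

ctxD : Term → List Fm
ctxD (var x A) = []
ctxD (eqc A) = []
ctxD (app f u) = ctxD f ++ ctxD u
ctxD (lam x A t) = ctxD t ++ (defλ x A t ∷ [])

ctx : Term → List Fm
ctx t = ctxN t ++ ctxT t ++ ctxD t

embedSeq : HSeq → FSeq
embedSeq (hs , c) =
  (concatMap ctx hs ++ ctx c ++ map (λ h → ⌈ h ⌉ ≐ topS) hs) , (⌈ c ⌉ ≐ topS)

{-# OPTIONS --safe #-}

-- The value of an HOL term t in an assignment ρ of closed set terms to the
-- first-order variables is ⌈ t ⌉ under ρ.  Where the λ-definitions of t hold,
-- values are well typed and satisfy β; hence, by extensionality of functions,
-- the value does not depend on the choice of the λ's, is invariant under α, and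
-- the value of an instance t[σ] in ρ is that of t in the assignment of the
-- values of σ.  A provable premise may be used at every assignment satisfying
-- its context.  What the context of the conclusion lacks is supplied by ZFC:
-- types are inhabited, and functions defined by HOL terms exist by replacement
-- and separation; absent type variables are read as 𝔹.

module Submission where

-- The obstacle is that a λ-variable is a free variable tied to one syntactic abstraction, and that
-- its definition is only a hypothesis. A premise may need λ-variables that the conclusion lacks,
-- and `t[σ]` has other λ-variables than `t`, so premises and conclusion cannot in general be
-- compared as they stand. What gives room is that derivations are closed under substitution for all
-- free first-order variables, those for types and λ's included.
--
-- Even the λ-variables of the conclusion are chosen anew, and its truth is carried back by
-- extensionality. Two facts make such choices possible. A λ-definition has no free HOL variable, so
-- it survives every change of their values, in particular the passage under a binder. And
-- λ-variables are chosen from the inside outwards, so a new choice never disturbs an older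
-- definition. The function chosen takes its arguments in curried form: it arises from one
-- comprehension per argument, and replacement demands each time that the function of the remaining
-- arguments be unique.

open import Defs
open import Data.Bool using (true; false; _∧_; _∨_; if_then_else_)
open import Data.Bool.Properties using (∧-conicalˡ; ∧-conicalʳ)
open import Data.Empty using (⊥; ⊥-elim)
open import Data.List using (List; []; _∷_; _++_; map; concatMap; foldr; foldl)
open import Data.List.Properties using (foldr-++)
import Data.List.Membership.DecPropositional as DecMembership
open import Data.List.Membership.Propositional using (_∈_; _∉_; find)
open import Data.List.Membership.Propositional.Properties
  using (∈-++⁺ˡ; ∈-++⁺ʳ; ∈-++⁻; ∈-map⁺; ∈-map⁻; ∈-concatMap⁺; ∈-concatMap⁻)
open import Data.List.Relation.Unary.All using (All; []; _∷_)
import Data.List.Relation.Unary.All as All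
open import Data.List.Relation.Unary.Any using (here; there)
import Data.List.Relation.Unary.Any as Any
open import Data.List.Relation.Unary.Unique.Propositional using (Unique; []; _∷_)
open import Data.List.Relation.Unary.Unique.Propositional.Properties using () renaming (++⁺ to Unique-++⁺)
open import Data.Nat using (ℕ; zero; suc; _≡ᵇ_; _⊔_; _≤_; _<_; _∸_; z≤n; s≤s)
import Data.Nat as ℕ
open import Data.Nat.Properties using (≡ᵇ⇒≡; ≡⇒≡ᵇ; m≤m⊔n; m≤n⊔m; ≤-trans; <-irrefl)
open import Data.Product using (_×_; _,_; proj₁; proj₂; ∃)
open import Data.Sum using (_⊎_; inj₁; inj₂)
open import Data.Unit using (⊤)
open import Function using (_∘_; id; it)
open import Relation.Binary.PropositionalEquality using (_≡_; _≢_; refl; sym; trans; cong; cong₂; subst; subst₂)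
open import Relation.Nullary using (Dec; yes; no)
open import Relation.Nullary.Negation using (¬_)
open import Relation.Nullary.Reflects using (Reflects; ofʸ; ofⁿ; fromEquivalence; _×-reflects_; _⊎-reflects_)

open DecMembership ℕ._≟_ using () renaming (_∈?_ to _∈ℕ?_)

-- Boolean tests

mapR : ∀ {P Q : Set} {b} → (P → Q) → (Q → P) → Reflects P b → Reflects Q b
mapR f g (ofʸ p) = ofʸ (f p)
mapR f g (ofⁿ ¬p) = ofⁿ (λ q → ¬p (g q))

trueR : ∀ {P : Set} {b} → Reflects P b → b ≡ true → P
trueR (ofʸ p) refl = p

falseR : ∀ {P : Set} {b} → Reflects P b → b ≡ false → ¬ P
falseR (ofⁿ p) refl = p

R-false : ∀ {P : Set} {b} → Reflects P b → ¬ P → b ≡ false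
R-false (ofʸ p) n = ⊥-elim (n p)
R-false (ofⁿ _) n = refl

R-true : ∀ {P : Set} {b} → Reflects P b → P → b ≡ true
R-true (ofʸ p) _ = refl
R-true (ofⁿ n) p = ⊥-elim (n p)

≡ᵇ-R : ∀ m n → Reflects (m ≡ n) (m ≡ᵇ n)
≡ᵇ-R m n = fromEquivalence (≡ᵇ⇒≡ m n) (≡⇒≡ᵇ m n)

cong-R : ∀ {X Y Z : Set} (f : X → Y → Z) {a c : X} {b d : Y} {p q} →
         (f a b ≡ f c d → a ≡ c × b ≡ d) →
         Reflects (a ≡ c) p → Reflects (b ≡ d) q → Reflects (f a b ≡ f c d) (p ∧ q)
cong-R f inj r s = mapR (λ { (refl , refl) → refl }) inj (r ×-reflects s)

eqTy-R : ∀ A B → Reflects (A ≡ B) (eqTy A B)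
eqTy-R (tvar m) (tvar n) = mapR (cong tvar) (λ { refl → refl }) (≡ᵇ-R m n)
eqTy-R (tvar _) bool = ofⁿ λ ()
eqTy-R (tvar _) ind = ofⁿ λ ()
eqTy-R (tvar _) (_ ⇛ _) = ofⁿ λ ()
eqTy-R bool (tvar _) = ofⁿ λ ()
eqTy-R bool bool = ofʸ refl
eqTy-R bool ind = ofⁿ λ ()
eqTy-R bool (_ ⇛ _) = ofⁿ λ ()
eqTy-R ind (tvar _) = ofⁿ λ ()
eqTy-R ind bool = ofⁿ λ ()
eqTy-R ind ind = ofʸ refl
eqTy-R ind (_ ⇛ _) = ofⁿ λ ()
eqTy-R (_ ⇛ _) (tvar _) = ofⁿ λ ()
eqTy-R (_ ⇛ _) bool = ofⁿ λ ()
eqTy-R (_ ⇛ _) ind = ofⁿ λ ()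
eqTy-R (A ⇛ B) (C ⇛ D) = cong-R _⇛_ (λ { refl → refl , refl }) (eqTy-R A C) (eqTy-R B D)

eqHV-R : ∀ v w → Reflects (v ≡ w) (eqHV v w)
eqHV-R (x , A) (y , B) = cong-R _,_ (λ { refl → refl , refl }) (≡ᵇ-R x y) (eqTy-R A B)

eqTm-R : ∀ s t → Reflects (s ≡ t) (eqTm s t)
eqTm-R (var x A) (var y B) = cong-R var (λ { refl → refl , refl }) (≡ᵇ-R x y) (eqTy-R A B)
eqTm-R (var _ _) (eqc _) = ofⁿ λ ()
eqTm-R (var _ _) (app _ _) = ofⁿ λ ()
eqTm-R (var _ _) (lam _ _ _) = ofⁿ λ ()
eqTm-R (eqc _) (var _ _) = ofⁿ λ ()
eqTm-R (eqc A) (eqc B) = mapR (cong eqc) (λ { refl → refl }) (eqTy-R A B)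
eqTm-R (eqc _) (app _ _) = ofⁿ λ ()
eqTm-R (eqc _) (lam _ _ _) = ofⁿ λ ()
eqTm-R (app _ _) (var _ _) = ofⁿ λ ()
eqTm-R (app _ _) (eqc _) = ofⁿ λ ()
eqTm-R (app f t) (app g u) = cong-R app (λ { refl → refl , refl }) (eqTm-R f g) (eqTm-R t u)
eqTm-R (app _ _) (lam _ _ _) = ofⁿ λ ()
eqTm-R (lam _ _ _) (var _ _) = ofⁿ λ ()
eqTm-R (lam _ _ _) (eqc _) = ofⁿ λ ()
eqTm-R (lam _ _ _) (app _ _) = ofⁿ λ ()
eqTm-R (lam x A s) (lam y B t) =
  mapR (λ { (refl , refl , refl) → refl }) (λ { refl → refl , refl , refl })
       (≡ᵇ-R x y ×-reflects eqTy-R A B ×-reflects eqTm-R s t)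

eqFV-R : ∀ v w → Reflects (v ≡ w) (eqFV v w)
eqFV-R (tyV m) (tyV n) = mapR (cong tyV) (λ { refl → refl }) (≡ᵇ-R m n)
eqFV-R (tyV _) (hV _ _) = ofⁿ λ ()
eqFV-R (tyV _) (lamV _) = ofⁿ λ ()
eqFV-R (tyV _) (oV _) = ofⁿ λ ()
eqFV-R (hV _ _) (tyV _) = ofⁿ λ ()
eqFV-R (hV x A) (hV y B) = cong-R hV (λ { refl → refl , refl }) (≡ᵇ-R x y) (eqTy-R A B)
eqFV-R (hV _ _) (lamV _) = ofⁿ λ ()
eqFV-R (hV _ _) (oV _) = ofⁿ λ ()
eqFV-R (lamV _) (tyV _) = ofⁿ λ ()
eqFV-R (lamV _) (hV _ _) = ofⁿ λ ()
eqFV-R (lamV s) (lamV t) = mapR (cong lamV) (λ { refl → refl }) (eqTm-R s t)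
eqFV-R (lamV _) (oV _) = ofⁿ λ ()
eqFV-R (oV _) (tyV _) = ofⁿ λ ()
eqFV-R (oV _) (hV _ _) = ofⁿ λ ()
eqFV-R (oV _) (lamV _) = ofⁿ λ ()
eqFV-R (oV m) (oV n) = mapR (cong oV) (λ { refl → refl }) (≡ᵇ-R m n)

any-R : ∀ {X : Set} {v w : X} {ws p q} → Reflects (v ≡ w) p → Reflects (v ∈ ws) q → Reflects (v ∈ w ∷ ws) (p ∨ q)
any-R r s = mapR (λ { (inj₁ e) → here e ; (inj₂ i) → there i })
                 (λ { (here e) → inj₁ e ; (there i) → inj₂ i }) (r ⊎-reflects s)

elemFV-R : ∀ v ws → Reflects (v ∈ ws) (elemFV v ws)
elemFV-R v [] = ofⁿ λ ()
elemFV-R v (w ∷ ws) = any-R (eqFV-R v w) (elemFV-R v ws)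

elemHV-R : ∀ v ws → Reflects (v ∈ ws) (elemHV v ws)
elemHV-R v [] = ofⁿ λ ()
elemHV-R v (w ∷ ws) = any-R (eqHV-R v w) (elemHV-R v ws)

-- Parallel substitution for free first-order variables

Env : Set
Env = FVar → FTm

subT : Env → FTm → FTm
subT ρ (fvar w) = ρ w
subT ρ (bvar i) = bvar i
subT ρ (appS s t) = appS (subT ρ s) (subT ρ t)
subT ρ (arrS s t) = arrS (subT ρ s) (subT ρ t)
subT ρ natS = natS
subT ρ botS = botS
subT ρ topS = topS
subT ρ boolS = boolS
subT ρ (eS s) = eS (subT ρ s)

subF : Env → Fm → Fm
subF ρ (s ∈' t) = subT ρ s ∈' subT ρ t
subF ρ (s ≐ t) = subT ρ s ≐ subT ρ t
subF ρ ⊥' = ⊥'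
subF ρ (φ ⟹ ψ) = subF ρ φ ⟹ subF ρ ψ
subF ρ (φ ∧' ψ) = subF ρ φ ∧' subF ρ ψ
subF ρ (φ ∨' ψ) = subF ρ φ ∨' subF ρ ψ
subF ρ (∀' φ) = ∀' (subF ρ φ)
subF ρ (∃' φ) = ∃' (subF ρ φ)

infixl 20 _[_↦_]
_[_↦_] : Env → FVar → FTm → Env
(ρ [ v ↦ t ]) w = if eqFV v w then t else ρ w

upd-same : ∀ ρ v t → (ρ [ v ↦ t ]) v ≡ t
upd-same ρ v t rewrite R-true (eqFV-R v v) refl = refl

upd-other : ∀ ρ v t {w} → v ≢ w → (ρ [ v ↦ t ]) w ≡ ρ w
upd-other ρ v t {w} n rewrite R-false (eqFV-R v w) n = refl

-- A record rather than the bare equation: `lcT 0 t` computes, so instance search could not recover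
-- `t` from it. Likewise `LcE` lets `ρ` be inferred.
record Lc (t : FTm) : Set where
  constructor lc
  field closed : lcT 0 t ≡ true
open Lc public

record LcE (ρ : Env) : Set where
  constructor lcE
  field at : ∀ w → Lc (ρ w)
open LcE public

instance
  lc-fvar : ∀ {w} → Lc (fvar w)
  lc-fvar = lc refl
  lc-nat : Lc natS
  lc-nat = lc refl
  lc-bot : Lc botS
  lc-bot = lc refl
  lc-top : Lc topS
  lc-top = lc refl
  lc-bool : Lc boolS
  lc-bool = lc refl
  lc-app : ∀ {s t} → ⦃ Lc s ⦄ → ⦃ Lc t ⦄ → Lc (appS s t)
  lc-app ⦃ lc p ⦄ ⦃ lc q ⦄ = lc (cong₂ _∧_ p q)
  lc-arr : ∀ {s t} → ⦃ Lc s ⦄ → ⦃ Lc t ⦄ → Lc (arrS s t)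
  lc-arr ⦃ lc p ⦄ ⦃ lc q ⦄ = lc (cong₂ _∧_ p q)
  lc-E : ∀ {s} → ⦃ Lc s ⦄ → Lc (eS s)
  lc-E ⦃ lc p ⦄ = lc p

upd-lc : ∀ {ρ v t} → LcE ρ → Lc t → ∀ w → Lc ((ρ [ v ↦ t ]) w)
upd-lc {ρ} {v} l k w with eqFV v w
... | true = k
... | false = at l w

lcE-upd : ∀ {ρ} → LcE ρ → ∀ v t → ⦃ Lc t ⦄ → LcE (ρ [ v ↦ t ])
lcE-upd l v t ⦃ k ⦄ = lcE (upd-lc {v = v} l k)

lcE-id : LcE fvar
lcE-id = lcE (λ w → lc-fvar)

∧⁻ˡ : ∀ a {b} → a ∧ b ≡ true → a ≡ true
∧⁻ˡ a {b} = ∧-conicalˡ a b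

∧⁻ʳ : ∀ a {b} → a ∧ b ≡ true → b ≡ true
∧⁻ʳ a {b} = ∧-conicalʳ a b

open-lcT : ∀ k u t → lcT 0 t ≡ true → openT k u t ≡ t
open-lcT k u (fvar w) l = refl
open-lcT k u (bvar zero) ()
open-lcT k u (bvar (suc _)) ()
open-lcT k u (appS s t) l =
  cong₂ appS (open-lcT k u s (∧⁻ˡ (lcT 0 s) l))
             (open-lcT k u t (∧⁻ʳ (lcT 0 s) l))
open-lcT k u (arrS s t) l =
  cong₂ arrS (open-lcT k u s (∧⁻ˡ (lcT 0 s) l))
             (open-lcT k u t (∧⁻ʳ (lcT 0 s) l))
open-lcT k u natS l = refl
open-lcT k u botS l = refl
open-lcT k u topS l = refl
open-lcT k u boolS l = refl
open-lcT k u (eS s) l = cong eS (open-lcT k u s l)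

ltᵇ-mono : ∀ i {k k'} → k ≤ k' → ltᵇ i k ≡ true → ltᵇ i k' ≡ true
ltᵇ-mono zero (s≤s p) l = refl
ltᵇ-mono (suc i) (s≤s p) l = ltᵇ-mono i p l

lcT-mono : ∀ {k k'} → k ≤ k' → ∀ t → lcT k t ≡ true → lcT k' t ≡ true
lcT-mono p (fvar w) l = refl
lcT-mono p (bvar i) l = ltᵇ-mono i p l
lcT-mono {k} p (appS s t) l = cong₂ _∧_ (lcT-mono p s (∧⁻ˡ (lcT k s) l)) (lcT-mono p t (∧⁻ʳ (lcT k s) l))
lcT-mono {k} p (arrS s t) l = cong₂ _∧_ (lcT-mono p s (∧⁻ˡ (lcT k s) l)) (lcT-mono p t (∧⁻ʳ (lcT k s) l))
lcT-mono p natS l = refl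
lcT-mono p botS l = refl
lcT-mono p topS l = refl
lcT-mono p boolS l = refl
lcT-mono p (eS s) l = lcT-mono p s l

lcT-sub : ∀ {ρ} → LcE ρ → ∀ k t → lcT k t ≡ true → lcT k (subT ρ t) ≡ true
lcT-sub {ρ} r k (fvar w) l = lcT-mono z≤n (ρ w) (closed (at r w))
lcT-sub r k (bvar i) l = l
lcT-sub r k (appS s t) l = cong₂ _∧_ (lcT-sub r k s (∧⁻ˡ (lcT k s) l)) (lcT-sub r k t (∧⁻ʳ (lcT k s) l))
lcT-sub r k (arrS s t) l = cong₂ _∧_ (lcT-sub r k s (∧⁻ˡ (lcT k s) l)) (lcT-sub r k t (∧⁻ʳ (lcT k s) l))
lcT-sub r k natS l = refl
lcT-sub r k botS l = refl
lcT-sub r k topS l = refl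
lcT-sub r k boolS l = refl
lcT-sub r k (eS s) l = lcT-sub r k s l

lcF-sub : ∀ {ρ} → LcE ρ → ∀ k φ → lcF k φ ≡ true → lcF k (subF ρ φ) ≡ true
lcF-sub r k (s ∈' t) l = cong₂ _∧_ (lcT-sub r k s (∧⁻ˡ (lcT k s) l)) (lcT-sub r k t (∧⁻ʳ (lcT k s) l))
lcF-sub r k (s ≐ t) l = cong₂ _∧_ (lcT-sub r k s (∧⁻ˡ (lcT k s) l)) (lcT-sub r k t (∧⁻ʳ (lcT k s) l))
lcF-sub r k ⊥' l = refl
lcF-sub r k (φ ⟹ ψ) l = cong₂ _∧_ (lcF-sub r k φ (∧⁻ˡ (lcF k φ) l)) (lcF-sub r k ψ (∧⁻ʳ (lcF k φ) l))
lcF-sub r k (φ ∧' ψ) l = cong₂ _∧_ (lcF-sub r k φ (∧⁻ˡ (lcF k φ) l)) (lcF-sub r k ψ (∧⁻ʳ (lcF k φ) l))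
lcF-sub r k (φ ∨' ψ) l = cong₂ _∧_ (lcF-sub r k φ (∧⁻ˡ (lcF k φ) l)) (lcF-sub r k ψ (∧⁻ʳ (lcF k φ) l))
lcF-sub r k (∀' φ) l = lcF-sub r (suc k) φ l
lcF-sub r k (∃' φ) l = lcF-sub r (suc k) φ l

sub-openT : ∀ {ρ} → LcE ρ → ∀ k u t → subT ρ (openT k u t) ≡ openT k (subT ρ u) (subT ρ t)
sub-openT r k u (fvar w) = sym (open-lcT k _ _ (closed (at r w)))
sub-openT r k u (bvar i) with i ≡ᵇ k
... | true = refl
... | false = refl
sub-openT r k u (appS s t) = cong₂ appS (sub-openT r k u s) (sub-openT r k u t)
sub-openT r k u (arrS s t) = cong₂ arrS (sub-openT r k u s) (sub-openT r k u t)
sub-openT r k u natS = refl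
sub-openT r k u botS = refl
sub-openT r k u topS = refl
sub-openT r k u boolS = refl
sub-openT r k u (eS s) = cong eS (sub-openT r k u s)

sub-openF : ∀ {ρ} → LcE ρ → ∀ k u φ → subF ρ (openF k u φ) ≡ openF k (subT ρ u) (subF ρ φ)
sub-openF r k u (s ∈' t) = cong₂ _∈'_ (sub-openT r k u s) (sub-openT r k u t)
sub-openF r k u (s ≐ t) = cong₂ _≐_ (sub-openT r k u s) (sub-openT r k u t)
sub-openF r k u ⊥' = refl
sub-openF r k u (φ ⟹ ψ) = cong₂ _⟹_ (sub-openF r k u φ) (sub-openF r k u ψ)
sub-openF r k u (φ ∧' ψ) = cong₂ _∧'_ (sub-openF r k u φ) (sub-openF r k u ψ)
sub-openF r k u (φ ∨' ψ) = cong₂ _∨'_ (sub-openF r k u φ) (sub-openF r k u ψ)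
sub-openF r k u (∀' φ) = cong ∀' (sub-openF r (suc k) u φ)
sub-openF r k u (∃' φ) = cong ∃' (sub-openF r (suc k) u φ)

ltᵇ-≢ : ∀ i k → ltᵇ i k ≡ true → (i ≡ᵇ k) ≡ false
ltᵇ-≢ zero (suc k) l = refl
ltᵇ-≢ (suc i) (suc k) l = ltᵇ-≢ i k l

-- `lcT k t` keeps the index `k` out of `t`, so after closing it marks exactly the occurrences of
-- `v`. The values of `ρ` are locally closed, hence opening leaves them alone. Binding a variable
-- and then instantiating it is thus an update of the assignment.
open-closeT : ∀ {ρ} → LcE ρ → ∀ k v u t → lcT k t ≡ true →
              openT k u (subT ρ (closeT k v t)) ≡ subT (ρ [ v ↦ u ]) t
open-closeT {ρ} r k v u (fvar w) l with eqFV v w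
... | true rewrite R-true (≡ᵇ-R k k) refl = refl
... | false = open-lcT k u _ (closed (at r w))
open-closeT r k v u (bvar i) l rewrite ltᵇ-≢ i k l = refl
open-closeT r k v u (appS s t) l =
  cong₂ appS (open-closeT r k v u s (∧⁻ˡ (lcT k s) l))
             (open-closeT r k v u t (∧⁻ʳ (lcT k s) l))
open-closeT r k v u (arrS s t) l =
  cong₂ arrS (open-closeT r k v u s (∧⁻ˡ (lcT k s) l))
             (open-closeT r k v u t (∧⁻ʳ (lcT k s) l))
open-closeT r k v u natS l = refl
open-closeT r k v u botS l = refl
open-closeT r k v u topS l = refl
open-closeT r k v u boolS l = refl
open-closeT r k v u (eS s) l = cong eS (open-closeT r k v u s l)

open-closeF : ∀ {ρ} → LcE ρ → ∀ k v u φ → lcF k φ ≡ true →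
              openF k u (subF ρ (closeF k v φ)) ≡ subF (ρ [ v ↦ u ]) φ
open-closeF r k v u (s ∈' t) l =
  cong₂ _∈'_ (open-closeT r k v u s (∧⁻ˡ (lcT k s) l))
             (open-closeT r k v u t (∧⁻ʳ (lcT k s) l))
open-closeF r k v u (s ≐ t) l =
  cong₂ _≐_ (open-closeT r k v u s (∧⁻ˡ (lcT k s) l))
            (open-closeT r k v u t (∧⁻ʳ (lcT k s) l))
open-closeF r k v u ⊥' l = refl
open-closeF r k v u (φ ⟹ ψ) l =
  cong₂ _⟹_ (open-closeF r k v u φ (∧⁻ˡ (lcF k φ) l))
            (open-closeF r k v u ψ (∧⁻ʳ (lcF k φ) l))
open-closeF r k v u (φ ∧' ψ) l =
  cong₂ _∧'_ (open-closeF r k v u φ (∧⁻ˡ (lcF k φ) l))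
             (open-closeF r k v u ψ (∧⁻ʳ (lcF k φ) l))
open-closeF r k v u (φ ∨' ψ) l =
  cong₂ _∨'_ (open-closeF r k v u φ (∧⁻ˡ (lcF k φ) l))
             (open-closeF r k v u ψ (∧⁻ʳ (lcF k φ) l))
open-closeF r k v u (∀' φ) l = cong ∀' (open-closeF r (suc k) v u φ l)
open-closeF r k v u (∃' φ) l = cong ∃' (open-closeF r (suc k) v u φ l)

subT-cong : ∀ {ρ ρ'} t → (∀ {w} → w ∈ fvT t → ρ w ≡ ρ' w) → subT ρ t ≡ subT ρ' t
subT-cong (fvar w) h = h (here refl)
subT-cong (bvar i) h = refl
subT-cong (appS s t) h = cong₂ appS (subT-cong s (h ∘ ∈-++⁺ˡ)) (subT-cong t (h ∘ ∈-++⁺ʳ (fvT s)))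
subT-cong (arrS s t) h = cong₂ arrS (subT-cong s (h ∘ ∈-++⁺ˡ)) (subT-cong t (h ∘ ∈-++⁺ʳ (fvT s)))
subT-cong natS h = refl
subT-cong botS h = refl
subT-cong topS h = refl
subT-cong boolS h = refl
subT-cong (eS s) h = cong eS (subT-cong s h)

subF-cong : ∀ {ρ ρ'} φ → (∀ {w} → w ∈ fvF φ → ρ w ≡ ρ' w) → subF ρ φ ≡ subF ρ' φ
subF-cong (s ∈' t) h = cong₂ _∈'_ (subT-cong s (h ∘ ∈-++⁺ˡ)) (subT-cong t (h ∘ ∈-++⁺ʳ (fvT s)))
subF-cong (s ≐ t) h = cong₂ _≐_ (subT-cong s (h ∘ ∈-++⁺ˡ)) (subT-cong t (h ∘ ∈-++⁺ʳ (fvT s)))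
subF-cong ⊥' h = refl
subF-cong (φ ⟹ ψ) h = cong₂ _⟹_ (subF-cong φ (h ∘ ∈-++⁺ˡ)) (subF-cong ψ (h ∘ ∈-++⁺ʳ (fvF φ)))
subF-cong (φ ∧' ψ) h = cong₂ _∧'_ (subF-cong φ (h ∘ ∈-++⁺ˡ)) (subF-cong ψ (h ∘ ∈-++⁺ʳ (fvF φ)))
subF-cong (φ ∨' ψ) h = cong₂ _∨'_ (subF-cong φ (h ∘ ∈-++⁺ˡ)) (subF-cong ψ (h ∘ ∈-++⁺ʳ (fvF φ)))
subF-cong (∀' φ) h = cong ∀' (subF-cong φ h)
subF-cong (∃' φ) h = cong ∃' (subF-cong φ h)

subT-id : ∀ t → subT fvar t ≡ t
subT-id (fvar w) = refl
subT-id (bvar i) = refl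
subT-id (appS s t) = cong₂ appS (subT-id s) (subT-id t)
subT-id (arrS s t) = cong₂ arrS (subT-id s) (subT-id t)
subT-id natS = refl
subT-id botS = refl
subT-id topS = refl
subT-id boolS = refl
subT-id (eS s) = cong eS (subT-id s)

subF-id : ∀ φ → subF fvar φ ≡ φ
subF-id (s ∈' t) = cong₂ _∈'_ (subT-id s) (subT-id t)
subF-id (s ≐ t) = cong₂ _≐_ (subT-id s) (subT-id t)
subF-id ⊥' = refl
subF-id (φ ⟹ ψ) = cong₂ _⟹_ (subF-id φ) (subF-id ψ)
subF-id (φ ∧' ψ) = cong₂ _∧'_ (subF-id φ) (subF-id ψ)
subF-id (φ ∨' ψ) = cong₂ _∨'_ (subF-id φ) (subF-id ψ)
subF-id (∀' φ) = cong ∀' (subF-id φ)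
subF-id (∃' φ) = cong ∃' (subF-id φ)

closeT-fresh : ∀ k x t → x ∉ fvT t → closeT k x t ≡ t
closeT-fresh k x (fvar w) n rewrite R-false (eqFV-R x w) (n ∘ here) = refl
closeT-fresh k x (bvar i) n = refl
closeT-fresh k x (appS s t) n =
  cong₂ appS (closeT-fresh k x s (n ∘ ∈-++⁺ˡ))
             (closeT-fresh k x t (n ∘ ∈-++⁺ʳ (fvT s)))
closeT-fresh k x (arrS s t) n =
  cong₂ arrS (closeT-fresh k x s (n ∘ ∈-++⁺ˡ))
             (closeT-fresh k x t (n ∘ ∈-++⁺ʳ (fvT s)))
closeT-fresh k x natS n = refl
closeT-fresh k x botS n = refl
closeT-fresh k x topS n = refl
closeT-fresh k x boolS n = refl
closeT-fresh k x (eS s) n = cong eS (closeT-fresh k x s n)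

FreshFor : FVar → Env → List FVar → Set
FreshFor y ρ ws = ∀ {w} → w ∈ ws → y ∉ fvT (ρ w)

-- A value of `ρ` that contains `x'` would be captured by closing at `x'`, whence the freshness. The
-- renaming turns a substituted schema axiom back into an instance of the schema, whose binder has
-- to be named.
sub-closeT : ∀ {ρ} k x x' t → FreshFor x' ρ (fvT t) →
             subT ρ (closeT k x t) ≡ closeT k x' (subT (ρ [ x ↦ fvar x' ]) t)
sub-closeT k x x' (fvar w) n with eqFV x w
... | true rewrite R-true (eqFV-R x' x') refl = refl
... | false = sym (closeT-fresh k x' _ (n (here refl)))
sub-closeT k x x' (bvar i) n = refl
sub-closeT k x x' (appS s t) n =
  cong₂ appS (sub-closeT k x x' s (n ∘ ∈-++⁺ˡ))
             (sub-closeT k x x' t (n ∘ ∈-++⁺ʳ (fvT s)))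
sub-closeT k x x' (arrS s t) n =
  cong₂ arrS (sub-closeT k x x' s (n ∘ ∈-++⁺ˡ))
             (sub-closeT k x x' t (n ∘ ∈-++⁺ʳ (fvT s)))
sub-closeT k x x' natS n = refl
sub-closeT k x x' botS n = refl
sub-closeT k x x' topS n = refl
sub-closeT k x x' boolS n = refl
sub-closeT k x x' (eS s) n = cong eS (sub-closeT k x x' s n)

sub-closeF : ∀ {ρ} k x x' φ → FreshFor x' ρ (fvF φ) →
             subF ρ (closeF k x φ) ≡ closeF k x' (subF (ρ [ x ↦ fvar x' ]) φ)
sub-closeF k x x' (s ∈' t) n =
  cong₂ _∈'_ (sub-closeT k x x' s (n ∘ ∈-++⁺ˡ))
             (sub-closeT k x x' t (n ∘ ∈-++⁺ʳ (fvT s)))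
sub-closeF k x x' (s ≐ t) n =
  cong₂ _≐_ (sub-closeT k x x' s (n ∘ ∈-++⁺ˡ))
            (sub-closeT k x x' t (n ∘ ∈-++⁺ʳ (fvT s)))
sub-closeF k x x' ⊥' n = refl
sub-closeF k x x' (φ ⟹ ψ) n =
  cong₂ _⟹_ (sub-closeF k x x' φ (n ∘ ∈-++⁺ˡ))
            (sub-closeF k x x' ψ (n ∘ ∈-++⁺ʳ (fvF φ)))
sub-closeF k x x' (φ ∧' ψ) n =
  cong₂ _∧'_ (sub-closeF k x x' φ (n ∘ ∈-++⁺ˡ))
             (sub-closeF k x x' ψ (n ∘ ∈-++⁺ʳ (fvF φ)))
sub-closeF k x x' (φ ∨' ψ) n =
  cong₂ _∨'_ (sub-closeF k x x' φ (n ∘ ∈-++⁺ˡ))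
             (sub-closeF k x x' ψ (n ∘ ∈-++⁺ʳ (fvF φ)))
sub-closeF k x x' (∀' φ) n = cong ∀' (sub-closeF (suc k) x x' φ n)
sub-closeF k x x' (∃' φ) n = cong ∃' (sub-closeF (suc k) x x' φ n)

fvT-close : ∀ k v t {w} → w ∈ fvT (closeT k v t) → w ∈ fvT t × v ≢ w
fvT-close k v (fvar u) i with eqFV v u | eqFV-R v u
fvT-close k v (fvar u) () | true | _
fvT-close k v (fvar u) (here refl) | false | ofⁿ n = here refl , n
fvT-close k v (appS s t) i with ∈-++⁻ (fvT (closeT k v s)) i
... | inj₁ j = let (a , b) = fvT-close k v s j in ∈-++⁺ˡ a , b
... | inj₂ j = let (a , b) = fvT-close k v t j in ∈-++⁺ʳ (fvT s) a , b
fvT-close k v (arrS s t) i with ∈-++⁻ (fvT (closeT k v s)) i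
... | inj₁ j = let (a , b) = fvT-close k v s j in ∈-++⁺ˡ a , b
... | inj₂ j = let (a , b) = fvT-close k v t j in ∈-++⁺ʳ (fvT s) a , b
fvT-close k v (eS s) i = fvT-close k v s i

fvF-close : ∀ k v φ {w} → w ∈ fvF (closeF k v φ) → w ∈ fvF φ × v ≢ w
fvF-close k v (s ∈' t) i with ∈-++⁻ (fvT (closeT k v s)) i
... | inj₁ j = let (a , b) = fvT-close k v s j in ∈-++⁺ˡ a , b
... | inj₂ j = let (a , b) = fvT-close k v t j in ∈-++⁺ʳ (fvT s) a , b
fvF-close k v (s ≐ t) i with ∈-++⁻ (fvT (closeT k v s)) i
... | inj₁ j = let (a , b) = fvT-close k v s j in ∈-++⁺ˡ a , b
... | inj₂ j = let (a , b) = fvT-close k v t j in ∈-++⁺ʳ (fvT s) a , b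
fvF-close k v (φ ⟹ ψ) i with ∈-++⁻ (fvF (closeF k v φ)) i
... | inj₁ j = let (a , b) = fvF-close k v φ j in ∈-++⁺ˡ a , b
... | inj₂ j = let (a , b) = fvF-close k v ψ j in ∈-++⁺ʳ (fvF φ) a , b
fvF-close k v (φ ∧' ψ) i with ∈-++⁻ (fvF (closeF k v φ)) i
... | inj₁ j = let (a , b) = fvF-close k v φ j in ∈-++⁺ˡ a , b
... | inj₂ j = let (a , b) = fvF-close k v ψ j in ∈-++⁺ʳ (fvF φ) a , b
fvF-close k v (φ ∨' ψ) i with ∈-++⁻ (fvF (closeF k v φ)) i
... | inj₁ j = let (a , b) = fvF-close k v φ j in ∈-++⁺ˡ a , b
... | inj₂ j = let (a , b) = fvF-close k v ψ j in ∈-++⁺ʳ (fvF φ) a , b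
fvF-close k v (∀' φ) i = fvF-close (suc k) v φ i
fvF-close k v (∃' φ) i = fvF-close (suc k) v φ i

-- Fresh variables

oBound : List FVar → ℕ
oBound [] = 0
oBound (oV n ∷ ws) = suc n ⊔ oBound ws
oBound (_ ∷ ws) = oBound ws

oBound-< : ∀ {n} ws → oV n ∈ ws → n < oBound ws
oBound-< (oV n ∷ ws) (here refl) = m≤m⊔n (suc n) (oBound ws)
oBound-< (oV m ∷ ws) (there i) = ≤-trans (oBound-< ws i) (m≤n⊔m (suc m) (oBound ws))
oBound-< (tyV _ ∷ ws) (there i) = oBound-< ws i
oBound-< (hV _ _ ∷ ws) (there i) = oBound-< ws i
oBound-< (lamV _ ∷ ws) (there i) = oBound-< ws i

fresh : List FVar → FVar
fresh ws = oV (oBound ws)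

fresh-∉ : ∀ ws → fresh ws ∉ ws
fresh-∉ ws i = <-irrefl refl (oBound-< ws i)

fresh-elem : ∀ ws → elemFV (fresh ws) ws ≡ false
fresh-elem ws = R-false (elemFV-R (fresh ws) ws) (fresh-∉ ws)

freshFor : Env → List FVar → FVar
freshFor ρ ws = fresh (concatMap (λ w → fvT (ρ w)) ws)

∈-concatMap : ∀ {X Y : Set} (f : X → List Y) {x y} xs → x ∈ xs → y ∈ f x → y ∈ concatMap f xs
∈-concatMap f xs i j = ∈-concatMap⁺ f (Any.map (λ { refl → j }) i)

freshFor-fresh : ∀ ρ ws → FreshFor (freshFor ρ ws) ρ ws
freshFor-fresh ρ ws i j = fresh-∉ _ (∈-concatMap (λ w → fvT (ρ w)) ws i j)

-- Derivations are closed under substitution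

-- The single axioms are closed formulas, on which `subF` computes to the identity. Only the schemas
-- have parameters: their instances are again instances, for the substituted formula with its bound
-- names refreshed.
Ax-sub : ∀ {ρ φ} → LcE ρ → Ax φ → Ax (subF ρ φ)
Ax-sub r extensionality = extensionality
Ax-sub r foundation = foundation
Ax-sub r pairing = pairing
Ax-sub r union = union
Ax-sub r powerset = powerset
Ax-sub r infinity = infinity
Ax-sub r choice = choice
Ax-sub {ρ} r (separation φ x l) =
  subst (λ ψ → Ax (∀' (∃' (∀' (bvar 0 ∈' bvar 1 ⟺ (bvar 0 ∈' bvar 2 ∧' ψ))))))
        (sym (sub-closeF 0 x x' φ (freshFor-fresh ρ (fvF φ))))
        (separation (subF (ρ [ x ↦ fvar x' ]) φ) x' (lcF-sub (lcE-upd r x (fvar x')) 0 φ l))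
  where x' = freshFor ρ (fvF φ)
Ax-sub {ρ} r (replacement φ x y l) =
  subst₂ (λ ψ₁ ψ₂ → Ax (∀' ((∀' (bvar 0 ∈' bvar 1 ⟹
                ∃' (ψ₁ ∧' ∀' (ψ₂ ⟹ bvar 0 ≐ bvar 1))))
            ⟹ ∃' (∀' (bvar 0 ∈' bvar 2 ⟹
                       ∃' (bvar 0 ∈' bvar 2 ∧' ψ₁))))))
         (sym (eq 1)) (sym (eq 2))
         (replacement (subF ρ'' φ) x' y' (lcF-sub {ρ''} (lcE-upd (lcE-upd r y (fvar y')) x (fvar x')) 0 φ l))
  where
  y' = freshFor ρ (fvF φ)
  ρ' = ρ [ y ↦ fvar y' ]
  -- Chosen against `ρ'`, which already sends `y` to `y'`; so `x'` also differs from `y'` if `y`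
  -- occurs in `φ`.
  x' = freshFor ρ' (fvF φ)
  ρ'' = ρ' [ x ↦ fvar x' ]
  eq : ∀ k → subF ρ (closeF 0 y (closeF k x φ)) ≡ closeF 0 y' (closeF k x' (subF ρ'' φ))
  eq k = trans (sub-closeF 0 y y' (closeF k x φ) (λ i → freshFor-fresh ρ (fvF φ) (proj₁ (fvF-close k x φ i))))
               (cong (closeF 0 y') (sub-closeF k x x' φ (freshFor-fresh ρ' (fvF φ))))
Ax-sub r def-bot = def-bot
Ax-sub r def-top = def-top
Ax-sub r def-bool = def-bool
Ax-sub r def-nat = def-nat
Ax-sub r def-app = def-app
Ax-sub r def-arr = def-arr
Ax-sub r def-E = def-E

subF-fresh : ∀ {ρ} φ {y t} → y ∉ fvF φ → subF (ρ [ y ↦ t ]) φ ≡ subF ρ φ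
subF-fresh {ρ} φ {y} {t} n = subF-cong φ (λ {w} i → upd-other ρ y t (λ { refl → n i }))

infix 4 _⊢[_]_
_⊢[_]_ : List Fm → Env → List Fm → Set
Δ ⊢[ ρ ] Γ = ∀ {ψ} → ψ ∈ Γ → subF ρ ψ ∈ Δ

lift : ∀ {ρ Γ Δ φ} → Δ ⊢[ ρ ] Γ → (subF ρ φ ∷ Δ) ⊢[ ρ ] (φ ∷ Γ)
lift h (here refl) = here refl
lift h (there i) = there (h i)

freshen : ∀ {ρ Γ Δ y y'} → y ∉ concatMap fvF Γ → Δ ⊢[ ρ ] Γ → Δ ⊢[ ρ [ y ↦ fvar y' ] ] Γ
freshen {ρ} {Γ} {Δ} n h {ψ} i = subst (_∈ Δ) (sym (subF-fresh ψ (λ j → n (∈-concatMap fvF Γ i j)))) (h i)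

⊢-cast : ∀ {Γ φ ψ} → φ ≡ ψ → Γ ⊢ᶠ φ → Γ ⊢ᶠ ψ
⊢-cast refl d = d

open-fresh : ∀ {ρ} → LcE ρ → ∀ φ {y y'} → y ∉ fvF φ →
             subF (ρ [ y ↦ fvar y' ]) (openF 0 (fvar y) φ) ≡ openF 0 (fvar y') (subF ρ φ)
open-fresh {ρ} r φ {y} {y'} n =
  trans (sub-openF (lcE-upd r y (fvar y')) 0 (fvar y) φ)
        (cong₂ (openF 0) (upd-same ρ y (fvar y')) (subF-fresh φ n))

-- The eigenvariable `y` of `∀I` or `∃E` may occur in `Δ` or in values of `ρ`. The subderivation is
-- therefore translated under `ρ` updated at `y` to a fresh `y'`; `y` is not free in the context and
-- the formulas concerned, so the update changes nothing there. Keeping `ρ` arbitrary in the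
-- induction replaces a separate renaming of derivations.
⊢-sub : ∀ {ρ Γ Δ φ} → LcE ρ → Δ ⊢[ ρ ] Γ → Γ ⊢ᶠ φ → Δ ⊢ᶠ subF ρ φ
⊢-sub r h (hyp i) = hyp (h i)
⊢-sub r h (axm a) = axm (Ax-sub r a)
⊢-sub r h (raa d) = raa (⊢-sub r (lift h) d)
⊢-sub r h (⟹I d) = ⟹I (⊢-sub r (lift h) d)
⊢-sub r h (⟹E d e) = ⟹E (⊢-sub r h d) (⊢-sub r h e)
⊢-sub r h (∧I d e) = ∧I (⊢-sub r h d) (⊢-sub r h e)
⊢-sub r h (∧E₁ d) = ∧E₁ (⊢-sub r h d)
⊢-sub r h (∧E₂ d) = ∧E₂ (⊢-sub r h d)
⊢-sub r h (∨I₁ d) = ∨I₁ (⊢-sub r h d)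
⊢-sub r h (∨I₂ d) = ∨I₂ (⊢-sub r h d)
⊢-sub r h (∨E d e f) = ∨E (⊢-sub r h d) (⊢-sub r (lift h) e) (⊢-sub r (lift h) f)
⊢-sub {ρ} {Γ} {Δ} r h (∀I {φ = φ} y n d) =
  ∀I y' (fresh-elem (fvF (subF ρ φ) ++ concatMap fvF Δ)) (⊢-cast (open-fresh r φ (m ∘ ∈-++⁺ˡ))
    (⊢-sub (lcE-upd r y (fvar y')) (freshen (m ∘ ∈-++⁺ʳ (fvF φ)) h) d))
  where
  y' = fresh (fvF (subF ρ φ) ++ concatMap fvF Δ)
  m = falseR (elemFV-R y (fvF φ ++ concatMap fvF Γ)) n
⊢-sub {ρ} r h (∀E {φ = φ} t l d) =
  ⊢-cast (sym (sub-openF r 0 t φ)) (∀E (subT ρ t) (lcT-sub r 0 t l) (⊢-sub r h d))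
⊢-sub {ρ} r h (∃I {φ = φ} t l d) =
  ∃I (subT ρ t) (lcT-sub r 0 t l) (⊢-cast (sub-openF r 0 t φ) (⊢-sub r h d))
⊢-sub {ρ} {Γ} {Δ} r h (∃E {φ = φ} {ψ = ψ} y n d e) =
  ∃E y' (fresh-elem (fvF (subF ρ φ) ++ fvF (subF ρ ψ) ++ concatMap fvF Δ)) (⊢-sub r h d)
    (⊢-cast (subF-fresh ψ (m ∘ ∈-++⁺ʳ (fvF φ) ∘ ∈-++⁺ˡ))
      (⊢-sub (lcE-upd r y (fvar y')) h' e))
  where
  y' = fresh (fvF (subF ρ φ) ++ fvF (subF ρ ψ) ++ concatMap fvF Δ)
  m = falseR (elemFV-R y (fvF φ ++ fvF ψ ++ concatMap fvF Γ)) n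
  h' : (openF 0 (fvar y') (subF ρ φ) ∷ Δ) ⊢[ ρ [ y ↦ fvar y' ] ] (openF 0 (fvar y) φ ∷ Γ)
  h' (here refl) = here (open-fresh r φ (m ∘ ∈-++⁺ˡ))
  h' (there i) = there (freshen {Γ = Γ} (m ∘ ∈-++⁺ʳ (fvF φ) ∘ ∈-++⁺ʳ (fvF ψ)) h i)
⊢-sub {ρ} r h (≐refl t l) = ≐refl (subT ρ t) (lcT-sub r 0 t l)
⊢-sub {ρ} r h (≐subst {t = t} {u = u} φ l k d e) =
  ⊢-cast (sym (sub-openF r 0 u φ))
    (≐subst (subF ρ φ) (lcT-sub r 0 t l) (lcT-sub r 0 u k) (⊢-sub r h d)
      (⊢-cast (sub-openF r 0 t φ) (⊢-sub r h e)))

infix 3 _⊑_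
_⊑_ : List Fm → List Fm → Set
Γ ⊑ Δ = ∀ {φ} → Γ ⊢ᶠ φ → Δ ⊢ᶠ φ

-- Translation along the identity substitution renames the eigenvariables that clash with the new
-- hypotheses.
weaken : ∀ {Γ Δ} → (∀ {ψ} → ψ ∈ Γ → ψ ∈ Δ) → Γ ⊑ Δ
weaken {Γ} {Δ} h {φ} d = ⊢-cast (subF-id φ) (⊢-sub lcE-id (λ {ψ} i → subst (_∈ Δ) (sym (subF-id ψ)) (h i)) d)

drop₁ : ∀ {Γ φ} → Γ ⊑ (φ ∷ Γ)
drop₁ = weaken there

cut : ∀ {Γ Δ φ} → (∀ {ψ} → ψ ∈ Γ → Δ ⊢ᶠ ψ) → Γ ⊢ᶠ φ → Δ ⊢ᶠ φ
cut {[]} h d = weaken (λ ()) d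
cut {ψ ∷ Γ} h d = ⟹E (cut (λ i → h (there i)) (⟹I d)) (h (here refl))

⊢-subst : ∀ {ρ Γ Δ φ} → LcE ρ → (∀ {ψ} → ψ ∈ Γ → Δ ⊢ᶠ subF ρ ψ) → Γ ⊢ᶠ φ → Δ ⊢ᶠ subF ρ φ
⊢-subst {ρ} {Γ} {Δ} r h d = cut h' (⊢-sub r (∈-map⁺ (subF ρ)) d)
  where
  h' : ∀ {ψ} → ψ ∈ map (subF ρ) Γ → Δ ⊢ᶠ ψ
  h' i with ∈-map⁻ (subF ρ) i
  ... | _ , j , refl = h j

-- Formulas under an environment for their dangling de Bruijn indices

nth : List FTm → ℕ → FTm
-- An index beyond the list gets a locally closed default, so `lc-nth` holds for every `n`.
nth [] n = botS
nth (t ∷ es) zero = t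
nth (t ∷ es) (suc n) = nth es n

-- All dangling indices are instantiated at once. Iterated `openT` would get stuck on the terms
-- inserted earlier, whereas this function computes on a concrete formula, so that instances of the
-- axioms unfold definitionally.
mopenT : ℕ → List FTm → FTm → FTm
mopenT k es (fvar w) = fvar w
mopenT k es (bvar i) = if ltᵇ i k then bvar i else nth es (i ∸ k)
mopenT k es (appS s t) = appS (mopenT k es s) (mopenT k es t)
mopenT k es (arrS s t) = arrS (mopenT k es s) (mopenT k es t)
mopenT k es natS = natS
mopenT k es botS = botS
mopenT k es topS = topS
mopenT k es boolS = boolS
mopenT k es (eS s) = eS (mopenT k es s)

mopenF : ℕ → List FTm → Fm → Fm
mopenF k es (s ∈' t) = mopenT k es s ∈' mopenT k es t
mopenF k es (s ≐ t) = mopenT k es s ≐ mopenT k es t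
mopenF k es ⊥' = ⊥'
mopenF k es (φ ⟹ ψ) = mopenF k es φ ⟹ mopenF k es ψ
mopenF k es (φ ∧' ψ) = mopenF k es φ ∧' mopenF k es ψ
mopenF k es (φ ∨' ψ) = mopenF k es φ ∨' mopenF k es ψ
mopenF k es (∀' φ) = ∀' (mopenF (suc k) es φ)
mopenF k es (∃' φ) = ∃' (mopenF (suc k) es φ)

data Lcs : List FTm → Set where
  instance
    [] : Lcs []
    cons : ∀ {t es} → ⦃ Lc t ⦄ → ⦃ Lcs es ⦄ → Lcs (t ∷ es)

lc-nth : ∀ {es} → Lcs es → ∀ n → Lc (nth es n)
lc-nth [] n = lc-bot
lc-nth (cons ⦃ l ⦄ ⦃ ls ⦄) zero = l
lc-nth (cons ⦃ l ⦄ ⦃ ls ⦄) (suc n) = lc-nth ls n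

data Compare (i k : ℕ) : Set where
  below : ltᵇ i k ≡ true → ltᵇ i (suc k) ≡ true → (i ≡ᵇ k) ≡ false → Compare i k
  equal : ltᵇ i k ≡ false → ltᵇ i (suc k) ≡ true → (i ≡ᵇ k) ≡ true → i ∸ k ≡ 0 → Compare i k
  above : ltᵇ i k ≡ false → ltᵇ i (suc k) ≡ false → i ∸ k ≡ suc (i ∸ suc k) → Compare i k

compare : ∀ i k → Compare i k
compare zero zero = equal refl refl refl refl
compare zero (suc k) = below refl refl refl
compare (suc i) zero = above refl refl refl
compare (suc i) (suc k) with compare i k
... | below a b c = below a b c
... | equal a b c d = equal a b c d
... | above a b c = above a b c

-- Links the calculus, which opens one index at a time, with `mopenF`: the terms already inserted
-- are locally closed, and opening at `k` passes over them.
open-mopenT : ∀ {es} → Lcs es → ∀ k t s → openT k t (mopenT (suc k) es s) ≡ mopenT k (t ∷ es) s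
open-mopenT l k t (fvar w) = refl
open-mopenT {es} l k t (bvar i) with compare i k
... | below a b c rewrite a | b | c = refl
... | equal a b c d rewrite a | b | c | d = refl
... | above a b c rewrite a | b | c = open-lcT k t _ (closed (lc-nth l (i ∸ suc k)))
open-mopenT l k t (appS s u) = cong₂ appS (open-mopenT l k t s) (open-mopenT l k t u)
open-mopenT l k t (arrS s u) = cong₂ arrS (open-mopenT l k t s) (open-mopenT l k t u)
open-mopenT l k t natS = refl
open-mopenT l k t botS = refl
open-mopenT l k t topS = refl
open-mopenT l k t boolS = refl
open-mopenT l k t (eS s) = cong eS (open-mopenT l k t s)

open-mopenF : ∀ {es} → Lcs es → ∀ k t φ → openF k t (mopenF (suc k) es φ) ≡ mopenF k (t ∷ es) φ
open-mopenF l k t (s ∈' u) = cong₂ _∈'_ (open-mopenT l k t s) (open-mopenT l k t u)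
open-mopenF l k t (s ≐ u) = cong₂ _≐_ (open-mopenT l k t s) (open-mopenT l k t u)
open-mopenF l k t ⊥' = refl
open-mopenF l k t (φ ⟹ ψ) = cong₂ _⟹_ (open-mopenF l k t φ) (open-mopenF l k t ψ)
open-mopenF l k t (φ ∧' ψ) = cong₂ _∧'_ (open-mopenF l k t φ) (open-mopenF l k t ψ)
open-mopenF l k t (φ ∨' ψ) = cong₂ _∨'_ (open-mopenF l k t φ) (open-mopenF l k t ψ)
open-mopenF l k t (∀' φ) = cong ∀' (open-mopenF l (suc k) t φ)
open-mopenF l k t (∃' φ) = cong ∃' (open-mopenF l (suc k) t φ)

mopen-lcT : ∀ {es} k t → lcT k t ≡ true → mopenT k es t ≡ t
mopen-lcT k (fvar w) l = refl
mopen-lcT k (bvar i) l rewrite l = refl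
mopen-lcT k (appS s t) l = cong₂ appS (mopen-lcT k s (∧⁻ˡ (lcT k s) l)) (mopen-lcT k t (∧⁻ʳ (lcT k s) l))
mopen-lcT k (arrS s t) l = cong₂ arrS (mopen-lcT k s (∧⁻ˡ (lcT k s) l)) (mopen-lcT k t (∧⁻ʳ (lcT k s) l))
mopen-lcT k natS l = refl
mopen-lcT k botS l = refl
mopen-lcT k topS l = refl
mopen-lcT k boolS l = refl
mopen-lcT k (eS s) l = cong eS (mopen-lcT k s l)

mopen-lcF : ∀ {es} k φ → lcF k φ ≡ true → mopenF k es φ ≡ φ
mopen-lcF k (s ∈' t) l = cong₂ _∈'_ (mopen-lcT k s (∧⁻ˡ (lcT k s) l)) (mopen-lcT k t (∧⁻ʳ (lcT k s) l))
mopen-lcF k (s ≐ t) l = cong₂ _≐_ (mopen-lcT k s (∧⁻ˡ (lcT k s) l)) (mopen-lcT k t (∧⁻ʳ (lcT k s) l))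
mopen-lcF k ⊥' l = refl
mopen-lcF k (φ ⟹ ψ) l = cong₂ _⟹_ (mopen-lcF k φ (∧⁻ˡ (lcF k φ) l)) (mopen-lcF k ψ (∧⁻ʳ (lcF k φ) l))
mopen-lcF k (φ ∧' ψ) l = cong₂ _∧'_ (mopen-lcF k φ (∧⁻ˡ (lcF k φ) l)) (mopen-lcF k ψ (∧⁻ʳ (lcF k φ) l))
mopen-lcF k (φ ∨' ψ) l = cong₂ _∨'_ (mopen-lcF k φ (∧⁻ˡ (lcF k φ) l)) (mopen-lcF k ψ (∧⁻ʳ (lcF k φ) l))
mopen-lcF k (∀' φ) l = cong ∀' (mopen-lcF (suc k) φ l)
mopen-lcF k (∃' φ) l = cong ∃' (mopen-lcF (suc k) φ l)

-- Natural deduction with hypotheses as Agda variables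

infix 2 _⊩[_]_
-- φ and es are indices so that unification can recover them, which it cannot
-- do from mopenF 0 es φ.
record _⊩[_]_ (Γ : List Fm) (es : List FTm) (φ : Fm) : Set where
  constructor ⟪_⟫
  field raw : Γ ⊢ᶠ mopenF 0 es φ
open _⊩[_]_ public

-- Existence in continuation form, since `∃E` yields a witness only within the derivation of some
-- `χ`. The witness is always a variable and lives in an extended context `Δ`; `Γ ⊑ Δ` carries the
-- earlier facts over.
Some : List Fm → (List Fm → FTm → Set) → Set
Some Γ P = ∀ {χ} → (∀ {Δ} → Γ ⊑ Δ → ∀ y → P Δ (fvar y) → Δ ⊢ᶠ χ) → Γ ⊢ᶠ χ

h₀ : ∀ {Γ φ} → (φ ∷ Γ) ⊢ᶠ φ
h₀ = hyp (here refl)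

⟹i : ∀ {Γ φ ψ} → (∀ {Δ} → Γ ⊑ Δ → Δ ⊢ᶠ φ → Δ ⊢ᶠ ψ) → Γ ⊢ᶠ φ ⟹ ψ
⟹i f = ⟹I (f drop₁ h₀)

∨e : ∀ {Γ φ ψ χ} → Γ ⊢ᶠ φ ∨' ψ → (∀ {Δ} → Γ ⊑ Δ → Δ ⊢ᶠ φ → Δ ⊢ᶠ χ) →
     (∀ {Δ} → Γ ⊑ Δ → Δ ⊢ᶠ ψ → Δ ⊢ᶠ χ) → Γ ⊢ᶠ χ
∨e d f g = ∨E d (f drop₁ h₀) (g drop₁ h₀)

⊥e : ∀ {Γ φ} → Γ ⊢ᶠ ⊥' → Γ ⊢ᶠ φ
⊥e d = raa (drop₁ d)

byContra : ∀ {Γ φ} → (∀ {Δ} → Γ ⊑ Δ → Δ ⊢ᶠ ¬' φ → Δ ⊢ᶠ ⊥') → Γ ⊢ᶠ φ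
byContra f = raa (f drop₁ h₀)

em : ∀ {Γ} φ → Γ ⊢ᶠ φ ∨' ¬' φ
em φ = byContra λ w n → ⟹E n (∨I₂ (⟹i λ w' p → ⟹E (w' n) (∨I₁ p)))

⟺→ : ∀ {Γ φ ψ} → Γ ⊢ᶠ (φ ⟺ ψ) → Γ ⊢ᶠ φ → Γ ⊢ᶠ ψ
⟺→ d = ⟹E (∧E₁ d)

⟺← : ∀ {Γ φ ψ} → Γ ⊢ᶠ (φ ⟺ ψ) → Γ ⊢ᶠ ψ → Γ ⊢ᶠ φ
⟺← d = ⟹E (∧E₂ d)

⟺i : ∀ {Γ φ ψ} → (∀ {Δ} → Γ ⊑ Δ → Δ ⊢ᶠ φ → Δ ⊢ᶠ ψ) → (∀ {Δ} → Γ ⊑ Δ → Δ ⊢ᶠ ψ → Δ ⊢ᶠ φ) →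
     Γ ⊢ᶠ (φ ⟺ ψ)
⟺i f g = ∧I (⟹i f) (⟹i g)

-- A derivation given for every `y` is taken at a fresh one, which settles the eigenvariable
-- condition.
∀I* : ∀ {Γ φ} → (∀ y → Γ ⊢ᶠ openF 0 (fvar y) φ) → Γ ⊢ᶠ ∀' φ
∀I* {Γ} {φ} f = ∀I (fresh ws) (fresh-elem ws) (f (fresh ws))
  where ws = fvF φ ++ concatMap fvF Γ

∃E* : ∀ {Γ φ} → Γ ⊢ᶠ ∃' φ → Some Γ (λ Δ y → Δ ⊢ᶠ openF 0 y φ)
∃E* {Γ} {φ} d {χ} f = ∃E (fresh ws) (fresh-elem ws) d (f drop₁ (fresh ws) h₀)
  where ws = fvF φ ++ fvF χ ++ concatMap fvF Γ

axiom : ∀ {Γ φ} → Ax φ → lcF 0 φ ≡ true → Γ ⊩[ [] ] φ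
axiom {φ = φ} a l = ⟪ ⊢-cast (sym (mopen-lcF 0 φ l)) (axm a) ⟫

∀e : ∀ {Γ es φ} → ⦃ Lcs es ⦄ → ∀ t → ⦃ Lc t ⦄ → Γ ⊩[ es ] ∀' φ → Γ ⊩[ t ∷ es ] φ
∀e {φ = φ} ⦃ ls ⦄ t ⦃ l ⦄ ⟪ d ⟫ = ⟪ ⊢-cast (open-mopenF ls 0 t φ) (∀E t (closed l) d) ⟫

∀i : ∀ {Γ es φ} → ⦃ Lcs es ⦄ → (∀ y → Γ ⊩[ fvar y ∷ es ] φ) → Γ ⊩[ es ] ∀' φ
∀i {φ = φ} ⦃ ls ⦄ f = ⟪ ∀I* (λ y → ⊢-cast (sym (open-mopenF ls 0 (fvar y) φ)) (raw (f y))) ⟫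

∃i : ∀ {Γ es φ} → ⦃ Lcs es ⦄ → ∀ t → ⦃ Lc t ⦄ → Γ ⊩[ t ∷ es ] φ → Γ ⊩[ es ] ∃' φ
∃i {φ = φ} ⦃ ls ⦄ t ⦃ l ⦄ ⟪ d ⟫ = ⟪ ∃I t (closed l) (⊢-cast (sym (open-mopenF ls 0 t φ)) d) ⟫

∃e : ∀ {Γ es φ} → ⦃ Lcs es ⦄ → Γ ⊩[ es ] ∃' φ → Some Γ (λ Δ y → Δ ⊩[ y ∷ es ] φ)
∃e {φ = φ} ⦃ ls ⦄ ⟪ d ⟫ f = ∃E* d (λ w y h → f w y ⟪ ⊢-cast (open-mopenF ls 0 (fvar y) φ) h ⟫)

⇒e : ∀ {Γ es φ ψ} → Γ ⊩[ es ] φ ⟹ ψ → Γ ⊢ᶠ mopenF 0 es φ → Γ ⊩[ es ] ψ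
⇒e ⟪ d ⟫ e = ⟪ ⟹E d e ⟫

⇒i : ∀ {Γ es φ ψ} → (∀ {Δ} → Γ ⊑ Δ → Δ ⊢ᶠ mopenF 0 es φ → Δ ⊩[ es ] ψ) → Γ ⊩[ es ] φ ⟹ ψ
⇒i f = ⟪ ⟹i (λ w h → raw (f w h)) ⟫

∧i : ∀ {Γ es φ ψ} → Γ ⊩[ es ] φ → Γ ⊩[ es ] ψ → Γ ⊩[ es ] φ ∧' ψ
∧i ⟪ d ⟫ ⟪ e ⟫ = ⟪ ∧I d e ⟫

∧e₁ : ∀ {Γ es φ ψ} → Γ ⊩[ es ] φ ∧' ψ → Γ ⊩[ es ] φ
∧e₁ ⟪ d ⟫ = ⟪ ∧E₁ d ⟫

∧e₂ : ∀ {Γ es φ ψ} → Γ ⊩[ es ] φ ∧' ψ → Γ ⊩[ es ] ψ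
∧e₂ ⟪ d ⟫ = ⟪ ∧E₂ d ⟫

upw : ∀ {Γ Δ es φ} → Γ ⊑ Δ → Γ ⊩[ es ] φ → Δ ⊩[ es ] φ
upw w ⟪ d ⟫ = ⟪ w d ⟫

-- Index 0 marks the places to rewrite and `es` holds the terms that stay fixed, so the pattern can
-- be written as a concrete formula.
rew : ∀ {Γ t u} → ⦃ Lc t ⦄ → ⦃ Lc u ⦄ → ∀ es φ → ⦃ Lcs es ⦄ → Γ ⊢ᶠ t ≐ u →
      Γ ⊢ᶠ mopenF 0 (t ∷ es) φ → Γ ⊢ᶠ mopenF 0 (u ∷ es) φ
rew {t = t} {u} ⦃ lt ⦄ ⦃ lu ⦄ es φ ⦃ ls ⦄ e d =
  ⊢-cast (open-mopenF ls 0 u φ)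
    (≐subst (mopenF 1 es φ) (closed lt) (closed lu) e (⊢-cast (sym (open-mopenF ls 0 t φ)) d))

≐-refl : ∀ {Γ} t → ⦃ Lc t ⦄ → Γ ⊢ᶠ t ≐ t
≐-refl t ⦃ l ⦄ = ≐refl t (closed l)

≐-reflexive : ∀ {Γ t u} → ⦃ Lc t ⦄ → t ≡ u → Γ ⊢ᶠ t ≐ u
≐-reflexive {t = t} refl = ≐-refl t

≐-sym : ∀ {Γ t u} → ⦃ Lc t ⦄ → ⦃ Lc u ⦄ → Γ ⊢ᶠ t ≐ u → Γ ⊢ᶠ u ≐ t
≐-sym {t = t} e = rew (t ∷ []) (bvar 0 ≐ bvar 1) e (≐-refl t)

≐-trans : ∀ {Γ t u v} → ⦃ Lc t ⦄ → ⦃ Lc u ⦄ → ⦃ Lc v ⦄ → Γ ⊢ᶠ t ≐ u → Γ ⊢ᶠ u ≐ v → Γ ⊢ᶠ t ≐ v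
≐-trans {t = t} e d = rew (t ∷ []) (bvar 1 ≐ bvar 0) d e

∈-resp : ∀ {Γ t u A} → ⦃ Lc t ⦄ → ⦃ Lc u ⦄ → ⦃ Lc A ⦄ → Γ ⊢ᶠ t ≐ u → Γ ⊢ᶠ t ∈' A → Γ ⊢ᶠ u ∈' A
∈-resp {A = A} e d = rew (A ∷ []) (bvar 0 ∈' bvar 1) e d

∈-respʳ : ∀ {Γ t A B} → ⦃ Lc t ⦄ → ⦃ Lc A ⦄ → ⦃ Lc B ⦄ → Γ ⊢ᶠ A ≐ B → Γ ⊢ᶠ t ∈' A → Γ ⊢ᶠ t ∈' B
∈-respʳ {t = t} e d = rew (t ∷ []) (bvar 1 ∈' bvar 0) e d

app-cong : ∀ {Γ f g a b} → ⦃ Lc f ⦄ → ⦃ Lc g ⦄ → ⦃ Lc a ⦄ → ⦃ Lc b ⦄ →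
           Γ ⊢ᶠ f ≐ g → Γ ⊢ᶠ a ≐ b → Γ ⊢ᶠ appS f a ≐ appS g b
app-cong {f = f} {g} {a} {b} e d =
  rew (appS f a ∷ g ∷ []) (bvar 1 ≐ appS (bvar 2) (bvar 0)) d
    (rew (appS f a ∷ a ∷ []) (bvar 1 ≐ appS (bvar 0) (bvar 2)) e (≐-refl (appS f a)))

-- Sets and ordered pairs

setExt : ∀ {Γ s t} → ⦃ Lc s ⦄ → ⦃ Lc t ⦄ →
         (∀ {Δ} → Γ ⊑ Δ → ∀ y → Δ ⊢ᶠ fvar y ∈' s → Δ ⊢ᶠ fvar y ∈' t) →
         (∀ {Δ} → Γ ⊑ Δ → ∀ y → Δ ⊢ᶠ fvar y ∈' t → Δ ⊢ᶠ fvar y ∈' s) → Γ ⊢ᶠ s ≐ t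
setExt {s = s} {t} f g =
  ⟹E (raw (∀e t (∀e s (axiom extensionality refl))))
     (raw {es = t ∷ s ∷ []} {φ = ∀' (bvar 0 ∈' bvar 2 ⟺ bvar 0 ∈' bvar 1)}
       (∀i λ y → ⟪ ⟺i (λ w → f w y) (λ w → g w y) ⟫))

-- Nested binders, and the schemas of separation and replacement

lcF-mono : ∀ {k k'} → k ≤ k' → ∀ φ → lcF k φ ≡ true → lcF k' φ ≡ true
lcF-mono {k} p (s ∈' t) l = cong₂ _∧_ (lcT-mono p s (∧⁻ˡ (lcT k s) l)) (lcT-mono p t (∧⁻ʳ (lcT k s) l))
lcF-mono {k} p (s ≐ t) l = cong₂ _∧_ (lcT-mono p s (∧⁻ˡ (lcT k s) l)) (lcT-mono p t (∧⁻ʳ (lcT k s) l))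
lcF-mono p ⊥' l = refl
lcF-mono {k} p (φ ⟹ ψ) l = cong₂ _∧_ (lcF-mono p φ (∧⁻ˡ (lcF k φ) l)) (lcF-mono p ψ (∧⁻ʳ (lcF k φ) l))
lcF-mono {k} p (φ ∧' ψ) l = cong₂ _∧_ (lcF-mono p φ (∧⁻ˡ (lcF k φ) l)) (lcF-mono p ψ (∧⁻ʳ (lcF k φ) l))
lcF-mono {k} p (φ ∨' ψ) l = cong₂ _∧_ (lcF-mono p φ (∧⁻ˡ (lcF k φ) l)) (lcF-mono p ψ (∧⁻ʳ (lcF k φ) l))
lcF-mono p (∀' φ) l = lcF-mono (s≤s p) φ l
lcF-mono p (∃' φ) l = lcF-mono (s≤s p) φ l

lcT-close : ∀ j k v t → ltᵇ j k ≡ true → lcT k t ≡ true → lcT k (closeT j v t) ≡ true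
lcT-close j k v (fvar w) p l with eqFV v w
... | true = p
... | false = refl
lcT-close j k v (bvar i) p l = l
lcT-close j k v (appS s t) p l =
  cong₂ _∧_ (lcT-close j k v s p (∧⁻ˡ (lcT k s) l))
            (lcT-close j k v t p (∧⁻ʳ (lcT k s) l))
lcT-close j k v (arrS s t) p l =
  cong₂ _∧_ (lcT-close j k v s p (∧⁻ˡ (lcT k s) l))
            (lcT-close j k v t p (∧⁻ʳ (lcT k s) l))
lcT-close j k v natS p l = refl
lcT-close j k v botS p l = refl
lcT-close j k v topS p l = refl
lcT-close j k v boolS p l = refl
lcT-close j k v (eS s) p l = lcT-close j k v s p l

lcF-close : ∀ j k v φ → ltᵇ j k ≡ true → lcF k φ ≡ true → lcF k (closeF j v φ) ≡ true
lcF-close j k v (s ∈' t) p l =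
  cong₂ _∧_ (lcT-close j k v s p (∧⁻ˡ (lcT k s) l))
            (lcT-close j k v t p (∧⁻ʳ (lcT k s) l))
lcF-close j k v (s ≐ t) p l =
  cong₂ _∧_ (lcT-close j k v s p (∧⁻ˡ (lcT k s) l))
            (lcT-close j k v t p (∧⁻ʳ (lcT k s) l))
lcF-close j k v ⊥' p l = refl
lcF-close j k v (φ ⟹ ψ) p l =
  cong₂ _∧_ (lcF-close j k v φ p (∧⁻ˡ (lcF k φ) l))
            (lcF-close j k v ψ p (∧⁻ʳ (lcF k φ) l))
lcF-close j k v (φ ∧' ψ) p l =
  cong₂ _∧_ (lcF-close j k v φ p (∧⁻ˡ (lcF k φ) l))
            (lcF-close j k v ψ p (∧⁻ʳ (lcF k φ) l))
lcF-close j k v (φ ∨' ψ) p l =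
  cong₂ _∧_ (lcF-close j k v φ p (∧⁻ˡ (lcF k φ) l))
            (lcF-close j k v ψ p (∧⁻ʳ (lcF k φ) l))
lcF-close j k v (∀' φ) p l = lcF-close (suc j) (suc k) v φ p l
lcF-close j k v (∃' φ) p l = lcF-close (suc j) (suc k) v φ p l

lcF-close₁ : ∀ v φ → lcF 0 φ ≡ true → lcF 1 (closeF 0 v φ) ≡ true
lcF-close₁ v φ l = lcF-close 0 1 v φ refl (lcF-mono z≤n φ l)

closeT-comm : ∀ i j x y t → x ≢ y → closeT i y (closeT j x t) ≡ closeT j x (closeT i y t)
closeT-comm i j x y (fvar w) n with eqFV x w in p | eqFV y w in q
... | true | true = ⊥-elim (n (trans (trueR (eqFV-R x w) p) (sym (trueR (eqFV-R y w) q))))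
... | true | false rewrite p = refl
... | false | true rewrite q = refl
... | false | false rewrite p | q = refl
closeT-comm i j x y (bvar k) n = refl
closeT-comm i j x y (appS s t) n = cong₂ appS (closeT-comm i j x y s n) (closeT-comm i j x y t n)
closeT-comm i j x y (arrS s t) n = cong₂ arrS (closeT-comm i j x y s n) (closeT-comm i j x y t n)
closeT-comm i j x y natS n = refl
closeT-comm i j x y botS n = refl
closeT-comm i j x y topS n = refl
closeT-comm i j x y boolS n = refl
closeT-comm i j x y (eS s) n = cong eS (closeT-comm i j x y s n)

closeF-comm : ∀ i j x y φ → x ≢ y → closeF i y (closeF j x φ) ≡ closeF j x (closeF i y φ)
closeF-comm i j x y (s ∈' t) n = cong₂ _∈'_ (closeT-comm i j x y s n) (closeT-comm i j x y t n)
closeF-comm i j x y (s ≐ t) n = cong₂ _≐_ (closeT-comm i j x y s n) (closeT-comm i j x y t n)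
closeF-comm i j x y ⊥' n = refl
closeF-comm i j x y (φ ⟹ ψ) n = cong₂ _⟹_ (closeF-comm i j x y φ n) (closeF-comm i j x y ψ n)
closeF-comm i j x y (φ ∧' ψ) n = cong₂ _∧'_ (closeF-comm i j x y φ n) (closeF-comm i j x y ψ n)
closeF-comm i j x y (φ ∨' ψ) n = cong₂ _∨'_ (closeF-comm i j x y φ n) (closeF-comm i j x y ψ n)
closeF-comm i j x y (∀' φ) n = cong ∀' (closeF-comm (suc i) (suc j) x y φ n)
closeF-comm i j x y (∃' φ) n = cong ∃' (closeF-comm (suc i) (suc j) x y φ n)

mopen-close : ∀ {ρ es} → LcE ρ → ⦃ Lcs es ⦄ → ∀ x t φ → lcF 0 φ ≡ true →
              mopenF 0 (t ∷ es) (subF ρ (closeF 0 x φ)) ≡ subF (ρ [ x ↦ t ]) φ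
mopen-close {ρ} {es} r ⦃ ls ⦄ x t φ l =
  trans (sym (open-mopenF ls 0 t C))
    (trans (cong (openF 0 t) (mopen-lcF 1 C (lcF-sub r 1 (closeF 0 x φ) (lcF-close₁ x φ l))))
      (open-closeF r 0 x t φ l))
  where C = subF ρ (closeF 0 x φ)

-- Exchanging the two closings puts the one for `x` outermost, where opening at its index cancels
-- it; `y` follows. The exchange needs distinct names.
mopen-close₂ : ∀ {ρ es} → LcE ρ → ⦃ Lcs es ⦄ → ∀ x y a b → ⦃ Lc a ⦄ → ∀ φ → x ≢ y → lcF 0 φ ≡ true →
               mopenF 0 (b ∷ a ∷ es) (subF ρ (closeF 0 y (closeF 1 x φ))) ≡ subF (ρ [ x ↦ a ] [ y ↦ b ]) φ
mopen-close₂ {ρ} {es} r ⦃ ls ⦄ x y a b φ n l =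
  trans (cong (λ ψ → mopenF 0 (b ∷ a ∷ es) (subF ρ ψ)) (closeF-comm 0 1 x y φ n))
  (trans (sym (open-mopenF cons 0 b C))
  (trans (cong (openF 0 b) (sym (open-mopenF ls 1 a C)))
  (trans (cong (openF 0 b ∘ openF 1 a) (mopen-lcF 2 C (lcF-sub r 2 (closeF 1 x D) lC)))
  (trans (cong (openF 0 b) (open-closeF r 1 x a D lD))
         (open-closeF (lcE-upd r x a) 0 y b φ l)))))
  where
  D = closeF 0 y φ
  lD = lcF-close₁ y φ l
  C = subF ρ (closeF 1 x D)
  lC = lcF-close 1 2 x D refl (lcF-mono (s≤s z≤n) D lD)

-- In the uniqueness clause of replacement a quantifier stands between those for `x` and for the
-- second value, whence the gap at index 1. `φ` does not mention that index, so inserting `c` there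
-- changes nothing (`open-D`).
mopen-close₃ : ∀ {ρ es} → LcE ρ → ⦃ Lcs es ⦄ → ∀ x y a c b → ⦃ Lc a ⦄ → ⦃ Lc c ⦄ → ∀ φ → x ≢ y → lcF 0 φ ≡ true →
               mopenF 0 (b ∷ c ∷ a ∷ es) (subF ρ (closeF 0 y (closeF 2 x φ))) ≡ subF (ρ [ x ↦ a ] [ y ↦ b ]) φ
mopen-close₃ {ρ} {es} r ⦃ ls ⦄ x y a c b φ n l =
  trans (cong (λ ψ → mopenF 0 (b ∷ c ∷ a ∷ es) (subF ρ ψ)) (closeF-comm 0 2 x y φ n))
  (trans (sym (open-mopenF cons 0 b C))
  (trans (cong (openF 0 b) (sym (open-mopenF cons 1 c C)))
  (trans (cong (openF 0 b ∘ openF 1 c) (sym (open-mopenF ls 2 a C)))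
  (trans (cong (openF 0 b ∘ openF 1 c ∘ openF 2 a) (mopen-lcF 3 C (lcF-sub r 3 (closeF 2 x D) lC)))
  (trans (cong (openF 0 b ∘ openF 1 c) (open-closeF r 2 x a D (lcF-mono (s≤s z≤n) D lD)))
  (trans (cong (openF 0 b) open-D)
         (open-closeF r' 0 y b φ l)))))))
  where
  r' = lcE-upd r x a
  D = closeF 0 y φ
  lD = lcF-close₁ y φ l
  C = subF ρ (closeF 2 x D)
  lC = lcF-close 2 3 x D refl (lcF-mono (s≤s z≤n) D lD)
  E = subF (ρ [ x ↦ a ]) D
  lE = lcF-sub r' 1 D lD
  open-D : openF 1 c E ≡ E
  open-D = trans (cong (openF 1 c) (sym (mopen-lcF 2 E (lcF-mono (s≤s z≤n) E lE))))
             (trans (open-mopenF [] 1 c E) (mopen-lcF 1 E lE))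

sep : ∀ {Γ ρ} → LcE ρ → ∀ φ x A → ⦃ Lc A ⦄ → lcF 0 φ ≡ true →
      Some Γ (λ Δ s → ∀ t → ⦃ Lc t ⦄ → Δ ⊢ᶠ (t ∈' s ⟺ (t ∈' A ∧' subF (ρ [ x ↦ t ]) φ)))
sep {Γ} {ρ} r φ x A l k = ∃e (∀e A base) λ w s h → k w s λ t →
    ⊢-cast (cong (λ ψ → t ∈' fvar s ⟺ (t ∈' A ∧' ψ)) (mopen-close r x t φ l)) (raw (∀e t h))
  where
  C = subF ρ (closeF 0 x φ)
  lC : lcF 3 C ≡ true
  lC = lcF-sub r 3 (closeF 0 x φ) (lcF-mono (s≤s z≤n) (closeF 0 x φ) (lcF-close₁ x φ l))
  base : Γ ⊩[ [] ] ∀' (∃' (∀' (bvar 0 ∈' bvar 1 ⟺ (bvar 0 ∈' bvar 2 ∧' C))))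
  base = ⟪ ⊢-cast (sym (mopen-lcF 0 _ lcs)) (axm (Ax-sub r (separation φ x l))) ⟫
    where
    lcs : lcF 0 (∀' (∃' (∀' (bvar 0 ∈' bvar 1 ⟺ (bvar 0 ∈' bvar 2 ∧' C))))) ≡ true
    lcs = cong₂ _∧_ lC (cong₂ _∧_ lC refl)

-- The schema in terms of assignments. As in the axiom, `G` is only known to contain a value for
-- every argument and may have other elements.
repl : ∀ {Γ ρ} → LcE ρ → ∀ φ x y A → ⦃ Lc A ⦄ → x ≢ y → lcF 0 φ ≡ true →
       (∀ {Δ} → Γ ⊑ Δ → ∀ a → Δ ⊢ᶠ fvar a ∈' A →
         Some Δ (λ Θ p → (Θ ⊢ᶠ subF (ρ [ x ↦ fvar a ] [ y ↦ p ]) φ) ×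
           (∀ {Ξ} → Θ ⊑ Ξ → ∀ q → Ξ ⊢ᶠ subF (ρ [ x ↦ fvar a ] [ y ↦ fvar q ]) φ → Ξ ⊢ᶠ fvar q ≐ p))) →
       Some Γ (λ Δ G → ∀ {Θ} → Δ ⊑ Θ → ∀ a → ⦃ Lc a ⦄ → Θ ⊢ᶠ a ∈' A →
         Some Θ (λ Ξ p → (Ξ ⊢ᶠ p ∈' G) × (Ξ ⊢ᶠ subF (ρ [ x ↦ a ] [ y ↦ p ]) φ)))
repl {Γ} {ρ} r φ x y A n l tot k =
  ∃e (⇒e (∀e A base) (raw total)) λ w G h → k w G λ w' a ha k' →
    ∃e (⇒e (∀e a (upw w' h)) ha) λ w'' p hp →
      k' w'' p (raw (∧e₁ hp) , ⊢-cast (mopen-close₂ r x y a (fvar p) φ n l) (raw (∧e₂ hp)))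
  where
  C₁ = subF ρ (closeF 0 y (closeF 1 x φ))
  C₂ = subF ρ (closeF 0 y (closeF 2 x φ))
  Tot = ∀' (bvar 0 ∈' bvar 1 ⟹ ∃' (C₁ ∧' ∀' (C₂ ⟹ bvar 0 ≐ bvar 1)))
  -- The levels count the quantifiers above each occurrence: `C₁` stands below three in the
  -- hypothesis of the axiom and below four in its conclusion, `C₂` below four.
  l₁ : lcF 4 C₁ ≡ true
  l₁ = lcF-sub r 4 (closeF 0 y (closeF 1 x φ))
         (lcF-close 0 4 y (closeF 1 x φ) refl (lcF-close 1 4 x φ refl (lcF-mono z≤n φ l)))
  l₂ : lcF 4 C₂ ≡ true
  l₂ = lcF-sub r 4 (closeF 0 y (closeF 2 x φ))
         (lcF-close 0 4 y (closeF 2 x φ) refl (lcF-close 2 4 x φ refl (lcF-mono z≤n φ l)))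
  l₁' : lcF 3 C₁ ≡ true
  l₁' = lcF-sub r 3 (closeF 0 y (closeF 1 x φ))
          (lcF-close 0 3 y (closeF 1 x φ) refl (lcF-close 1 3 x φ refl (lcF-mono z≤n φ l)))
  Ax' = ∀' (Tot ⟹ ∃' (∀' (bvar 0 ∈' bvar 2 ⟹ ∃' (bvar 0 ∈' bvar 2 ∧' C₁))))
  base : Γ ⊩[ [] ] Ax'
  base = ⟪ ⊢-cast (sym (mopen-lcF 0 Ax' lcs)) (axm (Ax-sub r (replacement φ x y l))) ⟫
    where
    lcs : lcF 0 Ax' ≡ true
    lcs = cong₂ _∧_ (cong₂ _∧_ l₁' (cong₂ _∧_ l₂ refl)) l₁
  total : Γ ⊩[ A ∷ [] ] Tot
  total = ∀i λ a → ⇒i λ w ha → ⟪ tot w a ha (λ w' p (hp , up) →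
    raw (∃i {es = fvar a ∷ A ∷ []} {φ = C₁ ∧' ∀' (C₂ ⟹ bvar 0 ≐ bvar 1)} (fvar p) (∧i
      ⟪ ⊢-cast (sym (mopen-close₂ r x y (fvar a) (fvar p) φ n l)) hp ⟫
      (∀i λ q → ⇒i λ w'' hq → ⟪ up w'' q (⊢-cast (mopen-close₃ r x y (fvar a) (fvar p) (fvar q) φ n l) hq) ⟫)))) ⟫

-- Kuratowski pairs

isSing : FTm → FTm → Fm
isSing w a = ∀' (bvar 0 ∈' w ⟺ bvar 0 ≐ a)

isUp : FTm → FTm → FTm → Fm
isUp w a b = ∀' (bvar 0 ∈' w ⟺ (bvar 0 ≐ a ∨' bvar 0 ≐ b))

-- The parameters are indices, in the order of the lists `es` used below. Closing the named formulas
-- yields the very de Bruijn bodies to which the axioms unfold, so `isPair` and `pairIn` match them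
-- definitionally.
singφ upφ pairφ pairInφ : Fm
singφ = ∀' (bvar 0 ∈' bvar 2 ⟺ bvar 0 ≐ bvar 1)
upφ = ∀' (bvar 0 ∈' bvar 3 ⟺ (bvar 0 ≐ bvar 2 ∨' bvar 0 ≐ bvar 1))
pairφ = closeF 2 (oV 0) (closeF 1 (oV 1) (closeF 0 (oV 2) (IsPair (o 0) (o 1) (o 2))))
pairInφ = closeF 2 (oV 0) (closeF 1 (oV 1) (closeF 0 (oV 2) (PairIn (o 0) (o 1) (o 2))))

isPair : FTm → FTm → FTm → Fm
isPair p a b = mopenF 0 (b ∷ a ∷ p ∷ []) pairφ

pairIn : FTm → FTm → FTm → Fm
pairIn a b r = mopenF 0 (r ∷ b ∷ a ∷ []) pairInφ

sing-∈ : ∀ {Γ w a} → ⦃ Lc w ⦄ → ⦃ Lc a ⦄ → ∀ z → ⦃ Lc z ⦄ → Γ ⊢ᶠ isSing w a → Γ ⊢ᶠ (z ∈' w ⟺ z ≐ a)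
sing-∈ {w = w} {a} z h = raw (∀e z (⟪_⟫ {es = a ∷ w ∷ []} {φ = singφ} h))

up-∈ : ∀ {Γ w a b} → ⦃ Lc w ⦄ → ⦃ Lc a ⦄ → ⦃ Lc b ⦄ → ∀ z → ⦃ Lc z ⦄ →
       Γ ⊢ᶠ isUp w a b → Γ ⊢ᶠ (z ∈' w ⟺ (z ≐ a ∨' z ≐ b))
up-∈ {w = w} {a} {b} z h = raw (∀e z (⟪_⟫ {es = b ∷ a ∷ w ∷ []} {φ = upφ} h))

pair-∈ : ∀ {Γ p a b} → ⦃ Lc p ⦄ → ⦃ Lc a ⦄ → ⦃ Lc b ⦄ → ∀ z → ⦃ Lc z ⦄ →
         Γ ⊢ᶠ isPair p a b → Γ ⊢ᶠ (z ∈' p ⟺ (isSing z a ∨' isUp z a b))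
pair-∈ {p = p} {a} {b} z h = raw (∀e z (⟪_⟫ {es = b ∷ a ∷ p ∷ []} {φ = pairφ} h))

-- Pairing provides only a set that contains `a` and `b`; separation removes the rest. The names
-- `oV 1` and `oV 2` hold the two terms as parameters.
upair : ∀ {Γ} a b → ⦃ Lc a ⦄ → ⦃ Lc b ⦄ → Some Γ (λ Δ s → Δ ⊢ᶠ isUp s a b)
upair a b k = ∃e (∀e b (∀e a (axiom pairing refl))) λ w c hc →
  sep (lcE-upd (lcE-upd lcE-id (oV 1) a) (oV 2) b) (o 0 ≐ o 1 ∨' o 0 ≐ o 2) (oV 0) (fvar c) refl λ w' s hs →
    k (w' ∘ w) s (raw {es = b ∷ a ∷ fvar s ∷ []} {φ = upφ} (∀i λ z → ⟪ ⟺i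
      (λ v h → ∧E₂ (⟺→ (v (hs (fvar z))) h))
      (λ v h → ⟺← (v (hs (fvar z))) (∧I
        (∨e h (λ v' e → ∈-resp (≐-sym e) (v' (v (w' (∧E₁ (raw hc))))))
              (λ v' e → ∈-resp (≐-sym e) (v' (v (w' (∧E₂ (raw hc)))))))
        h)) ⟫))

up→sing : ∀ {Γ w a} → ⦃ Lc w ⦄ → ⦃ Lc a ⦄ → Γ ⊢ᶠ isUp w a a → Γ ⊢ᶠ isSing w a
up→sing {w = w} {a} h = raw {es = a ∷ w ∷ []} {φ = singφ} (∀i λ z → ⟪ ⟺i
  (λ v m → ∨e (⟺→ (v (up-∈ (fvar z) h)) m) (λ _ e → e) (λ _ e → e))
  (λ v e → ⟺← (v (up-∈ (fvar z) h)) (∨I₁ e)) ⟫)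

up-ext : ∀ {Γ s t a b} → ⦃ Lc s ⦄ → ⦃ Lc t ⦄ → ⦃ Lc a ⦄ → ⦃ Lc b ⦄ → Γ ⊢ᶠ isUp s a b → Γ ⊢ᶠ isUp t a b → Γ ⊢ᶠ s ≐ t
up-ext hs ht = setExt (λ w y m → ⟺← (w (up-∈ (fvar y) ht)) (⟺→ (w (up-∈ (fvar y) hs)) m))
                      (λ w y m → ⟺← (w (up-∈ (fvar y) hs)) (⟺→ (w (up-∈ (fvar y) ht)) m))

sing-ext : ∀ {Γ s t a} → ⦃ Lc s ⦄ → ⦃ Lc t ⦄ → ⦃ Lc a ⦄ → Γ ⊢ᶠ isSing s a → Γ ⊢ᶠ isSing t a → Γ ⊢ᶠ s ≐ t
sing-ext hs ht = setExt (λ w y m → ⟺← (w (sing-∈ (fvar y) ht)) (⟺→ (w (sing-∈ (fvar y) hs)) m))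
                        (λ w y m → ⟺← (w (sing-∈ (fvar y) hs)) (⟺→ (w (sing-∈ (fvar y) ht)) m))

isPair-unique : ∀ {Γ p q a b} → ⦃ Lc p ⦄ → ⦃ Lc q ⦄ → ⦃ Lc a ⦄ → ⦃ Lc b ⦄ →
                Γ ⊢ᶠ isPair p a b → Γ ⊢ᶠ isPair q a b → Γ ⊢ᶠ p ≐ q
isPair-unique hp hq = setExt (λ w y m → ⟺← (w (pair-∈ (fvar y) hq)) (⟺→ (w (pair-∈ (fvar y) hp)) m))
                             (λ w y m → ⟺← (w (pair-∈ (fvar y) hp)) (⟺→ (w (pair-∈ (fvar y) hq)) m))

pair-exists : ∀ {Γ} a b → ⦃ Lc a ⦄ → ⦃ Lc b ⦄ → Some Γ (λ Δ p → Δ ⊢ᶠ isPair p a b)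
pair-exists a b k =
  upair a a λ w₁ s hs → upair a b λ w₂ d hd → upair (fvar s) (fvar d) λ w₃ p hp →
    k (w₃ ∘ w₂ ∘ w₁) p (raw {es = b ∷ a ∷ fvar p ∷ []} {φ = pairφ} (∀i λ z → ⟪ ⟺i
      (λ v m → ∨e (⟺→ (v (up-∈ (fvar z) hp)) m)
        (λ v' e → ∨I₁ (rew (a ∷ []) (∀' (bvar 0 ∈' bvar 1 ⟺ bvar 0 ≐ bvar 2)) (≐-sym e)
          (v' (v (w₃ (w₂ (up→sing hs)))))))
        (λ v' e → ∨I₂ (rew (a ∷ b ∷ []) (∀' (bvar 0 ∈' bvar 1 ⟺ (bvar 0 ≐ bvar 2 ∨' bvar 0 ≐ bvar 3))) (≐-sym e)
          (v' (v (w₃ hd))))))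
      (λ v h → ⟺← (v (up-∈ (fvar z) hp)) (∨e h
        (λ v' e → ∨I₁ (sing-ext e (v' (v (w₃ (w₂ (up→sing hs)))))))
        (λ v' e → ∨I₂ (up-ext e (v' (v (w₃ hd))))))) ⟫))

-- The set `{a}` belongs to `p`, so it is `{c}` or `{c, d}`; either way it contains `c`.
isPair-fst : ∀ {Γ p a b c d} → ⦃ Lc p ⦄ → ⦃ Lc a ⦄ → ⦃ Lc b ⦄ → ⦃ Lc c ⦄ → ⦃ Lc d ⦄ →
             Γ ⊢ᶠ isPair p a b → Γ ⊢ᶠ isPair p c d → Γ ⊢ᶠ a ≐ c
isPair-fst {a = a} {c = c} h k = upair a a λ w s hs →
  ≐-sym (⟺→ (sing-∈ c (up→sing hs)) (
    ∨e (⟺→ (w (pair-∈ (fvar s) k)) (⟺← (w (pair-∈ (fvar s) h)) (∨I₁ (up→sing hs))))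
      (λ v e → ⟺← (sing-∈ c e) (≐-refl c))
      (λ v e → ⟺← (up-∈ c e) (∨I₁ (≐-refl c)))))

-- The set `{a, b}` belongs to `p`, so it is `{a}` or `{a, d}`, and `b` is one of its elements.
isPair-snd∨ : ∀ {Γ p a b d} → ⦃ Lc p ⦄ → ⦃ Lc a ⦄ → ⦃ Lc b ⦄ → ⦃ Lc d ⦄ →
              Γ ⊢ᶠ isPair p a b → Γ ⊢ᶠ isPair p a d → Γ ⊢ᶠ b ≐ a ∨' b ≐ d
isPair-snd∨ {a = a} {b} h k = upair a b λ w s hs →
  ∨e (⟺→ (w (pair-∈ (fvar s) k)) (⟺← (w (pair-∈ (fvar s) h)) (∨I₂ hs)))
     (λ v e → ∨I₁ (⟺→ (sing-∈ b e) (v (⟺← (up-∈ b hs) (∨I₂ (≐-refl b))))))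
     (λ v e → ⟺→ (up-∈ b e) (v (⟺← (up-∈ b hs) (∨I₂ (≐-refl b)))))

isPair-resp₁ : ∀ {Γ p a b c} → ⦃ Lc p ⦄ → ⦃ Lc a ⦄ → ⦃ Lc b ⦄ → ⦃ Lc c ⦄ →
               Γ ⊢ᶠ a ≐ c → Γ ⊢ᶠ isPair p a b → Γ ⊢ᶠ isPair p c b
isPair-resp₁ {p = p} {b = b} e h =
  rew (b ∷ p ∷ []) (closeF 2 (oV 0) (closeF 0 (oV 1) (closeF 1 (oV 2) (IsPair (o 0) (o 1) (o 2))))) e h

isPair-resp₂ : ∀ {Γ p a b c} → ⦃ Lc p ⦄ → ⦃ Lc a ⦄ → ⦃ Lc b ⦄ → ⦃ Lc c ⦄ →
               Γ ⊢ᶠ b ≐ c → Γ ⊢ᶠ isPair p a b → Γ ⊢ᶠ isPair p a c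
isPair-resp₂ {p = p} {a} e h = rew (a ∷ p ∷ []) pairφ e h

-- Both pairs can be given the first component `a`. If `b` equals `a`, exchanging the roles of the
-- pairs shows that `d` equals `a` or `b`, and both cases suffice.
isPair-snd : ∀ {Γ p a b c d} → ⦃ Lc p ⦄ → ⦃ Lc a ⦄ → ⦃ Lc b ⦄ → ⦃ Lc c ⦄ → ⦃ Lc d ⦄ →
             Γ ⊢ᶠ isPair p a b → Γ ⊢ᶠ isPair p c d → Γ ⊢ᶠ b ≐ d
isPair-snd {a = a} {b} {c} {d} h k₀ =
  ∨e (isPair-snd∨ h k)
    (λ v ba → ∨e (v (isPair-snd∨ k h))
      (λ v' da → ≐-trans (v' ba) (≐-sym da))
      (λ v' db → ≐-sym db))
    (λ v bd → bd)
  where k = isPair-resp₁ (≐-sym (isPair-fst h k₀)) k₀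

-- Functions as sets of pairs

⟺→w : ∀ {Γ es φ ψ} → Γ ⊩[ es ] (φ ⟺ ψ) → Γ ⊢ᶠ mopenF 0 es φ → Γ ⊩[ es ] ψ
⟺→w d = ⇒e (∧e₁ d)

⟺←w : ∀ {Γ es φ ψ} → Γ ⊩[ es ] (φ ⟺ ψ) → Γ ⊩[ es ] ψ → Γ ⊢ᶠ mopenF 0 es φ
⟺←w d e = raw (⇒e (∧e₂ d) (raw e))

pairIn-e : ∀ {Γ a b r} → ⦃ Lc a ⦄ → ⦃ Lc b ⦄ → ⦃ Lc r ⦄ → Γ ⊢ᶠ pairIn a b r →
           Some Γ (λ Δ p → (Δ ⊢ᶠ isPair p a b) × (Δ ⊢ᶠ p ∈' r))
pairIn-e {a = a} {b} {r} h k = ∃e (⟪_⟫ {es = r ∷ b ∷ a ∷ []} {φ = pairInφ} h) λ w p m →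
  k w p (raw (∧e₁ m) , raw (∧e₂ m))

pairIn-i : ∀ {Γ a b r} → ⦃ Lc a ⦄ → ⦃ Lc b ⦄ → ⦃ Lc r ⦄ → ∀ p → ⦃ Lc p ⦄ →
           Γ ⊢ᶠ isPair p a b → Γ ⊢ᶠ p ∈' r → Γ ⊢ᶠ pairIn a b r
pairIn-i {a = a} {b} {r} p h m = raw {es = r ∷ b ∷ a ∷ []} {φ = pairInφ} (∃i p ⟪ ∧I h m ⟫)

pairIn-resp₂ : ∀ {Γ a b c r} → ⦃ Lc a ⦄ → ⦃ Lc b ⦄ → ⦃ Lc c ⦄ → ⦃ Lc r ⦄ →
               Γ ⊢ᶠ b ≐ c → Γ ⊢ᶠ pairIn a b r → Γ ⊢ᶠ pairIn a c r
pairIn-resp₂ e h = pairIn-e h λ w p (q , m) → pairIn-i (fvar p) (isPair-resp₂ (w e) q) m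

inProdφ : Fm
inProdφ = closeF 2 (oV 3) (closeF 1 (oV 0) (closeF 0 (oV 1)
  (Ex 4 (Ex 5 (o 4 ∈' o 0 ∧' o 5 ∈' o 1 ∧' IsPair (o 3) (o 4) (o 5))))))

inProd : FTm → FTm → FTm → Fm
inProd p A B = mopenF 0 (B ∷ A ∷ p ∷ []) inProdφ

inProd-i : ∀ {Γ p A B} → ⦃ Lc p ⦄ → ⦃ Lc A ⦄ → ⦃ Lc B ⦄ → ∀ a b → ⦃ Lc a ⦄ → ⦃ Lc b ⦄ →
           Γ ⊢ᶠ a ∈' A → Γ ⊢ᶠ b ∈' B → Γ ⊢ᶠ isPair p a b → Γ ⊢ᶠ inProd p A B
inProd-i {p = p} {A} {B} a b ha hb h =
  raw {es = B ∷ A ∷ p ∷ []} {φ = inProdφ} (∃i a (∃i b ⟪ ∧I ha (∧I hb h) ⟫))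

inProd-e : ∀ {Γ p A B χ} → ⦃ Lc p ⦄ → ⦃ Lc A ⦄ → ⦃ Lc B ⦄ → Γ ⊢ᶠ inProd p A B →
           (∀ {Δ} → Γ ⊑ Δ → ∀ a b → Δ ⊢ᶠ fvar a ∈' A → Δ ⊢ᶠ fvar b ∈' B →
             Δ ⊢ᶠ isPair p (fvar a) (fvar b) → Δ ⊢ᶠ χ) →
           Γ ⊢ᶠ χ
inProd-e {p = p} {A} {B} h k = ∃e (⟪_⟫ {es = B ∷ A ∷ p ∷ []} {φ = inProdφ} h) λ w a m → ∃e m λ w' b m' →
  k (w' ∘ w) a b (raw (∧e₁ m')) (raw (∧e₁ (∧e₂ m'))) (raw (∧e₂ (∧e₂ m')))

module _ {Γ : List Fm} {A B f : FTm} ⦃ lA : Lc A ⦄ ⦃ lB : Lc B ⦄ ⦃ lf : Lc f ⦄ where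

  private
    unfold = ∀e f (∀e B (∀e A (axiom {Γ} def-arr refl)))

  arr-⊆ : Γ ⊢ᶠ f ∈' arrS A B → ∀ p → ⦃ Lc p ⦄ → Γ ⊢ᶠ p ∈' f → Γ ⊢ᶠ inProd p A B
  arr-⊆ h p m = raw (⇒e (∀e p (∧e₁ (⟺→w unfold h))) m)

  arr-total : Γ ⊢ᶠ f ∈' arrS A B → ∀ a → ⦃ Lc a ⦄ → Γ ⊢ᶠ a ∈' A → Some Γ (λ Δ b → Δ ⊢ᶠ pairIn a b f)
  arr-total h a m k = ∃e (⇒e (∀e a (∧e₁ (∧e₂ (⟺→w unfold h)))) m) λ w b e → k w b (raw e)

  arr-i : (∀ {Δ} → Γ ⊑ Δ → ∀ p → Δ ⊢ᶠ fvar p ∈' f → Δ ⊢ᶠ inProd (fvar p) A B) →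
          (∀ {Δ} → Γ ⊑ Δ → ∀ a → Δ ⊢ᶠ fvar a ∈' A → Some Δ (λ Θ b → Θ ⊢ᶠ pairIn (fvar a) b f)) →
          (∀ {Δ} → Γ ⊑ Δ → ∀ a b c → Δ ⊢ᶠ pairIn (fvar a) (fvar b) f → Δ ⊢ᶠ pairIn (fvar a) (fvar c) f →
            Δ ⊢ᶠ fvar b ≐ fvar c) →
          Γ ⊢ᶠ f ∈' arrS A B
  arr-i sub tot fun = ⟺←w unfold (∧i (∀i λ p → ⇒i λ w h → ⟪ sub w p h ⟫) (∧i
    (∀i λ a → ⇒i λ w h → ⟪ tot w a h (λ w' b e → raw (existsPair a b e)) ⟫)
    (∀i λ a → ∀i λ b → ∀i λ c → ⇒i λ w h → ⟪ fun w a b c (∧E₁ h) (∧E₂ h) ⟫)))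
    where
    existsPair : ∀ {Δ} a b → Δ ⊢ᶠ pairIn (fvar a) (fvar b) f → Δ ⊩[ fvar a ∷ f ∷ B ∷ A ∷ [] ]
      ∃' (closeF 2 (oV 2) (closeF 1 (oV 4) (closeF 0 (oV 5) (PairIn (o 4) (o 5) (o 2)))))
    existsPair a b e = ∃i (fvar b) ⟪ e ⟫

  private
    isFun : Γ ⊢ᶠ f ∈' arrS A B → Γ ⊩[ f ∷ [] ] closeF 0 (oV 0) (IsFun (o 0))
    isFun h = ∧i
      (∀i λ p → ⇒i λ w m → ⟪ inProd-e (raw (⇒e (∀e (fvar p) (upw w (∧e₁ (⟺→w unfold h)))) m))
        (λ w' a b _ _ e → raw (exPair p a b e)) ⟫)
      ⟪ raw (∧e₂ (∧e₂ (⟺→w unfold h))) ⟫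
      where
      exPair : ∀ {Δ} p a b → Δ ⊢ᶠ isPair (fvar p) (fvar a) (fvar b) →
               Δ ⊩[ fvar p ∷ f ∷ [] ] closeF 0 (oV 1003) (Ex 1004 (Ex 1005 (IsPair (o 1003) (o 1004) (o 1005))))
      exPair p a b e = ∃i (fvar a) (∃i (fvar b) ⟪ e ⟫)

  -- `def-app` evaluates `appS` only where `IsFun` holds. The clauses of `def-arr` imply it, so the
  -- first disjunct of `def-app` applies.
  app-i : Γ ⊢ᶠ f ∈' arrS A B → ∀ a b → ⦃ Lc a ⦄ → ⦃ Lc b ⦄ → Γ ⊢ᶠ pairIn a b f → Γ ⊢ᶠ appS f a ≐ b
  app-i h a b e = raw (⇒e (∧e₂ (∀e b (∀e a (∀e f (axiom def-app refl))))) (∨I₁ (∧I (raw (isFun h)) e)))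

app-graph : ∀ {Γ A B f} → ⦃ Lc A ⦄ → ⦃ Lc B ⦄ → ⦃ Lc f ⦄ → Γ ⊢ᶠ f ∈' arrS A B →
            ∀ a → ⦃ Lc a ⦄ → Γ ⊢ᶠ a ∈' A → Γ ⊢ᶠ pairIn a (appS f a) f
app-graph h a m = arr-total h a m λ w b e → pairIn-resp₂ (≐-sym (app-i (w h) a (fvar b) e)) e

pairIn-typed : ∀ {Γ A B f} → ⦃ Lc A ⦄ → ⦃ Lc B ⦄ → ⦃ Lc f ⦄ → Γ ⊢ᶠ f ∈' arrS A B →
               ∀ {a b} → ⦃ Lc a ⦄ → ⦃ Lc b ⦄ → Γ ⊢ᶠ pairIn a b f → Γ ⊢ᶠ (a ∈' A ∧' b ∈' B)
pairIn-typed h e = pairIn-e e λ w p (q , m) → inProd-e (arr-⊆ (w h) (fvar p) m) λ w' a b ha hb q' →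
  ∧I (∈-resp (isPair-fst q' (w' q)) ha) (∈-resp (isPair-snd q' (w' q)) hb)

app-typed : ∀ {Γ A B f a} → ⦃ Lc A ⦄ → ⦃ Lc B ⦄ → ⦃ Lc f ⦄ → ⦃ Lc a ⦄ →
            Γ ⊢ᶠ f ∈' arrS A B → Γ ⊢ᶠ a ∈' A → Γ ⊢ᶠ appS f a ∈' B
app-typed {a = a} h m = ∧E₂ (pairIn-typed h (app-graph h a m))

-- An element `p` of `f` is a pair of some `a` with `f a`, which equals `g a`. The graph of `g`
-- holds a pair with these components, and by uniqueness of pairs it is `p`.
fun-⊆ : ∀ {Γ A B f g} → ⦃ Lc A ⦄ → ⦃ Lc B ⦄ → ⦃ Lc f ⦄ → ⦃ Lc g ⦄ →
        Γ ⊢ᶠ f ∈' arrS A B → Γ ⊢ᶠ g ∈' arrS A B →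
        (∀ {Δ} → Γ ⊑ Δ → ∀ a → Δ ⊢ᶠ fvar a ∈' A → Δ ⊢ᶠ appS f (fvar a) ≐ appS g (fvar a)) →
        ∀ p → Γ ⊢ᶠ fvar p ∈' f → Γ ⊢ᶠ fvar p ∈' g
fun-⊆ hf hg e p m = inProd-e (arr-⊆ hf (fvar p) m) λ w a b ha hb q →
  pairIn-e (app-graph (w hg) (fvar a) ha) λ w' r (q' , m') →
    ∈-resp (isPair-unique (isPair-resp₂ (≐-trans (≐-sym (w' (e w a ha)))
              (w' (app-i (w hf) (fvar a) (fvar b) (pairIn-i (fvar p) q (w m))))) q') (w' q)) m'

fun-ext : ∀ {Γ A B f g} → ⦃ Lc A ⦄ → ⦃ Lc B ⦄ → ⦃ Lc f ⦄ → ⦃ Lc g ⦄ →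
          Γ ⊢ᶠ f ∈' arrS A B → Γ ⊢ᶠ g ∈' arrS A B →
          (∀ {Δ} → Γ ⊑ Δ → ∀ a → Δ ⊢ᶠ fvar a ∈' A → Δ ⊢ᶠ appS f (fvar a) ≐ appS g (fvar a)) →
          Γ ⊢ᶠ f ≐ g
fun-ext hf hg e =
  setExt (λ w → fun-⊆ (w hf) (w hg) (λ w' → e (w' ∘ w)))
         (λ w → fun-⊆ (w hg) (w hf) (λ w' a m → ≐-sym (e (w' ∘ w) a m)))

-- Comprehension for functions

rewE : ∀ {Γ ρ t u} → LcE ρ → ⦃ Lc t ⦄ → ⦃ Lc u ⦄ → ∀ v φ → lcF 0 φ ≡ true → Γ ⊢ᶠ t ≐ u →
       Γ ⊢ᶠ subF (ρ [ v ↦ t ]) φ → Γ ⊢ᶠ subF (ρ [ v ↦ u ]) φ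
rewE {ρ = ρ} {t} {u} r ⦃ lt ⦄ ⦃ lu ⦄ v φ l e d =
  ⊢-cast (open-closeF r 0 v u φ l)
    (≐subst (subF ρ (closeF 0 v φ)) (closed lt) (closed lu) e
      (⊢-cast (sym (open-closeF r 0 v t φ l)) d))

upd-comm : ∀ ρ v w t u → v ≢ w → ∀ x → (ρ [ v ↦ t ] [ w ↦ u ]) x ≡ (ρ [ w ↦ u ] [ v ↦ t ]) x
upd-comm ρ v w t u n x with eqFV v x in p | eqFV w x in q
... | true | true = ⊥-elim (n (trans (trueR (eqFV-R v x) p) (sym (trueR (eqFV-R w x) q))))
... | true | false = refl
... | false | true = refl
... | false | false = refl

-- oV 0 stands for the value of the function; the other oV's are reserved
-- for auxiliary variables.
module Comprehension {Γ : List Fm} {ρ : Env} (r : LcE ρ) (φ : Fm) (x : ℕ) (X : HType) (A B : FTm)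
  ⦃ lA : Lc A ⦄ ⦃ lB : Lc B ⦄ (l : lcF 0 φ ≡ true) (noV : ∀ n → oV (suc n) ∉ fvF φ) where

  Φ : FTm → FTm → Fm
  Φ a b = subF (ρ [ hV x X ↦ a ] [ oV 0 ↦ b ]) φ

  private
    -- The domain enters `χ` as a variable: if `A` were written there directly, an occurrence of
    -- `hV x X` in it would be captured by the quantifier.
    ρ₀ = ρ [ oV 2 ↦ A ]
    r₀ = lcE-upd r (oV 2) A

    pairBody : Fm
    pairBody = isPair (o 1) (fvar (hV x X)) (o 0) ∧' φ

    ψ : Fm
    ψ = ∃' (closeF 0 (oV 0) pairBody)

    l-ψ : lcF 0 ψ ≡ true
    l-ψ = lcF-close₁ (oV 0) pairBody l

    χ : Fm
    χ = ∃' (closeF 0 (hV x X) (fvar (hV x X) ∈' o 2 ∧' ψ))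

    l-χ : lcF 0 χ ≡ true
    l-χ = lcF-close₁ (hV x X) (fvar (hV x X) ∈' o 2 ∧' ψ) l-ψ

    Φ-cong : ∀ {ρ'} a b → (∀ w → (∀ n → w ≢ oV (suc n)) → ρ' w ≡ (ρ [ hV x X ↦ a ] [ oV 0 ↦ b ]) w) →
      subF ρ' φ ≡ Φ a b
    Φ-cong a b e = subF-cong φ (λ {w} i → e w (λ { n refl → noV n i }))

    bodyEnv : FTm → FTm → FTm → Env
    bodyEnv p a b = ρ₀ [ hV x X ↦ a ] [ oV 1 ↦ p ] [ oV 0 ↦ b ]

    body-eq : ∀ p a b → subF (bodyEnv p a b) pairBody ≡ (isPair p a b ∧' Φ a b)
    body-eq p a b = cong₂ _∧'_ (cong (λ c → isPair p c b) (upd-same ρ₀ (hV x X) a)) (Φ-cong a b same)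
      where
      same : ∀ w → (∀ n → w ≢ oV (suc n)) → bodyEnv p a b w ≡ (ρ [ hV x X ↦ a ] [ oV 0 ↦ b ]) w
      same (oV zero) n = refl
      same (oV (suc m)) n = ⊥-elim (n m refl)
      same (tyV _) n = refl
      same (hV y Y) n = refl
      same (lamV _) n = refl

    r₁ : ∀ a p → ⦃ Lc a ⦄ → ⦃ Lc p ⦄ → LcE (ρ₀ [ hV x X ↦ a ] [ oV 1 ↦ p ])
    r₁ a p = lcE-upd (lcE-upd r₀ (hV x X) a) (oV 1) p

    ψ-i : ∀ {Δ} p a b → ⦃ Lc p ⦄ → ⦃ Lc a ⦄ → ⦃ Lc b ⦄ → Δ ⊢ᶠ isPair p a b → Δ ⊢ᶠ Φ a b →
          Δ ⊢ᶠ subF (ρ₀ [ hV x X ↦ a ] [ oV 1 ↦ p ]) ψ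
    ψ-i p a b ⦃ _ ⦄ ⦃ _ ⦄ ⦃ lb ⦄ h k = ∃I b (closed lb)
      (⊢-cast (sym (trans (open-closeF (r₁ a p) 0 (oV 0) b pairBody l) (body-eq p a b))) (∧I h k))

    ψ-e : ∀ {Δ} p a → ⦃ Lc p ⦄ → ⦃ Lc a ⦄ → Δ ⊢ᶠ subF (ρ₀ [ hV x X ↦ a ] [ oV 1 ↦ p ]) ψ →
          Some Δ (λ Θ b → (Θ ⊢ᶠ isPair p a b) × (Θ ⊢ᶠ Φ a b))
    ψ-e p a h k = ∃E* h λ w b m →
      let m' = ⊢-cast (trans (open-closeF (r₁ a p) 0 (oV 0) (fvar b) pairBody l) (body-eq p a (fvar b))) m
      in k w b (∧E₁ m' , ∧E₂ m')

    χ-eq : ∀ p a → subF (ρ₀ [ oV 1 ↦ p ] [ hV x X ↦ a ]) (fvar (hV x X) ∈' o 2 ∧' ψ) ≡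
                   (a ∈' A ∧' subF (ρ₀ [ hV x X ↦ a ] [ oV 1 ↦ p ]) ψ)
    χ-eq p a = cong₂ _∧'_ (cong (_∈' A) (upd-same (ρ₀ [ oV 1 ↦ p ]) (hV x X) a))
                          (subF-cong ψ (λ {w} _ → upd-comm ρ₀ (oV 1) (hV x X) p a (λ ()) w))

    χ-i : ∀ {Δ} p a → ⦃ Lc p ⦄ → ⦃ Lc a ⦄ → Δ ⊢ᶠ a ∈' A →
          Δ ⊢ᶠ subF (ρ₀ [ hV x X ↦ a ] [ oV 1 ↦ p ]) ψ → Δ ⊢ᶠ subF (ρ₀ [ oV 1 ↦ p ]) χ
    χ-i p a ⦃ lp ⦄ ⦃ la ⦄ h k = ∃I a (closed la)
      (⊢-cast (sym (trans (open-closeF (lcE-upd r₀ (oV 1) p) 0 (hV x X) a (fvar (hV x X) ∈' o 2 ∧' ψ) l-ψ)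
                          (χ-eq p a))) (∧I h k))

    χ-e : ∀ {Δ} p → ⦃ Lc p ⦄ → Δ ⊢ᶠ subF (ρ₀ [ oV 1 ↦ p ]) χ →
          Some Δ (λ Θ a → (Θ ⊢ᶠ a ∈' A) × (Θ ⊢ᶠ subF (ρ₀ [ hV x X ↦ a ] [ oV 1 ↦ p ]) ψ))
    χ-e p h k = ∃E* h λ w a m →
      let m' = ⊢-cast (trans (open-closeF (lcE-upd r₀ (oV 1) p) 0 (hV x X) (fvar a)
                                (fvar (hV x X) ∈' o 2 ∧' ψ) l-ψ) (χ-eq p (fvar a))) m
      in k w a (∧E₁ m' , ∧E₂ m')

    Φ-resp : ∀ {Δ a b a' b'} → ⦃ Lc a ⦄ → ⦃ Lc b ⦄ → ⦃ Lc a' ⦄ → ⦃ Lc b' ⦄ →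
             Δ ⊢ᶠ a ≐ a' → Δ ⊢ᶠ b ≐ b' → Δ ⊢ᶠ Φ a b → Δ ⊢ᶠ Φ a' b'
    Φ-resp {a = a} {b} {a'} {b'} e d h =
      rewE (lcE-upd r (hV x X) a') (oV 0) φ l d
        (⊢-cast (subF-cong φ (λ {w} _ → sym (upd-comm ρ (hV x X) (oV 0) a' b (λ ()) w)))
          (rewE (lcE-upd r (oV 0) b) (hV x X) φ l e
            (⊢-cast (subF-cong φ (λ {w} _ → upd-comm ρ (hV x X) (oV 0) a b (λ ()) w)) h)))

  -- Replacement is applied to `ψ`, which sends `a` to the pair of `a` and its value; `oV 1` names
  -- the pair. The resulting `G` covers the graph but may contain more, so separation by `χ` keeps
  -- only the pairs that `ψ` assigns to some element of `A`.
  comprehension :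
    (∀ {Δ} → Γ ⊑ Δ → ∀ a → Δ ⊢ᶠ fvar a ∈' A → Some Δ (λ Θ b → Θ ⊢ᶠ Φ (fvar a) b)) →
    (∀ {Δ} → Γ ⊑ Δ → ∀ a b → Δ ⊢ᶠ fvar a ∈' A → Δ ⊢ᶠ Φ (fvar a) (fvar b) → Δ ⊢ᶠ fvar b ∈' B) →
    (∀ {Δ} → Γ ⊑ Δ → ∀ a b c → Δ ⊢ᶠ fvar a ∈' A → Δ ⊢ᶠ Φ (fvar a) (fvar b) → Δ ⊢ᶠ Φ (fvar a) (fvar c) →
      Δ ⊢ᶠ fvar b ≐ fvar c) →
    Some Γ (λ Δ f → (Δ ⊢ᶠ f ∈' arrS A B) ×
      (∀ {Θ} → Δ ⊑ Θ → ∀ a → ⦃ Lc a ⦄ → Θ ⊢ᶠ a ∈' A → Θ ⊢ᶠ Φ a (appS f a)))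
  comprehension ex typ uniq k =
    repl r₀ ψ (hV x X) (oV 1) A (λ ()) l-ψ
      (λ w a ha k' → ex w a ha λ w₁ b hb → pair-exists (fvar a) (fvar b) λ w₂ p hp →
        k' (w₂ ∘ w₁) p (ψ-i (fvar p) (fvar a) (fvar b) hp (w₂ hb) ,
          λ w₃ q hq → ψ-e (fvar q) (fvar a) hq λ w₄ c (hqc , hc) →
            isPair-unique
              (isPair-resp₂ (uniq (w₄ ∘ w₃ ∘ w₂ ∘ w₁ ∘ w) a c b (w₄ (w₃ (w₂ (w₁ ha)))) hc (w₄ (w₃ (w₂ hb)))) hqc)
              (w₄ (w₃ hp))))
      λ w G hG → sep r₀ χ (oV 1) (fvar G) l-χ λ w' R hR →
        let open Graph (w' ∘ w) (fvar G) (fvar R) (λ v → hG (v ∘ w')) hR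
        in k (w' ∘ w) R (R-arr , λ v a ha → ∧E₁ (R-pair v (app-graph (v R-arr) a ha)))
    where
    module Graph {Δ} (w : Γ ⊑ Δ) (G R : FTm) ⦃ lG : Lc G ⦄ ⦃ lR : Lc R ⦄
      (hG : ∀ {Θ} → Δ ⊑ Θ → ∀ a → ⦃ Lc a ⦄ → Θ ⊢ᶠ a ∈' A →
        Some Θ (λ Ξ p → (Ξ ⊢ᶠ p ∈' G) × (Ξ ⊢ᶠ subF (ρ₀ [ hV x X ↦ a ] [ oV 1 ↦ p ]) ψ)))
      (hR : ∀ t → ⦃ Lc t ⦄ → Δ ⊢ᶠ (t ∈' R ⟺ (t ∈' G ∧' subF (ρ₀ [ oV 1 ↦ t ]) χ))) where

      R-e : ∀ {Θ ξ} → Δ ⊑ Θ → ∀ p → ⦃ Lc p ⦄ → Θ ⊢ᶠ p ∈' R →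
            (∀ {Ξ} → Θ ⊑ Ξ → ∀ a b → Ξ ⊢ᶠ isPair p (fvar a) (fvar b) → Ξ ⊢ᶠ fvar a ∈' A →
              Ξ ⊢ᶠ Φ (fvar a) (fvar b) → Ξ ⊢ᶠ ξ) → Θ ⊢ᶠ ξ
      R-e v p h k = χ-e p (∧E₂ (⟺→ (v (hR p)) h)) λ w₁ a (ha , hψ) →
        ψ-e p (fvar a) hψ λ w₂ b (hp , hb) → k (w₂ ∘ w₁) a b hp (w₂ ha) hb

      R-pair : ∀ {Θ} → Δ ⊑ Θ → ∀ {a b} → ⦃ Lc a ⦄ → ⦃ Lc b ⦄ → Θ ⊢ᶠ pairIn a b R → Θ ⊢ᶠ Φ a b ∧' a ∈' A
      R-pair v h = pairIn-e h λ w₁ p (hp , m) → R-e (w₁ ∘ v) (fvar p) m λ w₂ a b hp' ha hb →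
        ∧I (Φ-resp (isPair-fst hp' (w₂ hp)) (isPair-snd hp' (w₂ hp)) hb) (∈-resp (isPair-fst hp' (w₂ hp)) ha)

      R-total : ∀ {Θ} → Δ ⊑ Θ → ∀ a → Θ ⊢ᶠ fvar a ∈' A → Some Θ (λ Ξ b → Ξ ⊢ᶠ pairIn (fvar a) b R)
      R-total v a ha k = hG v (fvar a) ha λ w₁ p (hp , hψ) → ψ-e (fvar p) (fvar a) hψ λ w₂ b (hab , _) →
        k (w₂ ∘ w₁) b (pairIn-i (fvar p) hab
          (⟺← (w₂ (w₁ (v (hR (fvar p))))) (∧I (w₂ hp) (w₂ (χ-i (fvar p) (fvar a) (w₁ ha) hψ)))))

      R-arr : Δ ⊢ᶠ R ∈' arrS A B
      R-arr = arr-i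
        (λ v p h → R-e v (fvar p) h λ w₁ a b hp ha hb →
          inProd-i (fvar a) (fvar b) ha (typ (w₁ ∘ v ∘ w) a b ha hb) hp)
        R-total
        (λ v a b c h h' → uniq (v ∘ w) a b c (∧E₂ (R-pair v h)) (∧E₁ (R-pair v h)) (∧E₁ (R-pair v h')))

-- Booleans, natural numbers and equality

top∈bool : ∀ {Γ} → Γ ⊢ᶠ topS ∈' boolS
top∈bool = ⟺← (raw (∀e topS (axiom def-bool refl))) (∨I₂ (≐-refl topS))

bot∈bool : ∀ {Γ} → Γ ⊢ᶠ botS ∈' boolS
bot∈bool = ⟺← (raw (∀e botS (axiom def-bool refl))) (∨I₁ (≐-refl botS))

bool-cases : ∀ {Γ b} → ⦃ Lc b ⦄ → Γ ⊢ᶠ b ∈' boolS → Γ ⊢ᶠ b ≐ botS ∨' b ≐ topS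
bool-cases {b = b} = ⟺→ (raw (∀e b (axiom def-bool refl)))

∉bot : ∀ {Γ} t → ⦃ Lc t ⦄ → Γ ⊢ᶠ t ∈' botS → Γ ⊢ᶠ ⊥'
∉bot t h = ⟹E (raw (∀e t (axiom def-bot refl))) h

top≢bot : ∀ {Γ} → Γ ⊢ᶠ topS ≐ botS → Γ ⊢ᶠ ⊥'
top≢bot e = ∉bot botS (∈-respʳ e (⟺← (raw (∀e botS (axiom def-top refl))) (≐-refl botS)))

bool-ext : ∀ {Γ b c} → ⦃ Lc b ⦄ → ⦃ Lc c ⦄ → Γ ⊢ᶠ b ∈' boolS → Γ ⊢ᶠ c ∈' boolS →
           (∀ {Δ} → Γ ⊑ Δ → Δ ⊢ᶠ b ≐ topS → Δ ⊢ᶠ c ≐ topS) →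
           (∀ {Δ} → Γ ⊑ Δ → Δ ⊢ᶠ c ≐ topS → Δ ⊢ᶠ b ≐ topS) → Γ ⊢ᶠ b ≐ c
bool-ext hb hc f g = ∨e (bool-cases hc)
  (λ w c⊥ → ∨e (bool-cases (w hb))
    (λ w' b⊥ → ≐-trans b⊥ (≐-sym (w' c⊥)))
    (λ w' b⊤ → ⊥e (top≢bot (≐-trans (≐-sym (f (w' ∘ w) b⊤)) (w' c⊥)))))
  (λ w c⊤ → ≐-trans (g w c⊤) (≐-sym c⊤))

zero∈nat : ∀ {Γ} → Γ ⊢ᶠ botS ∈' natS
zero∈nat = ⟺←w (∀e botS (axiom def-nat refl)) (∀i λ I → ⇒i λ w h → ⟪ ∧E₁ h ⟫)

inhabited : FTm → Fm
inhabited A = ∃' (bvar 0 ∈' A)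

inhabited-i : ∀ {Γ A} → ⦃ Lc A ⦄ → ∀ t → ⦃ Lc t ⦄ → Γ ⊢ᶠ t ∈' A → Γ ⊢ᶠ inhabited A
inhabited-i {A = A} t h = raw {es = A ∷ []} (∃i {φ = bvar 0 ∈' bvar 1} t ⟪ h ⟫)

inhabited-e : ∀ {Γ A} → ⦃ Lc A ⦄ → Γ ⊢ᶠ inhabited A → Some Γ (λ Δ y → Δ ⊢ᶠ y ∈' A)
inhabited-e {A = A} h k = ∃e (⟪_⟫ {es = A ∷ []} {φ = ∃' (bvar 0 ∈' bvar 1)} h) λ w y m → k w y (raw m)

nonempty→inhabited : ∀ {Γ A} → ⦃ Lc A ⦄ → Γ ⊢ᶠ ¬' (A ≐ botS) → Γ ⊢ᶠ inhabited A
nonempty→inhabited h = byContra λ w n → ⟹E (w h) (setExt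
  (λ v y m → ⊥e (⟹E (v n) (inhabited-i (fvar y) m)))
  (λ v y m → ⊥e (∉bot (fvar y) m)))

inhabited→nonempty : ∀ {Γ A} → ⦃ Lc A ⦄ → Γ ⊢ᶠ inhabited A → Γ ⊢ᶠ ¬' (A ≐ botS)
inhabited→nonempty h = ⟹i λ w e → inhabited-e (w h) λ v y m → ∉bot (fvar y) (∈-respʳ (v e) m)

-- The witness is the constant function with value `b`. The names `hV 0 bool` and `hV 1 bool` are
-- labels for the argument and for the parameter `b`.
inhabited-arr : ∀ {Γ A B} → ⦃ Lc A ⦄ → ⦃ Lc B ⦄ → Γ ⊢ᶠ inhabited B → Γ ⊢ᶠ inhabited (arrS A B)
inhabited-arr {A = A} {B} h = inhabited-e h λ w b hb →
  Comprehension.comprehension (lcE-upd lcE-id (hV 1 bool) (fvar b)) (o 0 ≐ fvar (hV 1 bool)) 0 bool A B refl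
    (λ n → falseR (elemFV-R (oV (suc n)) _) refl)
    (λ v a ha k → k id b (≐-refl (fvar b)))
    (λ v a c ha e → ∈-resp (≐-sym e) (v hb))
    (λ v a c d ha e e' → ≐-trans e (≐-sym e'))
    λ v f (hf , _) → inhabited-i (fvar f) hf

-- Characteristic functions and the sets `E(A)`

charφ : Fm
charφ = closeF 2 (oV 0) (closeF 1 (oV 2) (closeF 0 (oV 3)
  (Aℓ 4 (o 4 ∈' o 3 ⟺ Ex 5 (Ex 6 (IsPair (o 4) (o 5) (o 6) ∧' o 5 ∈' o 0 ∧' o 6 ∈' boolS
    ∧' (o 2 ≐ o 5 ⟹ o 6 ≐ topS) ∧' (¬' (o 2 ≐ o 5) ⟹ o 6 ≐ botS)))))))

-- The membership condition inside `charφ`, with the pair at index 0. Index 1 is left to `f`, so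
-- that the list of `charφ`, extended by the pair, opens it.
rowφ : Fm
rowφ = closeF 3 (oV 0) (closeF 2 (oV 2) (closeF 0 (oV 4)
  (Ex 5 (Ex 6 (IsPair (o 4) (o 5) (o 6) ∧' o 5 ∈' o 0 ∧' o 6 ∈' boolS
    ∧' (o 2 ≐ o 5 ⟹ o 6 ≐ topS) ∧' (¬' (o 2 ≐ o 5) ⟹ o 6 ≐ botS))))))

isChar : FTm → FTm → FTm → Fm
isChar A x f = mopenF 0 (f ∷ x ∷ A ∷ []) charφ

truth : FTm → FTm → FTm → Fm
truth x y b = (x ≐ y ⟹ b ≐ topS) ∧' (¬' (x ≐ y) ⟹ b ≐ botS)

truth-unique : ∀ {Γ x y b c} → ⦃ Lc b ⦄ → ⦃ Lc c ⦄ → Γ ⊢ᶠ truth x y b → Γ ⊢ᶠ truth x y c → Γ ⊢ᶠ b ≐ c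
truth-unique {x = x} {y} h k = ∨e (em (x ≐ y))
  (λ w e → ≐-trans (⟹E (w (∧E₁ h)) e) (≐-sym (⟹E (w (∧E₁ k)) e)))
  (λ w e → ≐-trans (⟹E (w (∧E₂ h)) e) (≐-sym (⟹E (w (∧E₂ k)) e)))

truth-resp : ∀ {Γ x x' y y' b b'} → ⦃ Lc x ⦄ → ⦃ Lc x' ⦄ → ⦃ Lc y ⦄ → ⦃ Lc y' ⦄ → ⦃ Lc b ⦄ → ⦃ Lc b' ⦄ →
             Γ ⊢ᶠ x ≐ x' → Γ ⊢ᶠ y ≐ y' → Γ ⊢ᶠ b ≐ b' → Γ ⊢ᶠ truth x y b → Γ ⊢ᶠ truth x' y' b'
truth-resp {x = x} {x'} {y} {y'} {b} {b'} p q e h =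
  rew (x' ∷ y' ∷ []) ((bvar 1 ≐ bvar 2 ⟹ bvar 0 ≐ topS) ∧' (¬' (bvar 1 ≐ bvar 2) ⟹ bvar 0 ≐ botS)) e
  (rew (x' ∷ b ∷ []) ((bvar 1 ≐ bvar 0 ⟹ bvar 2 ≐ topS) ∧' (¬' (bvar 1 ≐ bvar 0) ⟹ bvar 2 ≐ botS)) q
  (rew (y ∷ b ∷ []) ((bvar 0 ≐ bvar 1 ⟹ bvar 2 ≐ topS) ∧' (¬' (bvar 0 ≐ bvar 1) ⟹ bvar 2 ≐ botS)) p h))

module _ {A x f : FTm} ⦃ lA : Lc A ⦄ ⦃ lx : Lc x ⦄ ⦃ lf : Lc f ⦄ where

  Row : List Fm → FTm → Set
  Row Γ p = ∀ {χ} → (∀ {Δ} → Γ ⊑ Δ → ∀ y b → Δ ⊢ᶠ isPair p (fvar y) (fvar b) → Δ ⊢ᶠ fvar y ∈' A →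
              Δ ⊢ᶠ fvar b ∈' boolS → Δ ⊢ᶠ truth x (fvar y) (fvar b) → Δ ⊢ᶠ χ) → Γ ⊢ᶠ χ

  row-e : ∀ {Γ p} → ⦃ Lc p ⦄ → Γ ⊩[ p ∷ f ∷ x ∷ A ∷ [] ] rowφ → Row Γ p
  row-e h k = ∃e h λ w y h₁ → ∃e h₁ λ w' b h₂ →
    let h₃ = raw h₂ in k (w' ∘ w) y b (∧E₁ h₃) (∧E₁ (∧E₂ h₃)) (∧E₁ (∧E₂ (∧E₂ h₃))) (∧E₂ (∧E₂ (∧E₂ h₃)))

  row-i : ∀ {Γ} p y b → ⦃ Lc p ⦄ → ⦃ Lc y ⦄ → ⦃ Lc b ⦄ → Γ ⊢ᶠ isPair p y b → Γ ⊢ᶠ y ∈' A → Γ ⊢ᶠ b ∈' boolS →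
          Γ ⊢ᶠ truth x y b → Γ ⊩[ p ∷ f ∷ x ∷ A ∷ [] ] rowφ
  row-i p y b hp hy hb t = ∃i y (∃i b ⟪ ∧I hp (∧I hy (∧I hb t)) ⟫)

  isChar-e : ∀ {Γ} → Γ ⊢ᶠ isChar A x f → ∀ p → ⦃ Lc p ⦄ → Γ ⊢ᶠ p ∈' f → Row Γ p
  isChar-e h p m = row-e (⟺→w (∀e p (⟪_⟫ {es = f ∷ x ∷ A ∷ []} {φ = charφ} h)) m)

  isChar-∈ : ∀ {Γ} → Γ ⊢ᶠ isChar A x f → ∀ p y b → ⦃ Lc p ⦄ → ⦃ Lc y ⦄ → ⦃ Lc b ⦄ →
             Γ ⊢ᶠ isPair p y b → Γ ⊢ᶠ y ∈' A → Γ ⊢ᶠ b ∈' boolS → Γ ⊢ᶠ truth x y b → Γ ⊢ᶠ p ∈' f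
  isChar-∈ h p y b hp hy hb t = ⟺←w (∀e p (⟪_⟫ {es = f ∷ x ∷ A ∷ []} {φ = charφ} h)) (row-i p y b hp hy hb t)

  isChar-i : ∀ {Γ} →
             (∀ {Δ} → Γ ⊑ Δ → ∀ p → Δ ⊢ᶠ fvar p ∈' f → Row Δ (fvar p)) →
             (∀ {Δ} → Γ ⊑ Δ → ∀ p y b → Δ ⊢ᶠ isPair (fvar p) (fvar y) (fvar b) → Δ ⊢ᶠ fvar y ∈' A →
               Δ ⊢ᶠ fvar b ∈' boolS → Δ ⊢ᶠ truth x (fvar y) (fvar b) → Δ ⊢ᶠ fvar p ∈' f) →
             Γ ⊢ᶠ isChar A x f
  isChar-i el in' = raw {es = f ∷ x ∷ A ∷ []} {φ = charφ} (∀i λ p → ∧i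
    (⇒i λ w m → ⟪ el w p m (λ v y b hp hy hb t → raw (row-i (fvar p) (fvar y) (fvar b) hp hy hb t)) ⟫)
    (⇒i λ w h → ⟪ row-e {p = fvar p} ⟪ h ⟫ (λ v y b hp hy hb t → in' (v ∘ w) p y b hp hy hb t) ⟫))

isChar-unique : ∀ {Γ A x f g} → ⦃ Lc A ⦄ → ⦃ Lc x ⦄ → ⦃ Lc f ⦄ → ⦃ Lc g ⦄ →
                Γ ⊢ᶠ isChar A x f → Γ ⊢ᶠ isChar A x g → Γ ⊢ᶠ f ≐ g
isChar-unique hf hg = setExt (incl hf hg) (incl hg hf)
  where
  incl : ∀ {Γ A x f g} → ⦃ Lc A ⦄ → ⦃ Lc x ⦄ → ⦃ Lc f ⦄ → ⦃ Lc g ⦄ → Γ ⊢ᶠ isChar A x f → Γ ⊢ᶠ isChar A x g →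
        ∀ {Δ} → Γ ⊑ Δ → ∀ p → Δ ⊢ᶠ fvar p ∈' f → Δ ⊢ᶠ fvar p ∈' g
  incl hf hg w p m = isChar-e (w hf) (fvar p) m λ v y b hp hy hb t →
    isChar-∈ (v (w hg)) (fvar p) (fvar y) (fvar b) hp hy hb t

truth-exists : ∀ {Γ} x y → ⦃ Lc x ⦄ → ⦃ Lc y ⦄ → Some Γ (λ Δ b → (Δ ⊢ᶠ b ∈' boolS) × (Δ ⊢ᶠ truth x y b))
truth-exists x y k = ∃e (⟪_⟫ {es = y ∷ x ∷ []} {φ = ex} (∨e (em (x ≐ y))
    (λ w e → raw {es = y ∷ x ∷ []} {φ = ex}
      (∃i topS ⟪ ∧I top∈bool (∧I (⟹i λ _ _ → ≐-refl topS) (⟹i λ v n → ⊥e (⟹E n (v e)))) ⟫))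
    (λ w n → raw {es = y ∷ x ∷ []} {φ = ex}
      (∃i botS ⟪ ∧I bot∈bool (∧I (⟹i λ v e → ⊥e (⟹E (v n) e)) (⟹i λ _ _ → ≐-refl botS)) ⟫))))
  λ w b h → k w b (∧E₁ (raw h) , ∧E₂ (raw h))
  where
  ex : Fm
  ex = ∃' (bvar 0 ∈' boolS ∧' (bvar 2 ≐ bvar 1 ⟹ bvar 0 ≐ topS) ∧' (¬' (bvar 2 ≐ bvar 1) ⟹ bvar 0 ≐ botS))

-- Comprehension describes `f` through application, `isChar` describes it through its pairs; the
-- graph of `f` translates one into the other.
char-exists : ∀ {Γ} A x → ⦃ Lc A ⦄ → ⦃ Lc x ⦄ → Some Γ (λ Δ f → (Δ ⊢ᶠ f ∈' arrS A boolS) × (Δ ⊢ᶠ isChar A x f))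
char-exists A x k =
  Comprehension.comprehension (lcE-upd lcE-id (hV 1 bool) x)
    (o 0 ∈' boolS ∧' truth (fvar (hV 1 bool)) (fvar (hV 0 bool)) (o 0)) 0 bool A boolS refl
    (λ n → falseR (elemFV-R (oV (suc n)) _) refl)
    (λ v a ha k' → truth-exists x (fvar a) λ w b (hb , t) → k' w b (∧I hb t))
    (λ v a b ha h → ∧E₁ h)
    (λ v a b c ha h h' → truth-unique {x = x} {fvar a} (∧E₂ h) (∧E₂ h'))
    λ v f (hf , hφ) → k v f (hf , isChar-i
      (λ w p m k' → inProd-e (arr-⊆ (w hf) (fvar p) m) λ w' y b hy hb hp →
        k' w' y b hp hy hb (truth-resp (≐-refl x) (≐-refl (fvar y))
          (app-i (w' (w hf)) (fvar y) (fvar b) (pairIn-i (fvar p) hp (w' m)))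
          (∧E₂ (hφ (w' ∘ w) (fvar y) hy))))
      (λ w p y b hp hy hb t → pairIn-e
        (pairIn-resp₂ (truth-unique {x = x} {fvar y} (∧E₂ (hφ w (fvar y) hy)) t) (app-graph (w hf) (fvar y) hy))
        λ w' q (hq , m) → ∈-resp (isPair-unique hq (w' hp)) m))

E-∈ : ∀ {Γ} A p → ⦃ Lc A ⦄ → ⦃ Lc p ⦄ → ∀ x f → ⦃ Lc x ⦄ → ⦃ Lc f ⦄ → Γ ⊢ᶠ isPair p x f → Γ ⊢ᶠ x ∈' A →
      Γ ⊢ᶠ f ∈' arrS A boolS → Γ ⊢ᶠ isChar A x f → Γ ⊢ᶠ p ∈' eS A
E-∈ A p x f hp hx hf hc = ⟺←w (∀e p (∀e A (axiom def-E refl))) (∃i x (∃i f ⟪ ∧I hp (∧I hx (∧I hf hc)) ⟫))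

E-e : ∀ {Γ} A p → ⦃ Lc A ⦄ → ⦃ Lc p ⦄ → Γ ⊢ᶠ p ∈' eS A → ∀ {χ} →
      (∀ {Δ} → Γ ⊑ Δ → ∀ x f → Δ ⊢ᶠ isPair p (fvar x) (fvar f) → Δ ⊢ᶠ fvar x ∈' A → Δ ⊢ᶠ fvar f ∈' arrS A boolS →
        Δ ⊢ᶠ isChar A (fvar x) (fvar f) → Δ ⊢ᶠ χ) → Γ ⊢ᶠ χ
E-e A p h k = ∃e (⟺→w (∀e p (∀e A (axiom def-E refl))) h) λ w x h₁ → ∃e h₁ λ w' f h₂ →
  let h₃ = raw h₂ in k (w' ∘ w) x f (∧E₁ h₃) (∧E₁ (∧E₂ h₃)) (∧E₁ (∧E₂ (∧E₂ h₃))) (∧E₂ (∧E₂ (∧E₂ h₃)))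

isChar-resp : ∀ {Γ A x y f g} → ⦃ Lc A ⦄ → ⦃ Lc x ⦄ → ⦃ Lc y ⦄ → ⦃ Lc f ⦄ → ⦃ Lc g ⦄ →
              Γ ⊢ᶠ x ≐ y → Γ ⊢ᶠ f ≐ g → Γ ⊢ᶠ isChar A x f → Γ ⊢ᶠ isChar A y g
isChar-resp {A = A} {x} {y} {f} {g} e d h =
  rew (y ∷ A ∷ []) charφ d
    (rew (f ∷ A ∷ []) (∀' (bvar 0 ∈' bvar 2 ⟺ closeF 3 (oV 0) (closeF 1 (oV 2) (closeF 0 (oV 4)
      (Ex 5 (Ex 6 (IsPair (o 4) (o 5) (o 6) ∧' o 5 ∈' o 0 ∧' o 6 ∈' boolS
        ∧' (o 2 ≐ o 5 ⟹ o 6 ≐ topS) ∧' (¬' (o 2 ≐ o 5) ⟹ o 6 ≐ botS)))))))) e h)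

E-pair : ∀ {Γ A x f} → ⦃ Lc A ⦄ → ⦃ Lc x ⦄ → ⦃ Lc f ⦄ → Γ ⊢ᶠ pairIn x f (eS A) → Γ ⊢ᶠ isChar A x f
E-pair {A = A} h = pairIn-e h λ w p (hp , m) → E-e A (fvar p) m λ w' x' f' hp' _ _ hc →
  isChar-resp (isPair-fst hp' (w' hp)) (isPair-snd hp' (w' hp)) hc

E-typed : ∀ {Γ} A → ⦃ Lc A ⦄ → Γ ⊢ᶠ eS A ∈' arrS A (arrS A boolS)
E-typed A = arr-i
  (λ w p m → E-e A (fvar p) m λ v x f hp hx hf _ → inProd-i (fvar x) (fvar f) hx hf hp)
  (λ w a ha k → char-exists A (fvar a) λ v f (hf , hc) → pair-exists (fvar a) (fvar f) λ v' p hp →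
    k (v' ∘ v) f (pairIn-i (fvar p) hp (E-∈ A (fvar p) (fvar a) (fvar f) hp (v' (v ha)) (v' hf) (v' hc))))
  (λ w a b c h h' → isChar-unique (E-pair h) (E-pair h'))

-- `E(A)` has functions as values, so graphs are consulted twice: the pair of `x` and `E(A) x` shows
-- the latter to be the characteristic function of `x`, and the pair of the latter at `y` gives the
-- truth value.
E-truth : ∀ {Γ A x y} → ⦃ Lc A ⦄ → ⦃ Lc x ⦄ → ⦃ Lc y ⦄ → Γ ⊢ᶠ x ∈' A → Γ ⊢ᶠ y ∈' A →
          Γ ⊢ᶠ truth x y (appS (appS (eS A) x) y)
E-truth {A = A} {x} {y} hx hy =
  pairIn-e (app-graph (app-typed (E-typed A) hx) y hy) λ w p (hp , m) →
    isChar-e (w (E-pair (app-graph (E-typed A) x hx))) (fvar p) m λ v y' b hp' _ _ t →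
      truth-resp (≐-refl x) (isPair-fst hp' (v hp)) (isPair-snd hp' (v hp)) t

E-intro : ∀ {Γ A x y} → ⦃ Lc A ⦄ → ⦃ Lc x ⦄ → ⦃ Lc y ⦄ → Γ ⊢ᶠ x ∈' A → Γ ⊢ᶠ y ∈' A → Γ ⊢ᶠ x ≐ y →
          Γ ⊢ᶠ appS (appS (eS A) x) y ≐ topS
E-intro hx hy e = ⟹E (∧E₁ (E-truth hx hy)) e

E-elim : ∀ {Γ A x y} → ⦃ Lc A ⦄ → ⦃ Lc x ⦄ → ⦃ Lc y ⦄ → Γ ⊢ᶠ x ∈' A → Γ ⊢ᶠ y ∈' A →
         Γ ⊢ᶠ appS (appS (eS A) x) y ≐ topS → Γ ⊢ᶠ x ≐ y
E-elim hx hy e = byContra λ w n →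
  top≢bot (≐-trans (≐-sym (w e)) (⟹E (w (∧E₂ (E-truth hx hy))) n))

-- Free variables of HOL terms

remove⁻ : ∀ {x v} vs → v ∈ removeHV x vs → v ∈ vs × x ≢ v
remove⁻ {x} (w ∷ vs) i with eqHV x w | eqHV-R x w
... | true | _ = let (a , b) = remove⁻ vs i in there a , b
remove⁻ {x} (w ∷ vs) (here refl) | false | ofⁿ n = here refl , n
remove⁻ {x} (w ∷ vs) (there i) | false | ofⁿ n = let (a , b) = remove⁻ vs i in there a , b

remove⁺ : ∀ {x v} vs → v ∈ vs → x ≢ v → v ∈ removeHV x vs
remove⁺ {x} (w ∷ vs) i n with eqHV x w | eqHV-R x w
remove⁺ (w ∷ vs) (here refl) n | true | ofʸ e = ⊥-elim (n e)
remove⁺ (w ∷ vs) (there i) n | true | _ = remove⁺ vs i n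
remove⁺ (w ∷ vs) (here refl) n | false | _ = here refl
remove⁺ (w ∷ vs) (there i) n | false | _ = there (remove⁺ vs i n)

add⁻ : ∀ l v {w} → w ∈ addHV l v → w ∈ l ⊎ w ≡ v
add⁻ l v i with elemHV v l
... | true = inj₁ i
... | false with ∈-++⁻ l i
...   | inj₁ j = inj₁ j
...   | inj₂ (here e) = inj₂ e

add⁺ˡ : ∀ l v {w} → w ∈ l → w ∈ addHV l v
add⁺ˡ l v i with elemHV v l
... | true = i
... | false = ∈-++⁺ˡ i

add⁺ʳ : ∀ l v → v ∈ addHV l v
add⁺ʳ l v with elemHV v l | elemHV-R v l
... | true | ofʸ i = i
... | false | _ = ∈-++⁺ʳ l (here refl)

union⁻ : ∀ xs ys {w} → w ∈ unionHV xs ys → w ∈ xs ⊎ w ∈ ys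
union⁻ xs [] i = inj₁ i
union⁻ xs (y ∷ ys) i with union⁻ (addHV xs y) ys i
... | inj₂ j = inj₂ (there j)
... | inj₁ j with add⁻ xs y j
...   | inj₁ k = inj₁ k
...   | inj₂ refl = inj₂ (here refl)

union⁺ˡ : ∀ xs ys {w} → w ∈ xs → w ∈ unionHV xs ys
union⁺ˡ xs [] i = i
union⁺ˡ xs (y ∷ ys) i = union⁺ˡ (addHV xs y) ys (add⁺ˡ xs y i)

union⁺ʳ : ∀ xs ys {w} → w ∈ ys → w ∈ unionHV xs ys
union⁺ʳ xs (y ∷ ys) (here refl) = union⁺ˡ (addHV xs y) ys (add⁺ʳ xs y)
union⁺ʳ xs (y ∷ ys) (there i) = union⁺ʳ (addHV xs y) ys i

snoc-unique : ∀ {xs : List HVar} {v} → Unique xs → v ∉ xs → Unique (xs ++ v ∷ [])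
snoc-unique u n = Unique-++⁺ u ([] ∷ []) (λ { (i , here refl) → n i })

remove-unique : ∀ {x} vs → Unique vs → Unique (removeHV x vs)
remove-unique [] u = []
remove-unique {x} (w ∷ vs) (a ∷ u) with eqHV x w
... | true = remove-unique vs u
... | false = All.tabulate (λ i → All.lookup a (proj₁ (remove⁻ vs i))) ∷ remove-unique vs u

add-unique : ∀ l v → Unique l → Unique (addHV l v)
add-unique l v u with elemHV v l | elemHV-R v l
... | true | _ = u
... | false | ofⁿ n = snoc-unique u n

union-unique : ∀ xs ys → Unique xs → Unique (unionHV xs ys)
union-unique xs [] u = u
union-unique xs (y ∷ ys) u = union-unique (addHV xs y) ys (add-unique xs y u)

-- A λ-variable is applied to these variables one after the other. With a repetition its defining
-- equations would speak only of argument tuples that agree at both places and would not determine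
-- the function.
fv-unique : ∀ t → Unique (fv t)
fv-unique (var x A) = [] ∷ []
fv-unique (eqc A) = []
fv-unique (app f u) = union-unique (fv f) (fv u) (fv-unique f)
fv-unique (lam x A t) = remove-unique (fv t) (fv-unique t)

fv-app⁻ : ∀ f u {v} → v ∈ fv (app f u) → v ∈ fv f ⊎ v ∈ fv u
fv-app⁻ f u = union⁻ (fv f) (fv u)

fv-appˡ : ∀ f u {v} → v ∈ fv f → v ∈ fv (app f u)
fv-appˡ f u = union⁺ˡ (fv f) (fv u)

fv-appʳ : ∀ f u {v} → v ∈ fv u → v ∈ fv (app f u)
fv-appʳ f u = union⁺ʳ (fv f) (fv u)

fv⊆ctxTvars : ∀ t {v} → v ∈ fv t → v ∈ ctxTvars t
fv⊆ctxTvars (var x A) i = i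
fv⊆ctxTvars (app f u) i with fv-app⁻ f u i
... | inj₁ j = ∈-++⁺ˡ (fv⊆ctxTvars f j)
... | inj₂ j = ∈-++⁺ʳ (ctxTvars f) (fv⊆ctxTvars u j)
fv⊆ctxTvars (lam x A t) i = let (j , n) = remove⁻ (fv t) i in remove⁺ (ctxTvars t) (fv⊆ctxTvars t j) n

ctxTvars⊆fv : ∀ t {v} → v ∈ ctxTvars t → v ∈ fv t
ctxTvars⊆fv (var x A) i = i
ctxTvars⊆fv (app f u) i with ∈-++⁻ (ctxTvars f) i
... | inj₁ j = fv-appˡ f u (ctxTvars⊆fv f j)
... | inj₂ j = fv-appʳ f u (ctxTvars⊆fv u j)
ctxTvars⊆fv (lam x A t) i = let (j , n) = remove⁻ (ctxTvars t) i in remove⁺ (fv t) (ctxTvars⊆fv t j) n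

tvs-fv : ∀ t {v X} → v ∈ fv t → X ∈ tvsTy (proj₂ v) → X ∈ tvsTm t
tvs-fv (var x A) (here refl) j = j
tvs-fv (app f u) i j with fv-app⁻ f u i
... | inj₁ k = ∈-++⁺ˡ (tvs-fv f k j)
... | inj₂ k = ∈-++⁺ʳ (tvsTm f) (tvs-fv u k j)
tvs-fv (lam x A t) i j = ∈-++⁺ʳ (tvsTy A) (tvs-fv t (proj₁ (remove⁻ (fv t) i)) j)

-- These are the abstractions defined in `ctxD`. `⌈ t ⌉` itself shows only the outermost of them;
-- the inner ones appear in the definitions of the outer ones.
lams : Term → List Term
lams (var x A) = []
lams (eqc A) = []
lams (app f u) = lams f ++ lams u
lams (lam x A t) = lams t ++ lam x A t ∷ []

lams-trans : ∀ t {l m} → l ∈ lams t → m ∈ lams l → m ∈ lams t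
lams-trans (app f u) i j with ∈-++⁻ (lams f) i
... | inj₁ k = ∈-++⁺ˡ (lams-trans f k j)
... | inj₂ k = ∈-++⁺ʳ (lams f) (lams-trans u k j)
lams-trans (lam x A t) i j with ∈-++⁻ (lams t) i
... | inj₁ k = ∈-++⁺ˡ (lams-trans t k j)
... | inj₂ (here refl) = j

ctxD⁺ : ∀ t {x A s} → lam x A s ∈ lams t → defλ x A s ∈ ctxD t
ctxD⁺ (app f u) i with ∈-++⁻ (lams f) i
... | inj₁ j = ∈-++⁺ˡ (ctxD⁺ f j)
... | inj₂ j = ∈-++⁺ʳ (ctxD f) (ctxD⁺ u j)
ctxD⁺ (lam x A t) i with ∈-++⁻ (lams t) i
... | inj₁ j = ∈-++⁺ˡ (ctxD⁺ t j)
... | inj₂ (here refl) = ∈-++⁺ʳ (ctxD t) (here refl)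

ctxD⁻ : ∀ (P : Fm → Set) t → (∀ {x A s} → lam x A s ∈ lams t → P (defλ x A s)) → ∀ {φ} → φ ∈ ctxD t → P φ
ctxD⁻ P (app f u) h i with ∈-++⁻ (ctxD f) i
... | inj₁ j = ctxD⁻ P f (h ∘ ∈-++⁺ˡ) j
... | inj₂ j = ctxD⁻ P u (h ∘ ∈-++⁺ʳ (lams f)) j
ctxD⁻ P (lam x A t) h i with ∈-++⁻ (ctxD t) i
... | inj₁ j = ctxD⁻ P t (h ∘ ∈-++⁺ˡ) j
... | inj₂ (here refl) = h (∈-++⁺ʳ (lams t) (here refl))

ty-typed : ∀ {t A} → Typed t A → ty t ≡ A
ty-typed tvarT = refl
ty-typed teqc = refl
ty-typed (tapp d e) rewrite ty-typed d = refl
ty-typed (tlam {A = A} d) = cong (A ⇛_) (ty-typed d)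

-- Values of types and terms

lc-ty : ∀ A → Lc ⌈ A ⌉ty
lc-ty (tvar X) = lc-fvar
lc-ty bool = lc-bool
lc-ty ind = lc-nat
lc-ty (A ⇛ B) = lc-arr ⦃ lc-ty A ⦄ ⦃ lc-ty B ⦄

lc-apps : ∀ {f} us → Lc f → (∀ {u} → u ∈ us → Lc u) → Lc (foldl appS f us)
lc-apps [] l h = l
lc-apps (u ∷ us) l h = lc-apps us (lc-app ⦃ l ⦄ ⦃ h (here refl) ⦄) (h ∘ there)

lc-hvT : ∀ vs {u} → u ∈ map hvT vs → Lc u
lc-hvT vs i with ∈-map⁻ hvT i
... | _ , _ , refl = lc-fvar

lc-tm : ∀ t → Lc ⌈ t ⌉
lc-tm (var x A) = lc-fvar
lc-tm (eqc A) = lc-E ⦃ lc-ty A ⦄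
lc-tm (app f u) = lc-app ⦃ lc-tm f ⦄ ⦃ lc-tm u ⦄
lc-tm (lam x A t) = lc-apps (map hvT (fv (lam x A t))) lc-fvar (lc-hvT (fv (lam x A t)))

lc-subT : ∀ {ρ t} → LcE ρ → Lc t → Lc (subT ρ t)
lc-subT {t = t} r l = lc (lcT-sub r 0 t (closed l))

hv : HVar → FVar
hv (x , A) = hV x A

⟦_⟧ty : HType → Env → FTm
⟦ A ⟧ty ρ = subT ρ ⌈ A ⌉ty

⟦_⟧ : Term → Env → FTm
⟦ t ⟧ ρ = subT ρ ⌈ t ⌉

lcY : ∀ {ρ} → LcE ρ → ∀ A → Lc (⟦ A ⟧ty ρ)
lcY r A = lc-subT r (lc-ty A)

lcV : ∀ {ρ} → LcE ρ → ∀ t → Lc (⟦ t ⟧ ρ)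
lcV r t = lc-subT r (lc-tm t)

apps : Env → FTm → List HVar → FTm
apps ρ f [] = f
apps ρ f (v ∷ vs) = apps ρ (appS f (ρ (hv v))) vs

sub-apps : ∀ ρ f vs → subT ρ (foldl appS f (map hvT vs)) ≡ apps ρ (subT ρ f) vs
sub-apps ρ f [] = refl
sub-apps ρ f (v ∷ vs) = sub-apps ρ (appS f (hvT v)) vs

apps-snoc : ∀ ρ f vs v → apps ρ f (vs ++ v ∷ []) ≡ appS (apps ρ f vs) (ρ (hv v))
apps-snoc ρ f [] v = refl
apps-snoc ρ f (u ∷ vs) v = apps-snoc ρ (appS f (ρ (hv u))) vs v

apps-cong : ∀ {ρ ρ'} f vs → (∀ {v} → v ∈ vs → ρ (hv v) ≡ ρ' (hv v)) → apps ρ f vs ≡ apps ρ' f vs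
apps-cong f [] h = refl
apps-cong {ρ} {ρ'} f (v ∷ vs) h =
  trans (cong (λ a → apps ρ (appS f a) vs) (h (here refl)))
        (apps-cong (appS f (ρ' (hv v))) vs (h ∘ there))

arrs : HType → List HVar → FTm
arrs τ vs = foldr (λ v R → arrS ⌈ proj₂ v ⌉ty R) ⌈ τ ⌉ty vs

arrs-snoc : ∀ τ vs v → arrs τ (vs ++ v ∷ []) ≡ arrs (proj₂ v ⇛ τ) vs
arrs-snoc τ vs v = foldr-++ (λ v R → arrS ⌈ proj₂ v ⌉ty R) ⌈ τ ⌉ty vs (v ∷ [])

lc-arrs : ∀ τ vs → Lc (arrs τ vs)
lc-arrs τ [] = lc-ty τ
lc-arrs τ (v ∷ vs) = lc-arr ⦃ lc-ty (proj₂ v) ⦄ ⦃ lc-arrs τ vs ⦄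

fv-ty : ∀ A {w} → w ∈ fvT ⌈ A ⌉ty → ∃ λ X → w ≡ tyV X
fv-ty (tvar X) (here refl) = X , refl
fv-ty (A ⇛ B) i with ∈-++⁻ (fvT ⌈ A ⌉ty) i
... | inj₁ j = fv-ty A j
... | inj₂ j = fv-ty B j

fv-arrs : ∀ τ vs {w} → w ∈ fvT (arrs τ vs) → ∃ λ X → w ≡ tyV X
fv-arrs τ [] i = fv-ty τ i
fv-arrs τ (v ∷ vs) i with ∈-++⁻ (fvT ⌈ proj₂ v ⌉ty) i
... | inj₁ j = fv-ty (proj₂ v) j
... | inj₂ j = fv-arrs τ vs j

fv-apps : ∀ f vs {w} → w ∈ fvT (foldl appS f (map hvT vs)) → w ∈ fvT f ⊎ (∃ λ v → v ∈ vs × w ≡ hv v)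
fv-apps f [] i = inj₁ i
fv-apps f (v ∷ vs) i with fv-apps (appS f (hvT v)) vs i
... | inj₂ (u , j , e) = inj₂ (u , there j , e)
... | inj₁ j with ∈-++⁻ (fvT f) j
...   | inj₁ k = inj₁ k
...   | inj₂ (here e) = inj₂ (v , here refl , e)

Occ : Term → FVar → Set
Occ t (tyV X) = X ∈ tvsTm t
Occ t (hV x A) = (x , A) ∈ fv t
Occ t (lamV l) = l ∈ lams t
Occ t (oV n) = ⊥

tvs-ty : ∀ A {X} → tyV X ∈ fvT ⌈ A ⌉ty → X ∈ tvsTy A
tvs-ty (tvar X) (here refl) = here refl
tvs-ty (A ⇛ B) i with ∈-++⁻ (fvT ⌈ A ⌉ty) i
... | inj₁ j = ∈-++⁺ˡ (tvs-ty A j)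
... | inj₂ j = ∈-++⁺ʳ (tvsTy A) (tvs-ty B j)

Occ-appˡ : ∀ f u w → Occ f w → Occ (app f u) w
Occ-appˡ f u (tyV X) i = ∈-++⁺ˡ i
Occ-appˡ f u (hV x A) i = fv-appˡ f u i
Occ-appˡ f u (lamV l) i = ∈-++⁺ˡ i

Occ-appʳ : ∀ f u w → Occ u w → Occ (app f u) w
Occ-appʳ f u (tyV X) i = ∈-++⁺ʳ (tvsTm f) i
Occ-appʳ f u (hV x A) i = fv-appʳ f u i
Occ-appʳ f u (lamV l) i = ∈-++⁺ʳ (lams f) i

fv-val : ∀ t {w} → w ∈ fvT ⌈ t ⌉ → Occ t w
fv-val (var x A) (here refl) = here refl
fv-val (eqc A) {w} i with fv-ty A i
... | X , refl = tvs-ty A i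
fv-val (app f u) {w} i with ∈-++⁻ (fvT ⌈ f ⌉) i
... | inj₁ j = Occ-appˡ f u w (fv-val f j)
... | inj₂ j = Occ-appʳ f u w (fv-val u j)
fv-val (lam x A t) i with fv-apps (λvar (lam x A t)) (fv (lam x A t)) i
... | inj₁ (here refl) = ∈-++⁺ʳ (lams t) (here refl)
... | inj₂ (_ , j , refl) = j

SameTy : Env → Env → Set
SameTy ρ ρ' = ∀ X → ρ (tyV X) ≡ ρ' (tyV X)

ty-cong-on : ∀ {ρ ρ'} A → (∀ {X} → X ∈ tvsTy A → ρ (tyV X) ≡ ρ' (tyV X)) → ⟦ A ⟧ty ρ ≡ ⟦ A ⟧ty ρ'
ty-cong-on {ρ} {ρ'} A h = subT-cong ⌈ A ⌉ty same
  where
  same : ∀ {w} → w ∈ fvT ⌈ A ⌉ty → ρ w ≡ ρ' w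
  same i with fv-ty A i
  ... | X , refl = h (tvs-ty A i)

ty-cong : ∀ {ρ ρ'} → SameTy ρ ρ' → ∀ A → ⟦ A ⟧ty ρ ≡ ⟦ A ⟧ty ρ'
ty-cong h A = ty-cong-on A (λ {X} _ → h X)

arrs-cong : ∀ {ρ ρ'} → SameTy ρ ρ' → ∀ τ vs → subT ρ (arrs τ vs) ≡ subT ρ' (arrs τ vs)
arrs-cong h τ [] = ty-cong h τ
arrs-cong h τ (v ∷ vs) = cong₂ arrS (ty-cong h (proj₂ v)) (arrs-cong h τ vs)

TV : List Fm → Env → List HVar → Set
TV Γ ρ vs = ∀ {v} → v ∈ vs → Γ ⊢ᶠ ρ (hv v) ∈' ⟦ proj₂ v ⟧ty ρ

Off : List HVar → Env → Env → Set
Off vs ρ ρ' = ∀ w → (∀ {v} → v ∈ vs → w ≢ hv v) → ρ' w ≡ ρ w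

Off-ty : ∀ {vs ρ ρ'} → Off vs ρ ρ' → SameTy ρ ρ'
Off-ty h X = sym (h (tyV X) (λ _ ()))

hv-inj : ∀ {u v} → hv u ≡ hv v → u ≡ v
hv-inj refl = refl

Off-cons : ∀ {v vs ρ ρ'} → Off (v ∷ vs) ρ ρ' → Off vs (ρ [ hv v ↦ ρ' (hv v) ]) ρ'
Off-cons {v} {vs} {ρ} {ρ'} h w n with eqFV (hv v) w | eqFV-R (hv v) w
... | true | ofʸ refl = refl
... | false | ofⁿ m = h w (λ { (here refl) e → m (sym e) ; (there i) e → n i e })

Off-uncons : ∀ {v vs ρ ρ' a} → Off vs (ρ [ hv v ↦ a ]) ρ' → Off (v ∷ vs) ρ ρ'
Off-uncons {v} {vs} {ρ} {a = a} h w n =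
  trans (h w (n ∘ there)) (upd-other ρ (hv v) a (λ e → n (here refl) (sym e)))

Off-head : ∀ {v vs ρ ρ' a} → v ∉ vs → Off vs (ρ [ hv v ↦ a ]) ρ' → ρ' (hv v) ≡ a
Off-head {v} {vs} {ρ} {ρ'} {a} n h =
  trans (h (hv v) (λ i e → n (subst (_∈ vs) (sym (hv-inj e)) i))) (upd-same ρ (hv v) a)

TV-cons : ∀ {Δ v vs ρ ρ' a} → Off vs (ρ [ hv v ↦ a ]) ρ' → TV Δ ρ' vs → Δ ⊢ᶠ a ∈' ⟦ proj₂ v ⟧ty ρ →
  TV Δ ρ' (v ∷ vs)
TV-cons off tv h (there i) = tv i
-- If `v` recurs in `vs`, the later quantifier decides its value, and `tv` already covers it.
TV-cons {v = v} {vs} off tv h (here refl) with elemHV v vs | elemHV-R v vs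
... | true | ofʸ i = tv i
... | false | ofⁿ n = ⊢-cast (cong₂ _∈'_ (sym (Off-head n off)) (ty-cong (λ X → Off-ty off X) (proj₂ v))) h

lc-bAll : ∀ φ vs → lcF 0 φ ≡ true → lcF 0 (foldr bAll φ vs) ≡ true
lc-body : ∀ φ v vs → lcF 0 φ ≡ true → lcF 0 (hvT v ∈' ⌈ proj₂ v ⌉ty ⟹ foldr bAll φ vs) ≡ true
lc-bAll φ [] l = l
lc-bAll φ (v ∷ vs) l = lcF-close₁ (hv v) (hvT v ∈' ⌈ proj₂ v ⌉ty ⟹ foldr bAll φ vs) (lc-body φ v vs l)
lc-body φ v vs l = cong₂ _∧_ (closed (lc-ty (proj₂ v))) (lc-bAll φ vs l)

-- The instances of a block of bounded quantifiers are the assignments that differ from `ρ` only on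
-- `vs` and are well typed there. `ρ'` fixes all values in advance, and each quantifier moves one of
-- them into `ρ` (`Off-cons`).
bAll-e : ∀ {Γ ρ ρ'} → LcE ρ → LcE ρ' → ∀ φ → lcF 0 φ ≡ true → ∀ vs → Off vs ρ ρ' → TV Γ ρ' vs →
         Γ ⊢ᶠ subF ρ (foldr bAll φ vs) → Γ ⊢ᶠ subF ρ' φ
bAll-e r r' φ l [] off h d = ⊢-cast (subF-cong φ (λ {w} _ → sym (off w (λ ())))) d
bAll-e {ρ = ρ} {ρ'} r r' φ l (v ∷ vs) off h d =
  bAll-e (lcE-upd r (hv v) a ⦃ la ⦄) r' φ l vs (Off-cons off) (h ∘ there)
    (⟹E (⊢-cast (open-closeF r 0 (hv v) a body (lc-body φ v vs l)) (∀E a (closed la) d))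
        (⊢-cast (cong₂ _∈'_ (sym (upd-same ρ (hv v) a)) (ty-cong (λ X → sym (Off-ty off X)) (proj₂ v)))
                (h (here refl))))
  where
  a = ρ' (hv v)
  la = at r' (hv v)
  body = hvT v ∈' ⌈ proj₂ v ⌉ty ⟹ foldr bAll φ vs

bAll-i : ∀ {Γ ρ} → LcE ρ → ∀ φ → lcF 0 φ ≡ true → ∀ vs →
         (∀ {Δ} → Γ ⊑ Δ → ∀ ρ' → LcE ρ' → Off vs ρ ρ' → TV Δ ρ' vs → Δ ⊢ᶠ subF ρ' φ) →
         Γ ⊢ᶠ subF ρ (foldr bAll φ vs)
bAll-i {ρ = ρ} r φ l [] f = f id ρ r (λ w _ → refl) (λ ())
bAll-i {Γ} {ρ} r φ l (v ∷ vs) f = ∀I* λ y → ⊢-cast (sym (open-closeF r 0 (hv v) (fvar y) body (lc-body φ v vs l)))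
  (⟹i λ w h → bAll-i (lcE-upd r (hv v) (fvar y)) φ l vs λ w' ρ' r' off tv →
    f (w' ∘ w) ρ' r' (Off-uncons {v} off) (TV-cons off tv
      (⊢-cast (cong₂ _∈'_ (upd-same ρ (hv v) (fvar y)) (ty-cong (λ _ → refl) (proj₂ v))) (w' h))))
  where
  body = hvT v ∈' ⌈ proj₂ v ⌉ty ⟹ foldr bAll φ vs

fv-bAll : ∀ φ vs {w} → w ∈ fvF (foldr bAll φ vs) →
  (∃ λ X → w ≡ tyV X × (∃ λ v → v ∈ vs × X ∈ tvsTy (proj₂ v))) ⊎ (w ∈ fvF φ × (∀ {v} → v ∈ vs → w ≢ hv v))
fv-bAll φ [] i = inj₂ (i , λ ())
fv-bAll φ (v ∷ vs) i with fvF-close 0 (hv v) (hvT v ∈' ⌈ proj₂ v ⌉ty ⟹ foldr bAll φ vs) i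
... | here e , n = ⊥-elim (n (sym e))
... | there j , n with ∈-++⁻ (fvT ⌈ proj₂ v ⌉ty) j
...   | inj₁ k with fv-ty (proj₂ v) k
...     | X , refl = inj₁ (X , refl , v , here refl , tvs-ty (proj₂ v) k)
fv-bAll φ (v ∷ vs) i | there j , n | inj₂ k with fv-bAll φ vs k
... | inj₁ (X , e , u , m , p) = inj₁ (X , e , u , there m , p)
... | inj₂ (m , p) = inj₂ (m , λ { (here refl) e → n (sym e) ; (there q) → p q })

-- Validity of the λ-definitions

DD : List Fm → Env → List Term → Set
DD Γ ρ D = ∀ {x A t} → lam x A t ∈ D → Γ ⊢ᶠ subF ρ (defλ x A t)

vars : ℕ → HType → Term → List HVar
vars x A t = fv (lam x A t) ++ ((x , A) ∷ [])

fv⊆vars : ∀ x A t {v} → v ∈ fv t → v ∈ vars x A t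
fv⊆vars x A t {v} i with eqHV (x , A) v | eqHV-R (x , A) v
... | true | ofʸ refl = ∈-++⁺ʳ (fv (lam x A t)) (here refl)
... | false | ofⁿ n = ∈-++⁺ˡ (remove⁺ (fv t) i n)

OccD : Term → FVar → Set
OccD l (tyV X) = ⊤
OccD l (hV x A) = ⊥
OccD l (lamV m) = m ∈ lams l
OccD l (oV n) = ⊥

self∈ : ∀ x A t → lam x A t ∈ lams (lam x A t)
self∈ x A t = ∈-++⁺ʳ (lams t) (here refl)

-- Every free variable of `t` is among `vars x A t`, hence bound by the quantifier block. Validity
-- of a definition therefore depends on the type variables and on the λ-variables in `lams`, but on
-- no value of an HOL variable.
fv-def : ∀ x A t {w} → w ∈ fvF (defλ x A t) → OccD (lam x A t) w
fv-def x A t (here refl) = self∈ x A t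
fv-def x A t {w} (there i) with ∈-++⁻ (fvT (arrs (ty t) (vars x A t))) i
... | inj₁ j with fv-arrs (ty t) (vars x A t) j
...   | _ , refl = _
fv-def x A t {w} (there i) | inj₂ j
  with fv-bAll (foldl appS (λvar (lam x A t)) (map hvT (vars x A t)) ≐ ⌈ t ⌉) (vars x A t) j
... | inj₁ (_ , refl , _) = _
... | inj₂ (k , n) with ∈-++⁻ (fvT (foldl appS (λvar (lam x A t)) (map hvT (vars x A t)))) k
...   | inj₁ m with fv-apps (λvar (lam x A t)) (vars x A t) m
...     | inj₁ (here refl) = self∈ x A t
...     | inj₂ (v , p , refl) = ⊥-elim (n p refl)
fv-def x A t {w} (there i) | inj₂ j | inj₂ (k , n) | inj₂ m = go w (fv-val t m) n
  where
  go : ∀ w → Occ t w → (∀ {v} → v ∈ vars x A t → w ≢ hv v) → OccD (lam x A t) w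
  go (tyV X) o n = _
  go (hV y B) o n = ⊥-elim (n (fv⊆vars x A t o) refl)
  go (lamV l) o n = ∈-++⁺ˡ o

def-cong : ∀ {ρ ρ'} x A t → SameTy ρ ρ' → (∀ {l} → l ∈ lams (lam x A t) → ρ (lamV l) ≡ ρ' (lamV l)) →
           subF ρ (defλ x A t) ≡ subF ρ' (defλ x A t)
def-cong {ρ} {ρ'} x A t h k = subF-cong (defλ x A t) (λ {w} i → go w (fv-def x A t i))
  where
  go : ∀ w → OccD (lam x A t) w → ρ w ≡ ρ' w
  go (tyV X) o = h X
  go (lamV l) o = k o

DD-cong : ∀ {Γ ρ ρ'} t → SameTy ρ ρ' → (∀ {l} → l ∈ lams t → ρ (lamV l) ≡ ρ' (lamV l)) →
          DD Γ ρ (lams t) → DD Γ ρ' (lams t)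
DD-cong t h k d {x} {A} {s} i = ⊢-cast (def-cong x A s h (λ j → k (lams-trans t i j))) (d i)

val-cong : ∀ {ρ ρ'} t → SameTy ρ ρ' → (∀ {l} → l ∈ lams t → ρ (lamV l) ≡ ρ' (lamV l)) →
           (∀ {v} → v ∈ fv t → ρ (hv v) ≡ ρ' (hv v)) → ⟦ t ⟧ ρ ≡ ⟦ t ⟧ ρ'
val-cong {ρ} {ρ'} t h k v = subT-cong ⌈ t ⌉ (λ {w} i → go w (fv-val t i))
  where
  go : ∀ w → Occ t w → ρ w ≡ ρ' w
  go (tyV X) o = h X
  go (hV x A) o = v o
  go (lamV l) o = k o

apps-typed : ∀ {Γ ρ f} → LcE ρ → Lc f → ∀ τ vs → TV Γ ρ vs → Γ ⊢ᶠ f ∈' subT ρ (arrs τ vs) →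
  Γ ⊢ᶠ apps ρ f vs ∈' ⟦ τ ⟧ty ρ
apps-typed r l τ [] h d = d
apps-typed {ρ = ρ} r l τ (v ∷ vs) h d =
  apps-typed r (lc-app ⦃ l ⦄ ⦃ at r (hv v) ⦄) τ vs (h ∘ there)
    (app-typed ⦃ lcY r (proj₂ v) ⦄ ⦃ lc-subT r (lc-arrs τ vs) ⦄ ⦃ l ⦄ ⦃ at r (hv v) ⦄ d (h (here refl)))

val-typed : ∀ {Γ ρ t A} → LcE ρ → Typed t A → DD Γ ρ (lams t) → TV Γ ρ (fv t) → Γ ⊢ᶠ ⟦ t ⟧ ρ ∈' ⟦ A ⟧ty ρ
val-typed r tvarT d h = h (here refl)
val-typed {ρ = ρ} r (teqc {A}) d h = E-typed (⟦ A ⟧ty ρ) ⦃ lcY r A ⦄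
val-typed r (tapp {f} {u} {A} {B} p q) d h =
  app-typed ⦃ lcY r A ⦄ ⦃ lcY r B ⦄ ⦃ lcV r f ⦄ ⦃ lcV r u ⦄
    (val-typed r p (d ∘ ∈-++⁺ˡ) (h ∘ fv-appˡ f u))
    (val-typed r q (d ∘ ∈-++⁺ʳ (lams f)) (h ∘ fv-appʳ f u))
val-typed {Γ} {ρ} r (tlam {x} {A} {t} {B} p) d h =
  ⊢-cast (cong (_∈' ⟦ A ⇛ B ⟧ty ρ) (sym (sub-apps ρ (λvar (lam x A t)) (fv (lam x A t)))))
    (apps-typed r (at r _) (A ⇛ B) (fv (lam x A t)) h
      (⊢-cast (cong (λ T → ρ (lamV (lam x A t)) ∈' subT ρ T)
                (trans (arrs-snoc (ty t) (fv (lam x A t)) (x , A))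
                       (cong (λ τ → arrs (A ⇛ τ) (fv (lam x A t))) (ty-typed p))))
        (∧E₁ (d (self∈ x A t)))))

TV-upd : ∀ {Γ ρ x A t a} → TV Γ ρ (fv (lam x A t)) → Γ ⊢ᶠ a ∈' ⟦ A ⟧ty ρ → TV Γ (ρ [ hV x A ↦ a ]) (fv t)
TV-upd {Γ} {ρ} {x} {A} {t} {a} h k {v} i with eqHV (x , A) v | eqHV-R (x , A) v
... | true | ofʸ refl = ⊢-cast (cong (a ∈'_) (ty-cong (λ _ → refl) A)) k
... | false | ofⁿ n = ⊢-cast (cong (ρ (hv v) ∈'_) (ty-cong (λ _ → refl) (proj₂ v))) (h (remove⁺ (fv t) i n))

TV-upd-vars : ∀ {Γ ρ x A t a} → TV Γ ρ (fv (lam x A t)) → Γ ⊢ᶠ a ∈' ⟦ A ⟧ty ρ →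
  TV Γ (ρ [ hV x A ↦ a ]) (vars x A t)
TV-upd-vars {Γ} {ρ} {x} {A} {t} {a} h k {v} i with ∈-++⁻ (fv (lam x A t)) i
... | inj₁ j = TV-upd {t = t} h k (proj₁ (remove⁻ (fv t) j))
... | inj₂ (here refl) = ⊢-cast (cong₂ _∈'_ (sym (upd-same ρ (hV x A) a)) (ty-cong (λ _ → refl) A)) k

-- This is the defining equation at `ρ` updated by `a`. The last element of `vars x A t` is `x`,
-- which supplies the argument `a`; the others are free in the abstraction, hence different from
-- `x`, and keep their values in `ρ`.
val-β : ∀ {Γ ρ x A t a} → LcE ρ → ⦃ Lc a ⦄ → DD Γ ρ (lams (lam x A t)) → TV Γ ρ (fv (lam x A t)) →
        Γ ⊢ᶠ a ∈' ⟦ A ⟧ty ρ → Γ ⊢ᶠ appS (⟦ lam x A t ⟧ ρ) a ≐ ⟦ t ⟧ (ρ [ hV x A ↦ a ])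
val-β {Γ} {ρ} {x} {A} {t} {a} r d h k =
  ⊢-cast (cong (_≐ ⟦ t ⟧ ρ') eq)
    (bAll-e r r' (foldl appS (λvar l) (map hvT vs) ≐ ⌈ t ⌉) lc-eq vs off
      (TV-upd-vars {t = t} h k) (∧E₂ (d (self∈ x A t))))
  where
  l = lam x A t
  vs = vars x A t
  ρ' = ρ [ hV x A ↦ a ]
  r' = lcE-upd r (hV x A) a
  lc-eq : lcF 0 (foldl appS (λvar l) (map hvT vs) ≐ ⌈ t ⌉) ≡ true
  lc-eq = cong₂ _∧_ (closed (lc-apps (map hvT vs) (lc-fvar {lamV l}) (lc-hvT vs))) (closed (lc-tm t))
  off : Off vs ρ ρ'
  off w n = upd-other ρ (hV x A) a (λ e → n (∈-++⁺ʳ (fv l) (here refl)) (sym e))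
  same : ∀ {v} → v ∈ fv l → ρ' (hv v) ≡ ρ (hv v)
  same i = upd-other ρ (hV x A) a (proj₂ (remove⁻ (fv t) i) ∘ hv-inj)
  eq : subT ρ' (foldl appS (λvar l) (map hvT vs)) ≡ appS (⟦ l ⟧ ρ) a
  eq = trans (sub-apps ρ' (λvar l) vs) (trans (apps-snoc ρ' (ρ (lamV l)) (fv l) (x , A))
         (cong₂ appS (trans (apps-cong (ρ (lamV l)) (fv l) same) (sym (sub-apps ρ (λvar l) (fv l))))
                      (upd-same ρ (hV x A) a)))

-- Existence of the functions named by the λ-variables

-- Generalises `defλ` to an arbitrary variable `z`: at `lamV` it is the definition to be validated,
-- at `oV 0` the property to which comprehension is applied.
defFm : FVar → HType → List HVar → FTm → Fm
defFm z τ vs s = fvar z ∈' arrs τ vs ∧' foldr bAll (foldl appS (fvar z) (map hvT vs) ≐ s) vs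

-- The semantic reading of `defFm`, with assignments in place of quantifiers. In this form arguments
-- can be split off one at a time (`Fun-tail`, `Fun-cons`).
Fun : List Fm → Env → FTm → HType → List HVar → FTm → Set
Fun Γ ρ c τ vs s = (Γ ⊢ᶠ c ∈' subT ρ (arrs τ vs)) ×
  (∀ {Δ} → Γ ⊑ Δ → ∀ ρ' → LcE ρ' → Off vs ρ ρ' → TV Δ ρ' vs → Δ ⊢ᶠ apps ρ' c vs ≐ subT ρ' s)

record Reserved (z : FVar) : Set where
  field
    notH : ∀ {v} → z ≢ hv v
    notT : ∀ {X} → z ≢ tyV X
open Reserved

lamV-reserved : ∀ {l} → Reserved (lamV l)
lamV-reserved = record { notH = λ () ; notT = λ () }

oV-reserved : ∀ {n} → Reserved (oV n)
oV-reserved = record { notH = λ () ; notT = λ () }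

upd-ty : ∀ {ρ z a} → Reserved z → SameTy (ρ [ z ↦ a ]) ρ
upd-ty {ρ} {z} {a} R X = upd-other ρ z a (notT R)

TV-reserved : ∀ {Γ ρ z a vs} → Reserved z → TV Γ ρ vs → TV Γ (ρ [ z ↦ a ]) vs
TV-reserved {ρ = ρ} {z} {a} R h {v} i =
  ⊢-cast (cong₂ _∈'_ (sym (upd-other ρ z a (notH R))) (ty-cong (λ X → sym (upd-ty {ρ} R X)) (proj₂ v))) (h i)

Off-upd : ∀ {vs ρ ρ' z a} → Off vs ρ ρ' → Off vs (ρ [ z ↦ a ]) (ρ' [ z ↦ a ])
Off-upd {z = z} h w n with eqFV z w
... | true = refl
... | false = h w n

Off-restore : ∀ {vs ρ ρ' z a} → Off vs (ρ [ z ↦ a ]) ρ' → Off vs ρ (ρ' [ z ↦ ρ z ])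
Off-restore {ρ = ρ} {z = z} {a} h w n with eqFV z w in e | eqFV-R z w
... | true | ofʸ refl = refl
... | false | ofⁿ m = trans (h w n) (upd-other ρ z a m)

subT-reserved : ∀ {ρ z a s} → z ∉ fvT s → subT (ρ [ z ↦ a ]) s ≡ subT ρ s
subT-reserved {ρ} {z} {a} {s} n = subT-cong s (λ i → upd-other ρ z a (λ { refl → n i }))

module _ {z : FVar} (R : Reserved z) (τ : HType) (s : FTm) (ls : Lc s) (z∉ : z ∉ fvT s) where

  private
    eqn : List HVar → Fm
    eqn vs = foldl appS (fvar z) (map hvT vs) ≐ s

    lc-eqn : ∀ vs → lcF 0 (eqn vs) ≡ true
    lc-eqn vs = cong₂ _∧_ (closed (lc-apps (map hvT vs) (lc-fvar {z}) (lc-hvT vs))) (closed ls)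

  lc-defFm : ∀ vs → lcF 0 (defFm z τ vs s) ≡ true
  lc-defFm vs = cong₂ _∧_ (closed (lc-arrs τ vs)) (lc-bAll (eqn vs) vs (lc-eqn vs))

  def→Fun : ∀ {Γ ρ c vs} → LcE ρ → ⦃ Lc c ⦄ → Γ ⊢ᶠ subF (ρ [ z ↦ c ]) (defFm z τ vs s) → Fun Γ ρ c τ vs s
  def→Fun {Γ} {ρ} {c} {vs} r d =
    ⊢-cast (cong₂ _∈'_ (upd-same ρ z c) (arrs-cong (upd-ty {ρ} R) τ vs)) (∧E₁ d) ,
    λ w ρ' r' off tv → ⊢-cast (cong₂ _≐_
        (trans (sub-apps (ρ' [ z ↦ c ]) (fvar z) vs)
          (trans (cong (λ f → apps (ρ' [ z ↦ c ]) f vs) (upd-same ρ' z c))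
            (apps-cong c vs (λ _ → upd-other ρ' z c (notH R)))))
        (subT-reserved {ρ'} {z} {c} {s} z∉))
      (bAll-e (lcE-upd r z c) (lcE-upd r' z c) (eqn vs) (lc-eqn vs) vs
        (Off-upd {z = z} off) (TV-reserved R tv) (w (∧E₂ d)))

  Fun→def : ∀ {Γ ρ c vs} → LcE ρ → ⦃ Lc c ⦄ → Fun Γ ρ c τ vs s → Γ ⊢ᶠ subF (ρ [ z ↦ c ]) (defFm z τ vs s)
  Fun→def {Γ} {ρ} {c} {vs} r (d , f) = ∧I
    (⊢-cast (cong₂ _∈'_ (sym (upd-same ρ z c)) (sym (arrs-cong (upd-ty {ρ} R) τ vs))) d)
    (bAll-i (lcE-upd r z c) (eqn vs) (lc-eqn vs) vs λ w ρ' r' off tv →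
      ⊢-cast (sym (cong₂ _≐_
        (trans (sub-apps ρ' (fvar z) vs)
          (trans (cong (λ f → apps ρ' f vs) (trans (off z (λ _ → notH R)) (upd-same ρ z c)))
            (apps-cong c vs (λ _ → sym (upd-other ρ' z (ρ z) (notH R))))))
        (sym (subT-reserved {ρ'} {z} {ρ z} {s} z∉))))
      -- Here `ρ'` still has `c` at `z`; putting back `ρ z` makes it agree with `ρ` outside `vs`.
      (f w (ρ' [ z ↦ ρ z ]) (lcE-upd r' z (ρ z) ⦃ at r z ⦄) (Off-restore {z = z} off) (TV-reserved R tv)))

Fun-tail : ∀ {Γ ρ c τ x X vs s a} → LcE ρ → ⦃ Lc c ⦄ → ⦃ Lc a ⦄ → (x , X) ∉ vs → Fun Γ ρ c τ ((x , X) ∷ vs) s →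
           Γ ⊢ᶠ a ∈' ⟦ X ⟧ty ρ → Fun Γ (ρ [ hV x X ↦ a ]) (appS c a) τ vs s
Fun-tail {Γ} {ρ} {c} {τ} {x} {X} {vs} {s} {a} r n (d , f) ha =
  ⊢-cast (cong (appS c a ∈'_) (arrs-cong (λ _ → refl) τ vs))
    (app-typed ⦃ lcY r X ⦄ ⦃ lc-subT r (lc-arrs τ vs) ⦄ d ha) ,
  λ w ρ' r' off tv → ⊢-cast (cong (λ b → apps ρ' (appS c b) vs ≐ subT ρ' s) (Off-head n off))
    (f w ρ' r' (Off-uncons {x , X} off) (TV-cons off tv (w ha)))

Fun-cons : ∀ {Γ ρ c τ x X vs s} → LcE ρ → Γ ⊢ᶠ c ∈' subT ρ (arrs τ ((x , X) ∷ vs)) →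
           (∀ {Δ} → Γ ⊑ Δ → ∀ a → ⦃ Lc a ⦄ → Δ ⊢ᶠ a ∈' ⟦ X ⟧ty ρ → Fun Δ (ρ [ hV x X ↦ a ]) (appS c a) τ vs s) →
           Fun Γ ρ c τ ((x , X) ∷ vs) s
Fun-cons {x = x} {X} r d f = d , λ w ρ' r' off tv →
  proj₂ (f w (ρ' (hV x X)) ⦃ at r' (hV x X) ⦄
    (⊢-cast (cong (ρ' (hV x X) ∈'_) (ty-cong (λ Y → sym (Off-ty off Y)) X)) (tv (here refl))))
    id ρ' r' (Off-cons off) (tv ∘ there)

-- Extensionality at each argument in turn. Comprehension asks this uniqueness of the inner
-- functions in `Fun-exists`.
Fun-unique : ∀ {Γ ρ b c τ vs s} → LcE ρ → ⦃ Lc b ⦄ → ⦃ Lc c ⦄ → Lc s → Unique vs →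
             Fun Γ ρ b τ vs s → Fun Γ ρ c τ vs s → Γ ⊢ᶠ b ≐ c
Fun-unique {ρ = ρ} {vs = []} r ls u (_ , f) (_ , g) =
  ≐-trans ⦃ it ⦄ ⦃ lc-subT r ls ⦄ ⦃ it ⦄ (f id ρ r (λ _ _ → refl) (λ ()))
    (≐-sym ⦃ it ⦄ ⦃ lc-subT r ls ⦄ (g id ρ r (λ _ _ → refl) (λ ())))
Fun-unique {ρ = ρ} {τ = τ} {vs = (x , X) ∷ vs} {s = s} r ls (n ∷ u) f g =
  fun-ext ⦃ lcY r X ⦄ ⦃ lc-subT r (lc-arrs τ vs) ⦄ (proj₁ f) (proj₁ g) λ w a ha →
    Fun-unique (lcE-upd r (hV x X) (fvar a)) ls u
      (Fun-tail {s = s} r (λ i → All.lookup n i refl) (Fun-wk {s = s} w f) ha)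
      (Fun-tail {s = s} r (λ i → All.lookup n i refl) (Fun-wk {s = s} w g) ha)
  where
  Fun-wk : ∀ {Γ Δ ρ c τ vs s} → Γ ⊑ Δ → Fun Γ ρ c τ vs s → Fun Δ ρ c τ vs s
  Fun-wk w (d , f) = w d , λ w' → f (w' ∘ w)

fv-defFm : ∀ z τ vs s {n} → oV n ∈ fvF (defFm z τ vs s) → oV n ≡ z ⊎ oV n ∈ fvT s
fv-defFm z τ vs s (here e) = inj₁ e
fv-defFm z τ vs s (there i) with ∈-++⁻ (fvT (arrs τ vs)) i
... | inj₁ j with fv-arrs τ vs j
...   | _ , ()
fv-defFm z τ vs s (there i) | inj₂ j with fv-bAll (foldl appS (fvar z) (map hvT vs) ≐ s) vs j
... | inj₁ (_ , () , _)
... | inj₂ (k , n) with ∈-++⁻ (fvT (foldl appS (fvar z) (map hvT vs))) k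
...   | inj₂ m = inj₂ m
...   | inj₁ m with fv-apps (fvar z) vs m
...     | inj₁ (here e) = inj₁ e
...     | inj₂ (_ , _ , ())

-- Induction on `vs`: every value of the first variable has a function of the remaining ones, unique
-- by `Fun-unique`, and comprehension collects this correspondence into a function.
Fun-exists : ∀ {Γ ρ} → LcE ρ → ∀ τ s → Lc s → (∀ n → oV n ∉ fvT s) → ∀ vs → Unique vs →
             (∀ {Δ} → Γ ⊑ Δ → ∀ ρ' → LcE ρ' → Off vs ρ ρ' → TV Δ ρ' vs → Δ ⊢ᶠ subT ρ' s ∈' ⟦ τ ⟧ty ρ) →
             Some Γ (λ Δ c → Fun Δ ρ c τ vs s)
Fun-exists {Γ} {ρ} r τ s ls nv [] u h k =
  -- `Some` hands on variables only, so the value of `s` is first named by eliminating a provable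
  -- existential.
  ∃e {es = subT ρ s ∷ []} {φ = bvar 0 ≐ bvar 1} ⦃ cons ⦃ lv ⦄ ⦄
    (∃i ⦃ cons ⦃ lv ⦄ ⦄ (subT ρ s) ⦃ lv ⦄ ⟪ ≐-refl (subT ρ s) ⦃ lv ⦄ ⟫)
    λ w c e → k w c
      ( ∈-resp ⦃ lv ⦄ ⦃ lc-fvar ⦄ ⦃ lcY r τ ⦄ (≐-sym ⦃ lc-fvar ⦄ ⦃ lv ⦄ (raw e))
          (w (h id ρ r (λ _ _ → refl) (λ ())))
      , λ w' ρ' r' off tv → ⊢-cast (cong (fvar c ≐_) (subT-cong s (λ {y} _ → sym (off y (λ ()))))) (w' (raw e)))
  where lv = lc-subT r ls
Fun-exists {Γ} {ρ} r τ s ls nv ((x , X) ∷ vs) (n ∷ u) h k =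
  C.comprehension
    (λ w a ha k' → Fun-exists (r₁ (fvar a)) τ s ls nv vs u
      (λ w' ρ' r' off tv → ⊢-cast (cong (subT ρ' s ∈'_) (ty-cong (λ _ → refl) τ))
        (h (w' ∘ w) ρ' r' (Off-uncons {x , X} off) (TV-cons off tv (w' ha))))
      λ w' c fc → k' w' c (Fun→def oV-reserved τ s ls (nv 0) (r₁ (fvar a)) fc))
    (λ w a b ha d → ⊢-cast (cong (fvar b ∈'_) (arrs-cong (λ _ → refl) τ vs)) (proj₁ (toFun (fvar a) d)))
    (λ w a b c ha d e → Fun-unique (r₁ (fvar a)) ls u (toFun (fvar a) d) (toFun (fvar a) e))
    λ w f (hf , hφ) → k w f (Fun-cons {s = s} r hf λ w' a ha → toFun a (hφ w' a ha))
  where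
  r₁ : ∀ a → ⦃ Lc a ⦄ → LcE (ρ [ hV x X ↦ a ])
  r₁ a = lcE-upd r (hV x X) a
  φ = defFm (oV 0) τ vs s
  noV : ∀ n → oV (suc n) ∉ fvF φ
  noV n i with fv-defFm (oV 0) τ vs s i
  ... | inj₂ j = nv (suc n) j
  module C = Comprehension r φ x X (⟦ X ⟧ty ρ) (subT ρ (arrs τ vs)) ⦃ lcY r X ⦄ ⦃ lc-subT r (lc-arrs τ vs) ⦄
               (lc-defFm oV-reserved τ s ls (nv 0) vs) noV
  toFun : ∀ {Δ} a {b} → ⦃ Lc a ⦄ → ⦃ Lc b ⦄ → Δ ⊢ᶠ C.Φ a b → Fun Δ (ρ [ hV x X ↦ a ]) b τ vs s
  toFun a d = def→Fun oV-reserved τ s ls (nv 0) (r₁ a) d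

val-noV : ∀ t n → oV n ∉ fvT ⌈ t ⌉
val-noV t n i = fv-val t i

vars-unique : ∀ x A t → Unique (vars x A t)
vars-unique x A t = snoc-unique (fv-unique (lam x A t)) (λ i → proj₂ (remove⁻ (fv t) i) refl)

-- The hypothesis `lam x A t ∉ lams t` excludes circularity: the λ-variable being defined does not
-- occur in `⌈ t ⌉`.
λ-exists : ∀ {Γ ρ} → LcE ρ → ∀ x A {t B} → Typed t B → lam x A t ∉ lams t → DD Γ ρ (lams t) →
           Some Γ (λ Δ c → Δ ⊢ᶠ subF (ρ [ lamV (lam x A t) ↦ c ]) (defλ x A t))
λ-exists {Γ} {ρ} r x A {t} {B} p n d k =
  Fun-exists r (ty t) ⌈ t ⌉ (lc-tm t) (val-noV t) (vars x A t) (vars-unique x A t)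
    (λ {Δ} w ρ' r' off tv → ⊢-cast (cong (⟦ t ⟧ ρ' ∈'_)
          (trans (ty-cong {ρ'} {ρ} (λ X → sym (Off-ty off X)) B) (cong (λ τ → ⟦ τ ⟧ty ρ) (sym (ty-typed p)))))
        (val-typed r' p (DD-cong {Δ} {ρ} {ρ'} t (Off-ty off) (λ {l} _ → sym (off (lamV l) (λ _ ()))) (w ∘ d))
          (tv ∘ fv⊆vars x A t)))
    λ w c f → k w c (Fun→def lamV-reserved (ty t) ⌈ t ⌉ (lc-tm t) (n ∘ fv-val t) r f)

-- Completing an environment

-- A definition mentions only λ-variables of abstractions inside its own. If `D` is closed, they all
-- lie in `D`, so assigning a λ-variable outside `D` leaves the definitions of `D` valid.
Closed : List Term → Set
Closed D = ∀ {l m} → l ∈ D → m ∈ lams l → m ∈ D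

SameBase : Env → Env → Set
SameBase ρ ρ' = ∀ w → (∀ l → w ≢ lamV l) → ρ' w ≡ ρ w

record Extends (Γ Δ : List Fm) (ρ ρ' : Env) (D D' : List Term) : Set where
  field
    weak : Γ ⊑ Δ
    lcρ : LcE ρ'
    base : SameBase ρ ρ'
    closedD : Closed D'
    incl : ∀ {l} → l ∈ D → l ∈ D'
    valid : DD Δ ρ' D'
open Extends

Extension : List Fm → Env → List Term → List Term → Set
Extension Γ ρ D L = ∀ {χ} → (∀ {Δ ρ' D'} → Extends Γ Δ ρ ρ' D D' → (∀ {l} → l ∈ L → l ∈ D') → Δ ⊢ᶠ χ) → Γ ⊢ᶠ χ

extends-refl : ∀ {Γ ρ D} → LcE ρ → Closed D → DD Γ ρ D → Extends Γ Γ ρ ρ D D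
extends-refl r c d = record
  { weak = id ; lcρ = r ; base = λ _ _ → refl ; closedD = c ; incl = id ; valid = d }

extends-trans : ∀ {Γ Δ Θ ρ ρ' ρ'' D D' D''} → Extends Γ Δ ρ ρ' D D' → Extends Δ Θ ρ' ρ'' D' D'' →
  Extends Γ Θ ρ ρ'' D D''
extends-trans e f = record
  { weak = weak f ∘ weak e ; lcρ = lcρ f ; base = λ w n → trans (base f w n) (base e w n)
  ; closedD = closedD f ; incl = incl f ∘ incl e ; valid = valid f }

_∈Tm?_ : ∀ (l : Term) D → Dec (l ∈ D)
l ∈Tm? [] = no λ ()
l ∈Tm? (m ∷ D) with eqTm l m | eqTm-R l m | l ∈Tm? D
... | true | ofʸ refl | _ = yes (here refl)
... | false | _ | yes i = yes (there i)
... | false | ofⁿ n | no k = no λ { (here e) → n e ; (there i) → k i }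

-- The body is treated before its abstraction, so that its λ-definitions hold when the function is
-- formed. An abstraction met before keeps its function, since there is a single λ-variable for each
-- term. Otherwise it is missing from `D'`, which contains `lams t`, and this gives the
-- non-circularity that `λ-exists` asks for.
extend : ∀ {t B} → Typed t B → ∀ {Γ ρ D} → LcE ρ → Closed D → DD Γ ρ D → Extension Γ ρ D (lams t)
extend tvarT r c d k = k (extends-refl r c d) (λ ())
extend teqc r c d k = k (extends-refl r c d) (λ ())
extend (tapp {f} {u} p q) r c d k = extend p r c d λ e i → extend q (lcρ e) (closedD e) (valid e) λ e' j →
  k (extends-trans e e') (both e' i j)
  where
  both : ∀ {Γ Δ ρ ρ' D D'} → Extends Γ Δ ρ ρ' D D' → (∀ {l} → l ∈ lams f → l ∈ D) → (∀ {l} → l ∈ lams u → l ∈ D') →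
         ∀ {l} → l ∈ lams f ++ lams u → l ∈ D'
  both e' i j m with ∈-++⁻ (lams f) m
  ... | inj₁ a = incl e' (i a)
  ... | inj₂ b = j b
extend (tlam {x} {A} {t} p) r c d {χ} k = extend p r c d step
  where
  l = lam x A t
  step : ∀ {Δ ρ' D'} → Extends _ Δ _ ρ' _ D' → (∀ {m} → m ∈ lams t → m ∈ D') → Δ ⊢ᶠ χ
  step {Δ} {ρ'} {D'} e i with l ∈Tm? D'
  ... | yes j = k e (λ m → closedD e j m)
  ... | no n = λ-exists (lcρ e) x A p (n ∘ i) (valid e ∘ i) λ {Θ} w z h →
    k (extends-trans e (record
        { weak = w ; lcρ = lcE-upd (lcρ e) (lamV l) (fvar z)
        ; base = λ y m → upd-other ρ' (lamV l) (fvar z) (λ eq → m l (sym eq))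
        ; closedD = closed'
        ; incl = there
        ; valid = valid' {Θ} w z h })) in'
    where
    in' : ∀ {m} → m ∈ lams l → m ∈ l ∷ D'
    in' m with ∈-++⁻ (lams t) m
    ... | inj₁ a = there (i a)
    ... | inj₂ (here refl) = here refl
    closed' : Closed (l ∷ D')
    closed' (here refl) m = in' m
    closed' (there j) m = there (closedD e j m)
    valid' : ∀ {Θ} → Δ ⊑ Θ → ∀ z → Θ ⊢ᶠ subF (ρ' [ lamV l ↦ fvar z ]) (defλ x A t) →
      DD Θ (ρ' [ lamV l ↦ fvar z ]) (l ∷ D')
    valid' w z h (here refl) = h
    valid' w z h {y} {B} {s} (there j) =
      ⊢-cast (def-cong {ρ'} {ρ' [ lamV l ↦ fvar z ]} y B s (λ _ → refl) (λ {m} q →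
        sym (upd-other ρ' (lamV l) (fvar z) (λ { refl → n (closedD e j q) })))) (w (valid e j))

AllTyped : List Term → Set
AllTyped ts = ∀ {t} → t ∈ ts → ∃ λ B → Typed t B

extendAll : ∀ ts → AllTyped ts → ∀ {Γ ρ D} → LcE ρ → Closed D → DD Γ ρ D → Extension Γ ρ D (concatMap lams ts)
extendAll [] p r c d k = k (extends-refl r c d) (λ ())
extendAll (t ∷ ts) p r c d k = extend (proj₂ (p (here refl))) r c d λ e i →
  extendAll ts (p ∘ there) (lcρ e) (closedD e) (valid e) λ e' j → k (extends-trans e e') (both e' i j)
  where
  both : ∀ {Γ Δ ρ ρ' D D'} → Extends Γ Δ ρ ρ' D D' → (∀ {l} → l ∈ lams t → l ∈ D) →
    (∀ {l} → l ∈ concatMap lams ts → l ∈ D') →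
         ∀ {l} → l ∈ lams t ++ concatMap lams ts → l ∈ D'
  both e' i j m with ∈-++⁻ (lams t) m
  ... | inj₁ a = incl e' (i a)
  ... | inj₂ b = j b

-- Inhabited types and values for further HOL variables

Inhabited : List Fm → Env → Set
Inhabited Γ ρ = ∀ X → Γ ⊢ᶠ inhabited (ρ (tyV X))

ty-inhabited : ∀ {Γ ρ} → LcE ρ → Inhabited Γ ρ → ∀ A → Γ ⊢ᶠ inhabited (⟦ A ⟧ty ρ)
ty-inhabited r h (tvar X) = h X
ty-inhabited r h bool = inhabited-i topS top∈bool
ty-inhabited r h ind = inhabited-i botS zero∈nat
ty-inhabited r h (A ⇛ B) = inhabited-arr ⦃ lcY r A ⦄ ⦃ lcY r B ⦄ (ty-inhabited r h B)

KeepOn : List HVar → Env → Env → Set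
KeepOn F ρ ρ' = ∀ w → (∀ {v} → v ∉ F → w ≢ hv v) → ρ' w ≡ ρ w

-- Variables in `F` keep their values; any other receives an element of its inhabited type. In the
-- recursion a treated variable joins `F`, so that a later occurrence does not overwrite it.
extendT : ∀ {Γ ρ} → LcE ρ → Inhabited Γ ρ → ∀ vs F → TV Γ ρ F → ∀ {χ} →
          (∀ {Δ} → Γ ⊑ Δ → ∀ ρ' → LcE ρ' → KeepOn F ρ ρ' → TV Δ ρ' vs → Δ ⊢ᶠ χ) → Γ ⊢ᶠ χ
extendT {Γ} {ρ} r h vs F tv k = go vs F tv r h λ w ρ' r' keep tvF tvs → k w ρ' r' keep tvs
  where
  go : ∀ {Γ ρ} vs F → TV Γ ρ F → LcE ρ → Inhabited Γ ρ → ∀ {χ} →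
       (∀ {Δ} → Γ ⊑ Δ → ∀ ρ' → LcE ρ' → KeepOn F ρ ρ' → TV Δ ρ' F → TV Δ ρ' vs → Δ ⊢ᶠ χ) → Γ ⊢ᶠ χ
  go {ρ = ρ} [] F tv r h k = k id ρ r (λ _ _ → refl) tv (λ ())
  go {Γ} {ρ} (v ∷ vs) F tv r h k with elemHV v F | elemHV-R v F
  ... | true | ofʸ i = go vs F tv r h λ w ρ' r' keep tvF tvs →
    k w ρ' r' keep tvF (λ { (here refl) → tvF i ; (there j) → tvs j })
  ... | false | ofⁿ n = inhabited-e ⦃ lcY r (proj₂ v) ⦄ (ty-inhabited r h (proj₂ v)) λ w y m →
    go vs (v ∷ F) (tv' w y m) (lcE-upd r (hv v) (fvar y)) (λ X → w (h X)) λ w' ρ' r' keep tvF tvs →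
      k (w' ∘ w) ρ' r' (keep' y keep) (tvF ∘ there) (λ { (here refl) → tvF (here refl) ; (there j) → tvs j })
    where
    tv' : ∀ {Δ} → Γ ⊑ Δ → ∀ y → Δ ⊢ᶠ fvar y ∈' ⟦ proj₂ v ⟧ty ρ → TV Δ (ρ [ hv v ↦ fvar y ]) (v ∷ F)
    tv' w y m (here refl) =
      ⊢-cast (cong₂ _∈'_ (sym (upd-same ρ (hv v) (fvar y))) (ty-cong (λ _ → refl) (proj₂ v))) m
    tv' w y m {u} (there j) =
      ⊢-cast (cong₂ _∈'_ (sym (upd-other ρ (hv v) (fvar y)
                                                     (λ e → n (subst (_∈ F) (sym (hv-inj e)) j))))
                                         (ty-cong (λ _ → refl) (proj₂ u))) (w (tv j))
    keep' : ∀ {ρ'} y → KeepOn (v ∷ F) (ρ [ hv v ↦ fvar y ]) ρ' → KeepOn F ρ ρ'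
    keep' y keep w m = trans (keep w (λ j → m (j ∘ there))) (upd-other ρ (hv v) (fvar y) (λ e → m n (sym e)))

-- Simulation between terms

record TyRel (T : HType → HType → Set) : Set where
  field
    T-bool : T bool bool
    T-arr : ∀ {A A' B B'} → T A A' → T B B' → T (A ⇛ B) (A' ⇛ B')
    T-cod : ∀ {A A' B B'} → T (A ⇛ B) (A' ⇛ B') → T B B'
open TyRel

TmRel : Set₁
TmRel = HVar → Term → Set

-- The relation on free variables below a pair of binders. In `other`, `v ≢ w` excludes shadowing on
-- the left, and `v' ∉ fv u` excludes capture on the right.
data Under (E : TmRel) (v v' : HVar) : TmRel where
  same : Under E v v' v (var (proj₁ v') (proj₂ v'))
  other : ∀ {w u} → v ≢ w → v' ∉ fv u → E w u → Under E v v' w u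

-- One relation serves three comparisons: a term with itself under two choices of λ's, α-equivalent
-- terms, and a term with its instance. `T` and `E` record what becomes of types and free variables;
-- `E` relates variables to terms in order to cover instances.
data Sim (T : HType → HType → Set) : TmRel → Term → Term → Set₁ where
  var : ∀ {E x A u} → E (x , A) u → Sim T E (var x A) u
  eqc : ∀ {E A A'} → T A A' → Sim T E (eqc A) (eqc A')
  app : ∀ {E f f' u u'} → Sim T E f f' → Sim T E u u' → Sim T E (app f u) (app f' u')
  lam : ∀ {E x x' A A' t t'} → T A A' → Sim T (Under E (x , A) (x' , A')) t t' → Sim T E (lam x A t) (lam x' A' t')

Respects : (HType → HType → Set) → TmRel → Set
Respects T E = ∀ {w u B} → E w u → Typed u B → T (proj₂ w) B

under-respects : ∀ {T E x x' A A'} → T A A' → Respects T E → Respects T (Under E (x , A) (x' , A'))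
under-respects a h same tvarT = a
under-respects a h (other _ _ e) p = h e p

-- `Sim` relates only the domains of two abstractions. Extensionality also needs their codomains to
-- have the same interpretation, which follows from typing; `T-cod` handles application.
sim-ty : ∀ {T E t t' B B'} → TyRel T → Respects T E → Sim T E t t' → Typed t B → Typed t' B' → T B B'
sim-ty R h (var e) tvarT q = h e q
sim-ty R h (eqc a) teqc teqc = T-arr R a (T-arr R a (T-bool R))
sim-ty R h (app f u) (tapp p _) (tapp q _) = T-cod R (sim-ty R h f p q)
sim-ty R h (lam a s) (tlam p) (tlam q) = T-arr R a (sim-ty R (under-respects a h) s p q)

-- Nothing is assumed to link the λ-variables of the two sides. Two abstractions are compared as
-- functions on the same set: at a common argument each reduces by its own definition to the value
-- of its body, and the bodies agree by induction under `Under`.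
sim-val : ∀ {Γ T E t t' B B' ρ ρ'} → TyRel T → Respects T E → LcE ρ → LcE ρ' →
          (∀ {A A'} → T A A' → ⟦ A ⟧ty ρ ≡ ⟦ A' ⟧ty ρ') → Sim T E t t' → Typed t B → Typed t' B' →
          DD Γ ρ (lams t) → DD Γ ρ' (lams t') → TV Γ ρ (fv t) → TV Γ ρ' (fv t') →
          (∀ {w u} → E w u → w ∈ fv t → Γ ⊢ᶠ ρ (hv w) ≐ ⟦ u ⟧ ρ') → Γ ⊢ᶠ ⟦ t ⟧ ρ ≐ ⟦ t' ⟧ ρ'
sim-val R h r r' ty (var e) p q d d' tv tv' k = k e (here refl)
sim-val {ρ = ρ} R h r r' ty (eqc {A = A} a) p q d d' tv tv' k = ≐-reflexive ⦃ lcV r (eqc A) ⦄ (cong eS (ty a))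
sim-val R h r r' ty (app {f = f} {f'} {u} {u'} s₁ s₂) (tapp p₁ p₂) (tapp q₁ q₂) d d' tv tv' k =
  app-cong ⦃ lcV r f ⦄ ⦃ lcV r' f' ⦄ ⦃ lcV r u ⦄ ⦃ lcV r' u' ⦄
    (sim-val R h r r' ty s₁ p₁ q₁ (d ∘ ∈-++⁺ˡ) (d' ∘ ∈-++⁺ˡ) (tv ∘ fv-appˡ f u) (tv' ∘ fv-appˡ f' u')
      (λ e i → k e (fv-appˡ f u i)))
    (sim-val R h r r' ty s₂ p₂ q₂ (d ∘ ∈-++⁺ʳ (lams f)) (d' ∘ ∈-++⁺ʳ (lams f'))
      (tv ∘ fv-appʳ f u) (tv' ∘ fv-appʳ f' u')
      (λ e i → k e (fv-appʳ f u i)))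
sim-val {Γ} {E = E} {ρ = ρ} {ρ'} R h r r' ty (lam {x = x} {x'} {A} {A'} {t} {t'} a s)
        (tlam {B = B} p) (tlam {B = B'} q) d d' tv tv' k =
  fun-ext ⦃ lcY r A ⦄ ⦃ lcY r B ⦄ ⦃ lcV r (lam x A t) ⦄ ⦃ lcV r' (lam x' A' t') ⦄
    (val-typed r (tlam p) d tv)
    (⊢-cast (cong (⟦ lam x' A' t' ⟧ ρ' ∈'_) (sym (cong₂ arrS (ty a) (ty (sim-ty R (under-respects a h) s p q)))))
      (val-typed r' (tlam q) d' tv'))
    λ {Δ} w y m →
      let m' = ⊢-cast (cong (fvar y ∈'_) (ty a)) m
          r₁ = lcE-upd r (hV x A) (fvar y)
          r₁' = lcE-upd r' (hV x' A') (fvar y)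
          lf = lc-app ⦃ lcV r (lam x A t) ⦄ ⦃ lc-fvar {y} ⦄
          lf' = lc-app ⦃ lcV r' (lam x' A' t') ⦄ ⦃ lc-fvar {y} ⦄
      in ≐-trans ⦃ lf ⦄ ⦃ lcV r₁ t ⦄ ⦃ lf' ⦄ (val-β {t = t} r (w ∘ d) (w ∘ tv) m)
         (≐-trans ⦃ lcV r₁ t ⦄ ⦃ lcV r₁' t' ⦄ ⦃ lf' ⦄
           (sim-val R (under-respects a h) r₁ r₁'
             (λ {C} {C'} c → trans (ty-cong (λ _ → refl) C) (trans (ty c) (ty-cong (λ _ → refl) C')))
             s p q (DD-upd x A (fvar y) t (w ∘ d ∘ ∈-++⁺ˡ)) (DD-upd x' A' (fvar y) t' (w ∘ d' ∘ ∈-++⁺ˡ))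
             (TV-upd {t = t} (w ∘ tv) m) (TV-upd {t = t'} (w ∘ tv') m')
             (under w y))
           (≐-sym ⦃ lf' ⦄ ⦃ lcV r₁' t' ⦄ (val-β {t = t'} r' (w ∘ d') (w ∘ tv') m')))
  where
  DD-upd : ∀ {Δ ρ} x A b t → DD Δ ρ (lams t) → DD Δ (ρ [ hV x A ↦ b ]) (lams t)
  DD-upd {Δ} {ρ} x A b t = DD-cong {Δ} {ρ} {ρ [ hV x A ↦ b ]} t (λ _ → refl) (λ _ → refl)
  under : ∀ {Δ} → Γ ⊑ Δ → ∀ y {v u} → Under E (x , A) (x' , A') v u → v ∈ fv t →
          Δ ⊢ᶠ (ρ [ hV x A ↦ fvar y ]) (hv v) ≐ ⟦ u ⟧ (ρ' [ hV x' A' ↦ fvar y ])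
  under w y same i = ⊢-cast (cong₂ _≐_
      (sym (upd-same ρ (hV x A) (fvar y))) (sym (upd-same ρ' (hV x' A') (fvar y)))) (≐-refl (fvar y))
  under w y {v} {u} (other n n' e) i = ⊢-cast (cong₂ _≐_ (sym (upd-other ρ (hV x A) (fvar y) (n ∘ hv-inj)))
      (val-cong u (λ _ → refl) (λ _ → refl) (λ j → sym (upd-other ρ' (hV x' A') (fvar y)
        (λ e' → n' (subst (_∈ fv u) (sym (hv-inj e')) j))))))
    (w (k e (remove⁺ (fv t) i n)))

varOf : HVar → Term
varOf v = var (proj₁ v) (proj₂ v)

var-fresh : ∀ {v w} → v ≢ w → v ∉ fv (varOf w)
var-fresh n (here e) = n e

sim-refl : ∀ {T} {E : TmRel} t → (∀ {A} → (∀ {X} → X ∈ tvsTy A → X ∈ tvsTm t) → T A A) →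
           (∀ {w} → w ∈ fv t → E w (varOf w)) → Sim T E t t
sim-refl (var x A) h k = var (k (here refl))
sim-refl (eqc A) h k = eqc (h id)
sim-refl (app f u) h k = app (sim-refl f (λ s → h (∈-++⁺ˡ ∘ s)) (k ∘ fv-appˡ f u))
                             (sim-refl u (λ s → h (∈-++⁺ʳ (tvsTm f) ∘ s)) (k ∘ fv-appʳ f u))
sim-refl {E = E} (lam x A t) h k = lam (h ∈-++⁺ˡ) (sim-refl t (λ s → h (∈-++⁺ʳ (tvsTy A) ∘ s)) body)
  where
  body : ∀ {w} → w ∈ fv t → Under E (x , A) (x , A) w (varOf w)
  body {w} i with eqHV (x , A) w | eqHV-R (x , A) w
  ... | true | ofʸ refl = same
  ... | false | ofⁿ n = other n (var-fresh n) (k (remove⁺ (fv t) i n))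

-- `aeqV` consults the innermost pair of binders and fails if just one side matches; the two
-- remaining cases are the two constructors of `Under`.
sim-aeq : ∀ {E : TmRel} Γ s t → aeq Γ s t ≡ true → (∀ w w' → aeqV Γ w w' ≡ true → E w (varOf w')) → Sim _≡_ E s t
sim-aeq Γ (var x A) (var y B) h k = var (k (x , A) (y , B) h)
sim-aeq Γ (eqc A) (eqc B) h k = eqc (trueR (eqTy-R A B) h)
sim-aeq Γ (app f t) (app g u) h k = app (sim-aeq Γ f g (∧⁻ˡ (aeq Γ f g) h) k) (sim-aeq Γ t u (∧⁻ʳ (aeq Γ f g) h) k)
sim-aeq {E} Γ (lam x A s) (lam y B t) h k =
  lam (trueR (eqTy-R A B) (∧⁻ˡ (eqTy A B) h)) (sim-aeq _ s t (∧⁻ʳ (eqTy A B) h) body)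
  where
  body : ∀ w w' → aeqV (((x , A) , (y , B)) ∷ Γ) w w' ≡ true → Under E (x , A) (y , B) w (varOf w')
  body w w' e with eqHV w (x , A) | eqHV-R w (x , A) | eqHV w' (y , B) | eqHV-R w' (y , B)
  ... | true | ofʸ refl | true | ofʸ refl = same
  ... | false | ofⁿ n | false | ofⁿ m = other (n ∘ sym) (var-fresh (m ∘ sym)) (k w w' e)

maxName-≤ : ∀ {x A} vs → (x , A) ∈ vs → x ≤ maxName vs
maxName-≤ ((x , A) ∷ vs) (here refl) = m≤m⊔n x (maxName vs)
maxName-≤ ((y , B) ∷ vs) (there i) = ≤-trans (maxName-≤ vs i) (m≤n⊔m y (maxName vs))

rename-fresh : ∀ x A vs → ((if elemHV (x , A) vs then suc (maxName vs) else x) , A) ∉ vs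
rename-fresh x A vs i with elemHV (x , A) vs | elemHV-R (x , A) vs
... | true | _ = <-irrefl refl (maxName-≤ vs i)
... | false | ofⁿ n = n i

-- The list `avoid` collects the free variables of the images of all free variables of the
-- abstraction. The possibly renamed bound variable lies outside it, and this is the condition
-- against capture in `Under`.
sim-sub : ∀ {E : TmRel} {θ} σ t → (∀ {w} → w ∈ fv t → E w (σ (proj₁ w) (proj₂ w))) →
  Sim (λ A A' → A' ≡ tsub θ A) E t (sub θ σ t)
sim-sub σ (var x A) h = var (h (here refl))
sim-sub σ (eqc A) h = eqc refl
sim-sub σ (app f u) h = app (sim-sub σ f (h ∘ fv-appˡ f u)) (sim-sub σ u (h ∘ fv-appʳ f u))
sim-sub {E} {θ} σ (lam x A t) h = lam refl (sim-sub _ t body)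
  where
  avoid = concatMap (λ v → fv (σ (proj₁ v) (proj₂ v))) (fv (lam x A t))
  x' = if elemHV (x , tsub θ A) avoid then suc (maxName avoid) else x
  body : ∀ {w} → w ∈ fv t → Under E (x , A) (x' , tsub θ A) w
           (if eqHV w (x , A) then var x' (tsub θ A) else σ (proj₁ w) (proj₂ w))
  body {w} i with eqHV w (x , A) | eqHV-R w (x , A)
  ... | true | ofʸ refl = same
  ... | false | ofⁿ n = other (n ∘ sym)
    (λ j → rename-fresh x (tsub θ A) avoid
      (∈-concatMap (λ v → fv (σ (proj₁ v) (proj₂ v))) (fv (lam x A t)) w∈ j)) (h w∈)
    where w∈ = remove⁺ (fv t) i (n ∘ sym)

sub-tyRel : ∀ θ → TyRel (λ A A' → A' ≡ tsub θ A)
sub-tyRel θ = record { T-bool = refl ; T-arr = λ { refl refl → refl } ; T-cod = λ { refl → refl } }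

≡-tyRel : TyRel _≡_
≡-tyRel = record { T-bool = refl ; T-arr = λ { refl refl → refl } ; T-cod = λ { refl → refl } }

-- Equality of types restricted to type variables in `S`: the assignments compared for the
-- conclusion agree there, while elsewhere one of them takes the value `𝔹`.
On : List ℕ → HType → HType → Set
On S A A' = A ≡ A' × (∀ {X} → X ∈ tvsTy A → X ∈ S)

on-tyRel : ∀ S → TyRel (On S)
on-tyRel S = record
  { T-bool = refl , λ ()
  ; T-arr = λ { {A} (refl , p) (refl , q) → refl , λ i → arr A p q (∈-++⁻ (tvsTy A) i) }
  ; T-cod = λ { {A} (refl , p) → refl , p ∘ ∈-++⁺ʳ (tvsTy A) } }
  where
  arr : ∀ A {B : List ℕ} {X} → (∀ {X} → X ∈ tvsTy A → X ∈ S) → (∀ {X} → X ∈ B → X ∈ S) →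
    X ∈ tvsTy A ⊎ X ∈ B → X ∈ S
  arr A p q (inj₁ i) = p i
  arr A p q (inj₂ j) = q j

-- Environments satisfying the context of a term

-- The three parts of `ctx t` read at `ρ`, indexed by `fv` and `lams` in place of lists of formulas,
-- so that they pass to subterms by composition.
record Good (Γ : List Fm) (ρ : Env) (t : Term) : Set where
  field
    nonempty : ∀ {X} → X ∈ tvsTm t → Γ ⊢ᶠ ¬' (ρ (tyV X) ≐ botS)
    typedV : TV Γ ρ (fv t)
    validD : DD Γ ρ (lams t)
open Good

good-wk : ∀ {Γ Δ ρ t} → Γ ⊑ Δ → Good Γ ρ t → Good Δ ρ t
good-wk w g = record
  { nonempty = λ i → w (nonempty g i) ; typedV = λ i → w (typedV g i) ; validD = λ i → w (validD g i) }

good-appˡ : ∀ {Γ ρ} f u → Good Γ ρ (app f u) → Good Γ ρ f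
good-appˡ f u g = record
  { nonempty = nonempty g ∘ ∈-++⁺ˡ ; typedV = typedV g ∘ fv-appˡ f u ; validD = validD g ∘ ∈-++⁺ˡ }

good-appʳ : ∀ {Γ ρ} f u → Good Γ ρ (app f u) → Good Γ ρ u
good-appʳ f u g = record
  { nonempty = nonempty g ∘ ∈-++⁺ʳ (tvsTm f) ; typedV = typedV g ∘ fv-appʳ f u ; validD = validD g ∘ ∈-++⁺ʳ (lams f) }

good-app : ∀ {Γ ρ} f u → Good Γ ρ f → Good Γ ρ u → Good Γ ρ (app f u)
good-app {Γ} {ρ} f u g h = record { nonempty = ne ; typedV = tv ; validD = dd }
  where
  ne : ∀ {X} → X ∈ tvsTm f ++ tvsTm u → Γ ⊢ᶠ ¬' (ρ (tyV X) ≐ botS)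
  ne i with ∈-++⁻ (tvsTm f) i
  ... | inj₁ j = nonempty g j
  ... | inj₂ j = nonempty h j
  tv : TV Γ ρ (fv (app f u))
  tv i with fv-app⁻ f u i
  ... | inj₁ j = typedV g j
  ... | inj₂ j = typedV h j
  dd : DD Γ ρ (lams f ++ lams u)
  dd i with ∈-++⁻ (lams f) i
  ... | inj₁ j = validD g j
  ... | inj₂ j = validD h j

good-ctx : ∀ {Γ ρ} t → Good Γ ρ t → ∀ {φ} → φ ∈ ctx t → Γ ⊢ᶠ subF ρ φ
good-ctx {Γ} {ρ} t g i with ∈-++⁻ (ctxN t) i
... | inj₁ j with ∈-map⁻ (λ X → ¬' (fvar (tyV X) ≐ botS)) j
...   | X , k , refl = nonempty g k
good-ctx {Γ} {ρ} t g i | inj₂ j with ∈-++⁻ (ctxT t) j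
... | inj₁ k with ∈-map⁻ (λ v → hvT v ∈' ⌈ proj₂ v ⌉ty) k
...   | v , m , refl = typedV g (ctxTvars⊆fv t m)
good-ctx {Γ} {ρ} t g i | inj₂ j | inj₂ k = ctxD⁻ (λ φ → Γ ⊢ᶠ subF ρ φ) t (validD g) k

good-id : ∀ {Γ} t → (∀ {φ} → φ ∈ ctx t → φ ∈ Γ) → Good Γ fvar t
good-id t h = record
  { nonempty = λ i → hyp (h (∈-++⁺ˡ (∈-map⁺ _ i)))
  ; typedV = λ {v} i → ⊢-cast (cong (hvT v ∈'_) (sym (subT-id ⌈ proj₂ v ⌉ty)))
      (hyp (h (∈-++⁺ʳ (ctxN t) (∈-++⁺ˡ (∈-map⁺ (λ v → hvT v ∈' ⌈ proj₂ v ⌉ty) (fv⊆ctxTvars t i))))))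
  ; validD = λ {x} {A} {s} i → ⊢-cast (sym (subF-id (defλ x A s)))
      (hyp (h (∈-++⁺ʳ (ctxN t) (∈-++⁺ʳ (ctxT t) (ctxD⁺ t i))))) }

good-typed : ∀ {Γ ρ t A} → LcE ρ → Typed t A → Good Γ ρ t → Γ ⊢ᶠ ⟦ t ⟧ ρ ∈' ⟦ A ⟧ty ρ
good-typed r p g = val-typed r p (validD g) (typedV g)

True : List Fm → Env → Term → Set
True Γ ρ t = Γ ⊢ᶠ ⟦ t ⟧ ρ ≐ topS

premise : ∀ {Γ ρ} hs c → LcE ρ → Provable (embedSeq (hs , c)) → (∀ {h} → h ∈ hs → Good Γ ρ h) → Good Γ ρ c →
          (∀ {h} → h ∈ hs → True Γ ρ h) → True Γ ρ c
premise {Γ} {ρ} hs c r d gh gc th = ⊢-subst r hyps d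
  where
  hyps : ∀ {ψ} → ψ ∈ concatMap ctx hs ++ ctx c ++ map (λ h → ⌈ h ⌉ ≐ topS) hs → Γ ⊢ᶠ subF ρ ψ
  hyps i with ∈-++⁻ (concatMap ctx hs) i
  ... | inj₁ j = inHs hs gh j
    where
    inHs : ∀ ts → (∀ {h} → h ∈ ts → Good Γ ρ h) → ∀ {ψ} → ψ ∈ concatMap ctx ts → Γ ⊢ᶠ subF ρ ψ
    inHs (t ∷ ts) g j with ∈-++⁻ (ctx t) j
    ... | inj₁ k = good-ctx t (g (here refl)) k
    ... | inj₂ k = inHs ts (g ∘ there) k
  ... | inj₂ j with ∈-++⁻ (ctx c) j
  ...   | inj₁ k = good-ctx c gc k
  ...   | inj₂ k with ∈-map⁻ (λ h → ⌈ h ⌉ ≐ topS) k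
  ...     | h , m , refl = th m

extends-valid : ∀ {Γ Δ ρ ρ' D D'} → Extends Γ Δ ρ ρ' D D' → ∀ ts → (∀ {l} → l ∈ concatMap lams ts → l ∈ D') →
                ∀ {t} → t ∈ ts → DD Δ ρ' (lams t)
extends-valid e ts h i j = valid e (h (∈-concatMap lams ts i j))

TV-cong : ∀ {Γ ρ ρ' vs} → SameTy ρ ρ' → (∀ {v} → v ∈ vs → ρ (hv v) ≡ ρ' (hv v)) → TV Γ ρ vs → TV Γ ρ' vs
TV-cong s h tv {v} i = ⊢-cast (cong₂ _∈'_ (h i) (ty-cong s (proj₂ v))) (tv i)

-- The type variables outside the conclusion are interpreted by 𝔹.
initial : List ℕ → Env
initial S (tyV X) with X ∈ℕ? S
... | yes _ = fvar (tyV X)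
... | no _ = boolS
initial S w = fvar w

initial-lc : ∀ S → LcE (initial S)
initial-lc S = lcE go
  where
  go : ∀ w → Lc (initial S w)
  go (tyV X) with X ∈ℕ? S
  ... | yes _ = lc-fvar
  ... | no _ = lc-bool
  go (hV _ _) = lc-fvar
  go (lamV _) = lc-fvar
  go (oV _) = lc-fvar

initial-ty : ∀ {S X} → X ∈ S → initial S (tyV X) ≡ fvar (tyV X)
initial-ty {S} {X} i with X ∈ℕ? S
... | yes _ = refl
... | no n = ⊥-elim (n i)

initial-inhabited : ∀ {Γ} S → (∀ {X} → X ∈ S → Γ ⊢ᶠ ¬' (fvar (tyV X) ≐ botS)) → Inhabited Γ (initial S)
initial-inhabited S h X with X ∈ℕ? S
... | yes i = nonempty→inhabited (h i)
... | no _ = inhabited-i topS top∈bool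

concatMap⁻ : ∀ {X Y : Set} (f : X → List Y) xs {y} → y ∈ concatMap f xs → ∃ λ x → x ∈ xs × y ∈ f x
concatMap⁻ f xs i = find (∈-concatMap⁻ f {xs = xs} i)

True-resp : ∀ {Γ t u} → Lc t → Lc u → Γ ⊢ᶠ t ≐ u → Γ ⊢ᶠ t ≐ topS → Γ ⊢ᶠ u ≐ topS
True-resp l m e d = ≐-trans ⦃ m ⦄ ⦃ l ⦄ (≐-sym ⦃ l ⦄ ⦃ m ⦄ e) d

-- It suffices to derive the conclusion under every environment that is good
-- for the sequent and for any further terms ts, such as the premises.
module Semantic (ts : List Term) (hs : List Term) (c : Term) (typed : AllTyped ts) (wf : WfSeq (hs , c)) where

  private
    cs = c ∷ hs
    ks = ts ++ cs
    Γ₀ = proj₁ (embedSeq (hs , c))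
    S = concatMap tvsTm cs
    F = concatMap fv cs

    typed-cs : ∀ {t} → t ∈ cs → Typed t bool
    typed-cs (here refl) = proj₂ wf
    typed-cs (there i) = All.lookup (proj₁ wf) i

    typed-ks : AllTyped ks
    typed-ks i with ∈-++⁻ ts i
    ... | inj₁ j = typed j
    ... | inj₂ j = bool , typed-cs j

    good₀ : ∀ {t} → t ∈ cs → Good Γ₀ fvar t
    good₀ {t} (here refl) = good-id t (∈-++⁺ʳ (concatMap ctx hs) ∘ ∈-++⁺ˡ)
    good₀ {t} (there i) = good-id t (∈-++⁺ˡ ∘ ∈-concatMap ctx hs i)

    tvs-F : ∀ {v X} → v ∈ F → X ∈ tvsTy (proj₂ v) → X ∈ S
    tvs-F i j with concatMap⁻ fv cs i
    ... | t , k , m = ∈-concatMap tvsTm cs k (tvs-fv t m j)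

    nonempty₀ : ∀ {X} → X ∈ S → Γ₀ ⊢ᶠ ¬' (fvar (tyV X) ≐ botS)
    nonempty₀ i with concatMap⁻ tvsTm cs i
    ... | t , k , m = nonempty (good₀ k) m

    typed₀ : TV Γ₀ (initial S) F
    typed₀ {v} i with concatMap⁻ fv cs i
    ... | t , k , m = ⊢-cast (cong (hvT v ∈'_)
      (ty-cong-on (proj₂ v) (λ j → sym (initial-ty (tvs-F i j))))) (typedV (good₀ k) m)

  Goal : Set
  Goal = ∀ {Γ ρ} → LcE ρ → Inhabited Γ ρ → (∀ {t} → t ∈ ts → Good Γ ρ t) → (∀ {h} → h ∈ hs → Good Γ ρ h) →
         Good Γ ρ c → (∀ {h} → h ∈ hs → True Γ ρ h) → True Γ ρ c

  provable : Goal → Provable (embedSeq (hs , c))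
  provable goal =
    extendT (initial-lc S) (initial-inhabited S nonempty₀) (concatMap fv ks) F typed₀ λ w₁ ρ₁ r₁ keep tv₁ →
    -- Starting from the empty list re-chooses all λ-variables, also those that the hypotheses of
    -- the sequent define.
    extendAll ks typed-ks {D = []} r₁ (λ ()) (λ ()) λ e incl →
      finish w₁ ρ₁ keep tv₁ e incl
    where
    finish : ∀ {Δ Θ ρ₂ D} → Γ₀ ⊑ Δ → ∀ ρ₁ → KeepOn F (initial S) ρ₁ → TV Δ ρ₁ (concatMap fv ks) →
             Extends Δ Θ ρ₁ ρ₂ [] D → (∀ {l} → l ∈ concatMap lams ks → l ∈ D) → Θ ⊢ᶠ ⌈ c ⌉ ≐ topS
    finish {Δ} {Θ} {ρ₂} w₁ ρ₁ keep tv₁ e incl =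
      ⊢-cast (cong (_≐ topS) (subT-id ⌈ c ⌉))
        (True-resp (lcV r₂ c) (lcV lcE-id c) (≐-sym ⦃ lcV lcE-id c ⦄ ⦃ lcV r₂ c ⦄ (agree (here refl)))
          (goal r₂ inh (good ∘ ∈-++⁺ˡ) (good ∘ ∈-++⁺ʳ ts ∘ there) (good (∈-++⁺ʳ ts (here refl)))
            λ {h} i → True-resp (lcV lcE-id h) (lcV r₂ h) (agree (there i))
              (w (⊢-cast (cong (_≐ topS) (sym (subT-id ⌈ h ⌉)))
                (hyp (∈-++⁺ʳ (concatMap ctx hs) (∈-++⁺ʳ (ctx c) (∈-map⁺ (λ h → ⌈ h ⌉ ≐ topS) i))))))))
      where
      r₂ = lcρ e
      w : Γ₀ ⊑ Θ
      w d = weak e (w₁ d)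
      on-ty : ∀ X → ρ₂ (tyV X) ≡ initial S (tyV X)
      on-ty X = trans (base e (tyV X) (λ _ ())) (keep (tyV X) (λ _ ()))
      inh : Inhabited Θ ρ₂
      inh X = ⊢-cast (cong inhabited (sym (on-ty X))) (w (initial-inhabited S nonempty₀ X))
      good : ∀ {t} → t ∈ ks → Good Θ ρ₂ t
      good {t} i = record
        { nonempty = λ {X} _ → inhabited→nonempty ⦃ at r₂ (tyV X) ⦄ (inh X)
        ; typedV = TV-cong (λ X → sym (base e (tyV X) (λ _ ()))) (λ {v} _ → sym (base e (hv v) (λ _ ())))
            (λ j → weak e (tv₁ (∈-concatMap fv ks i j)))
        ; validD = extends-valid e ks incl i }
      on-F : ∀ {v} → v ∈ F → ρ₂ (hv v) ≡ fvar (hv v)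
      on-F {v} i = trans (base e (hv v) (λ _ ())) (keep (hv v) (λ n eq → n (subst (_∈ F) (hv-inj eq) i)))
      -- The term is compared with itself at two assignments: the identity, whose λ-definitions are
      -- hypotheses of the sequent, and `ρ₂` with the newly chosen functions. Both interpret the
      -- type variables and the free HOL variables of the sequent alike.
      agree : ∀ {t} → t ∈ cs → Θ ⊢ᶠ ⟦ t ⟧ fvar ≐ ⟦ t ⟧ ρ₂
      agree {t} i =
        sim-val {E = λ v u → v ∈ F × u ≡ varOf v} (on-tyRel S) (λ { (j , refl) tvarT → refl , tvs-F j }) lcE-id r₂
          (λ { {A} (refl , s) → ty-cong-on A (λ j → sym (trans (on-ty _) (initial-ty (s j)))) })
          (sim-refl t (λ s → refl , ∈-concatMap tvsTm cs i ∘ s) (λ j → ∈-concatMap fv cs i j , refl))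
          (typed-cs i) (typed-cs i)
          (λ j → w (validD (good₀ i) j)) (validD (good (∈-++⁺ʳ ts i)))
          (λ j → w (typedV (good₀ i) j)) (typedV (good (∈-++⁺ʳ ts i)))
          (λ { {v} (j , refl) _ → ⊢-cast (cong (fvar (hv v) ≐_) (sym (on-F j))) (≐-refl (fvar (hv v))) })

-- The rules

module _ {Γ : List Fm} {ρ : Env} {A : HType} {s t : Term} (r : LcE ρ) (p : Typed s A) (q : Typed t A) (gs : Good Γ ρ s) (gt : Good Γ ρ t) where

  true-eq⁻ : True Γ ρ (mkEq A s t) → Γ ⊢ᶠ ⟦ s ⟧ ρ ≐ ⟦ t ⟧ ρ
  true-eq⁻ = E-elim ⦃ lcY r A ⦄ ⦃ lcV r s ⦄ ⦃ lcV r t ⦄ (good-typed r p gs) (good-typed r q gt)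

  true-eq⁺ : Γ ⊢ᶠ ⟦ s ⟧ ρ ≐ ⟦ t ⟧ ρ → True Γ ρ (mkEq A s t)
  true-eq⁺ = E-intro ⦃ lcY r A ⦄ ⦃ lcV r s ⦄ ⦃ lcV r t ⦄ (good-typed r p gs) (good-typed r q gt)

good-lhs : ∀ {Γ ρ} A s t → Good Γ ρ (mkEq A s t) → Good Γ ρ s
good-lhs A s t g = good-appʳ (eqc A) s (good-appˡ (app (eqc A) s) t g)

good-rhs : ∀ {Γ ρ} A s t → Good Γ ρ (mkEq A s t) → Good Γ ρ t
good-rhs A s t g = good-appʳ (app (eqc A) s) t g

good-eqc : ∀ {Γ ρ} A s t → Good Γ ρ (mkEq A s t) → Good Γ ρ (eqc A)
good-eqc A s t g = good-appˡ (eqc A) s (good-appˡ (app (eqc A) s) t g)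

good-env : ∀ {Γ ρ ρ' t} → SameTy ρ ρ' → (∀ l → ρ (lamV l) ≡ ρ' (lamV l)) → TV Γ ρ' (fv t) → Good Γ ρ t →
  Good Γ ρ' t
good-env {Γ} {ρ} {ρ'} {t} s h tv g = record
  { nonempty = λ {X} i → ⊢-cast (cong (λ a → ¬' (a ≐ botS)) (s X)) (nonempty g i)
  ; typedV = tv
  ; validD = DD-cong {Γ} {ρ} {ρ'} t s (λ {l} _ → h l) (validD g) }

good-body : ∀ {Γ ρ x A t a} → Good Γ ρ (lam x A t) → Γ ⊢ᶠ a ∈' ⟦ A ⟧ty ρ → Good Γ (ρ [ hV x A ↦ a ]) t
good-body {Γ} {ρ} {x} {A} {t} {a} g m = record
  { nonempty = nonempty g ∘ ∈-++⁺ʳ (tvsTy A)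
  ; typedV = TV-upd {t = t} (typedV g) m
  ; validD = DD-cong {Γ} {ρ} {ρ [ hV x A ↦ a ]} t (λ _ → refl) (λ _ → refl) (validD g ∘ ∈-++⁺ˡ) }

upd-fresh : ∀ {ρ x A a vs} → (x , A) ∉ vs → ∀ {v} → v ∈ vs → ρ (hv v) ≡ (ρ [ hV x A ↦ a ]) (hv v)
upd-fresh {ρ} {x} {A} {a} {vs} n {v} i = sym (upd-other ρ (hV x A) a (λ e → n (subst (_∈ vs) (sym (hv-inj e)) i)))

alpha-val : ∀ {Γ ρ t t' A} → LcE ρ → Alpha t t' → Typed t A → Typed t' A → Good Γ ρ t → Good Γ ρ t' →
  Γ ⊢ᶠ ⟦ t ⟧ ρ ≐ ⟦ t' ⟧ ρ
alpha-val {ρ = ρ} {t} {t'} r a p p' g g' =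
  sim-val {E = λ v u → u ≡ varOf v} ≡-tyRel (λ { refl tvarT → refl }) r r (λ { refl → refl })
    (sim-aeq [] t t' a (λ v w e → cong varOf (sym (trueR (eqHV-R v w) e)))) p p'
    (validD g) (validD g') (typedV g) (typedV g')
    (λ { {v} refl _ → ≐-refl (ρ (hv v)) ⦃ at r (hv v) ⦄ })

-- Instantiation of type variables and term variables

module Substitution (θ : ℕ → HType) (σ : ℕ → HType → Term) (σ-typed : ∀ x A → Typed (σ x A) (tsub θ A))
  (hs : List Term) (c : Term) (wf : WfSeq (hs , c)) (wf' : WfSeq (map (sub θ σ) hs , sub θ σ c))
  (prem : Provable (embedSeq (hs , c))) where

  private
    cs = c ∷ hs

    image : HVar → Term
    image v = σ (proj₁ v) (proj₂ v)

    -- The images serve as values of variables, so they must be well typed and have valid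
    -- λ-definitions; listing them as further terms makes them `Good`.
    ts = map image (concatMap fv cs)

    typed-ts : AllTyped ts
    typed-ts i with ∈-map⁻ image i
    ... | v , _ , refl = _ , σ-typed (proj₁ v) (proj₂ v)

    typed-cs : ∀ {t} → t ∈ cs → Typed t bool
    typed-cs (here refl) = proj₂ wf
    typed-cs (there i) = All.lookup (proj₁ wf) i

    pullback : Env → Env
    pullback ρ (tyV X) = ⟦ θ X ⟧ty ρ
    pullback ρ (hV x A) = ⟦ σ x A ⟧ ρ
    -- A placeholder: the λ-variables of the uninstantiated sequent receive their functions from
    -- `extendAll`.
    pullback ρ (lamV l) = botS
    pullback ρ (oV n) = botS

    pullback-lc : ∀ {ρ} → LcE ρ → LcE (pullback ρ)
    pullback-lc {ρ} r = lcE go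
      where
      go : ∀ w → Lc (pullback ρ w)
      go (tyV X) = lcY r (θ X)
      go (hV x A) = lcV r (σ x A)
      go (lamV l) = lc-bot
      go (oV n) = lc-bot

    pullback-ty : ∀ {ρ ρ'} → (∀ X → ρ' (tyV X) ≡ ⟦ θ X ⟧ty ρ) → ∀ A → ⟦ A ⟧ty ρ' ≡ ⟦ tsub θ A ⟧ty ρ
    pullback-ty h (tvar X) = h X
    pullback-ty h bool = refl
    pullback-ty h ind = refl
    pullback-ty h (A ⇛ B) = cong₂ arrS (pullback-ty h A) (pullback-ty h B)

  provable : Provable (embedSeq (map (sub θ σ) hs , sub θ σ c))
  provable = Semantic.provable ts (map (sub θ σ) hs) (sub θ σ c) typed-ts wf'
    λ r inh gts ghs gc ths → extendAll cs (λ i → bool , typed-cs i) {D = []} (pullback-lc r) (λ ()) (λ ()) λ e incl →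
      finish r inh gts ghs gc ths e incl
    where
    finish : ∀ {Γ Δ ρ ρ' D} → LcE ρ → Inhabited Γ ρ → (∀ {t} → t ∈ ts → Good Γ ρ t) →
             (∀ {h} → h ∈ map (sub θ σ) hs → Good Γ ρ h) → Good Γ ρ (sub θ σ c) →
             (∀ {h} → h ∈ map (sub θ σ) hs → True Γ ρ h) →
             Extends Γ Δ (pullback ρ) ρ' [] D → (∀ {l} → l ∈ concatMap lams cs → l ∈ D) → True Δ ρ (sub θ σ c)
    finish {Γ} {Δ} {ρ} {ρ'} r inh gts ghs gc ths e incl =
      True-resp (lcV r' c) (lcV r (sub θ σ c)) (same-val (here refl) (proj₂ wf') gc)
        (premise hs c r' prem (good ∘ there) (good (here refl)) λ {h} i →
          let j = ∈-map⁺ (sub θ σ) i in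
          True-resp (lcV r (sub θ σ h)) (lcV r' h) (≐-sym ⦃ lcV r' h ⦄ ⦃ lcV r (sub θ σ h) ⦄
            (same-val (there i) (All.lookup (proj₁ wf') j) (ghs j))) (weak e (ths j)))
      where
      r' = lcρ e
      on-ty : ∀ A → ⟦ A ⟧ty ρ' ≡ ⟦ tsub θ A ⟧ty ρ
      on-ty = pullback-ty (λ X → base e (tyV X) (λ _ ()))
      on-hv : ∀ v → ρ' (hv v) ≡ ⟦ image v ⟧ ρ
      on-hv v = base e (hv v) (λ _ ())
      good : ∀ {t} → t ∈ cs → Good Δ ρ' t
      good i = record
        { nonempty = λ {X} _ → inhabited→nonempty ⦃ at r' (tyV X) ⦄
            (⊢-cast (cong inhabited (sym (on-ty (tvar X)))) (weak e (ty-inhabited r inh (θ X))))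
        ; typedV = λ {v} j → ⊢-cast (cong₂ _∈'_ (sym (on-hv v)) (sym (on-ty (proj₂ v))))
            (weak e (good-typed r (σ-typed (proj₁ v) (proj₂ v)) (gts (∈-map⁺ image (∈-concatMap fv cs i j)))))
        ; validD = extends-valid e cs incl i }
      same-val : ∀ {t} → t ∈ cs → Typed (sub θ σ t) bool → Good Γ ρ (sub θ σ t) → Δ ⊢ᶠ ⟦ t ⟧ ρ' ≐ ⟦ sub θ σ t ⟧ ρ
      same-val {t} i p g =
        sim-val {E = λ v u → u ≡ image v} (sub-tyRel θ)
          (λ { {w = v} refl q → typed-unique q (σ-typed (proj₁ v) (proj₂ v)) })
          r' r (λ { {A} refl → on-ty A }) (sim-sub σ t (λ _ → refl)) (typed-cs i) p
          (validD (good i)) (λ j → weak e (validD g j)) (typedV (good i)) (λ j → weak e (typedV g j))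
          (λ { {v} refl _ → ≐-reflexive ⦃ at r' (hv v) ⦄ (on-hv v) })
        where
        typed-unique : ∀ {t A B} → Typed t A → Typed t B → A ≡ B
        typed-unique p q = trans (sym (ty-typed p)) (ty-typed q)

tsub-id : ∀ A → tsub tvar A ≡ A
tsub-id (tvar X) = refl
tsub-id bool = refl
tsub-id ind = refl
tsub-id (A ⇛ B) = cong₂ _⇛_ (tsub-id A) (tsub-id B)

instLookup-typed : ∀ ps → All (λ e → Typed (proj₁ e) (proj₂ (proj₂ e))) ps → ∀ x A → Typed (instLookup ps x A) A
instLookup-typed [] [] x A = tvarT
instLookup-typed ((t , v) ∷ ps) (p ∷ qs) x A with eqHV (x , A) v | eqHV-R (x , A) v
... | true | ofʸ refl = p
... | false | _ = instLookup-typed ps qs x A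

mainTheorem1 : ∀ {ps : List HSeq} {s : HSeq} → HRule ps s →
    All WfSeq ps → WfSeq s →
    All (λ p → Provable (embedSeq p)) ps → Provable (embedSeq s)
mainTheorem1 (REFL A t) [] wf@(_ , tapp (tapp teqc p) _) [] = Semantic.provable [] [] (mkEq A t t) (λ ()) wf
  λ r inh gts ghs gc ths → true-eq⁺ r p p (good-rhs A t t gc) (good-rhs A t t gc) (≐-refl (⟦ t ⟧ _) ⦃ lcV r t ⦄)
mainTheorem1 (TRANS Γ Δ A s t t' u α) ((wΓ , w₁@(tapp (tapp teqc p) q)) ∷
  (wΔ , w₂@(tapp (tapp teqc q') _)) ∷ []) wf@(_ , tapp (tapp teqc _) v) (d ∷ e ∷ []) =
  -- The middle terms may be absent from the conclusion; listing the premises as further terms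
  -- supplies their contexts.
  Semantic.provable (mkEq A s t ∷ mkEq A t' u ∷ []) (Γ ++ Δ) (mkEq A s u)
    (λ { (here refl) → bool , w₁ ; (there (here refl)) → bool , w₂ }) wf
    λ r inh gts ghs gc ths →
      let g₁ = gts (here refl) ; g₂ = gts (there (here refl))
          gs = good-lhs A s t g₁ ; gt = good-rhs A s t g₁ ; gt' = good-lhs A t' u g₂ ; gu = good-rhs A t' u g₂
      in true-eq⁺ r p v gs gu
        (≐-trans ⦃ lcV r s ⦄ ⦃ lcV r t ⦄ ⦃ lcV r u ⦄
          (true-eq⁻ r p q gs gt (premise Γ (mkEq A s t) r d (ghs ∘ ∈-++⁺ˡ) g₁ (ths ∘ ∈-++⁺ˡ)))
          (≐-trans ⦃ lcV r t ⦄ ⦃ lcV r t' ⦄ ⦃ lcV r u ⦄ (alpha-val r α q q' gt gt')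
            (true-eq⁻ r q' v gt' gu (premise Δ (mkEq A t' u) r e (ghs ∘ ∈-++⁺ʳ Γ) g₂ (ths ∘ ∈-++⁺ʳ Γ)))))
mainTheorem1 (MK-COMB Γ Δ A B s t u v) ((wΓ , w₁@(tapp (tapp teqc p) q)) ∷
  (wΔ , w₂@(tapp (tapp teqc p') q')) ∷ []) wf (d ∷ e ∷ []) =
  Semantic.provable (mkEq (A ⇛ B) s t ∷ mkEq A u v ∷ []) (Γ ++ Δ) (mkEq B (app s u) (app t v))
    (λ { (here refl) → bool , w₁ ; (there (here refl)) → bool , w₂ }) wf
    λ r inh gts ghs gc ths →
      let g₁ = gts (here refl) ; g₂ = gts (there (here refl))
          gs = good-lhs (A ⇛ B) s t g₁ ; gt = good-rhs (A ⇛ B) s t g₁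
          gu = good-lhs A u v g₂ ; gv = good-rhs A u v g₂
      in true-eq⁺ r (tapp p p') (tapp q q') (good-app s u gs gu) (good-app t v gt gv)
        (app-cong ⦃ lcV r s ⦄ ⦃ lcV r t ⦄ ⦃ lcV r u ⦄ ⦃ lcV r v ⦄
          (true-eq⁻ r p q gs gt (premise Γ (mkEq (A ⇛ B) s t) r d (ghs ∘ ∈-++⁺ˡ) g₁ (ths ∘ ∈-++⁺ˡ)))
          (true-eq⁻ r p' q' gu gv (premise Δ (mkEq A u v) r e (ghs ∘ ∈-++⁺ʳ Γ) g₂ (ths ∘ ∈-++⁺ʳ Γ))))
mainTheorem1 (ABS Γ A B x s t fresh) ((wΓ , w₁@(tapp (tapp teqc p) q)) ∷ []) wf (d ∷ []) =
  Semantic.provable (mkEq B s t ∷ []) Γ (mkEq (A ⇛ B) (lam x A s) (lam x A t))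
    (λ { (here refl) → bool , w₁ }) wf
    λ {Θ} {ρ} r inh gts ghs gc ths →
      let gs = good-lhs (A ⇛ B) (lam x A s) (lam x A t) gc
          gt = good-rhs (A ⇛ B) (lam x A s) (lam x A t) gc
      in true-eq⁺ r (tlam p) (tlam q) gs gt
        (fun-ext ⦃ lcY r A ⦄ ⦃ lcY r B ⦄ ⦃ lcV r (lam x A s) ⦄ ⦃ lcV r (lam x A t) ⦄
          (good-typed r (tlam p) gs) (good-typed r (tlam q) gt) λ {Ξ} w y m →
            -- The premise is used at the assignment that sends `x` to the argument `y`. The
            -- hypotheses keep their contexts and their truth there because `x` is not free in them.
            let ρ₁ = ρ [ hV x A ↦ fvar y ]
                r₁ = lcE-upd r (hV x A) (fvar y)
                gs' = good-wk w gs ; gt' = good-wk w gt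
                gs₁ = good-body {t = s} gs' m ; gt₁ = good-body {t = t} gt' m
                ls = lc-app ⦃ lcV r (lam x A s) ⦄ ⦃ lc-fvar {y} ⦄
                lt = lc-app ⦃ lcV r (lam x A t) ⦄ ⦃ lc-fvar {y} ⦄
                g₁ : Good Ξ ρ₁ (mkEq B s t)
                g₁ = good-app (app (eqc B) s) t (good-app (eqc B) s
                       (good-env {t = eqc B} (λ _ → refl) (λ _ → refl) (λ ())
                         (good-wk w (good-eqc B s t (gts (here refl))))) gs₁) gt₁
            in ≐-trans ⦃ ls ⦄ ⦃ lcV r₁ s ⦄ ⦃ lt ⦄ (val-β {t = s} r (validD gs') (typedV gs') m)
              (≐-trans ⦃ lcV r₁ s ⦄ ⦃ lcV r₁ t ⦄ ⦃ lt ⦄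
                (true-eq⁻ r₁ p q gs₁ gt₁ (premise Γ (mkEq B s t) r₁ d
                  (λ {h} i → good-env {t = h} (λ _ → refl) (λ _ → refl)
                    (TV-cong (λ _ → refl) (upd-fresh {ρ} (x∉ i)) (λ j → w (typedV (ghs i) j))) (good-wk w (ghs i)))
                  g₁
                  (λ {h} i → ⊢-cast (cong (_≐ topS) (val-cong h (λ _ → refl) (λ _ → refl) (upd-fresh {ρ} (x∉ i))))
                    (w (ths i)))))
                (≐-sym ⦃ lt ⦄ ⦃ lcV r₁ t ⦄ (val-β {t = t} r (validD gt') (typedV gt') m))))
  where
  x∉ : ∀ {h} → h ∈ Γ → (x , A) ∉ fv h
  x∉ i j = falseR (elemHV-R (x , A) (concatMap fv Γ)) fresh (∈-concatMap fv Γ i j)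
mainTheorem1 (BETA A B x t) [] wf@(_ , tapp (tapp teqc p@(tapp (tlam _) _)) q) [] =
  Semantic.provable [] [] (mkEq B (app (lam x A t) (var x A)) t) (λ ()) wf
    λ {Θ} {ρ} r inh gts ghs gc ths →
      let gl = good-lhs B (app (lam x A t) (var x A)) t gc
          gt = good-rhs B (app (lam x A t) (var x A)) t gc
          gλ = good-appˡ (lam x A t) (var x A) gl
          gx = good-appʳ (lam x A t) (var x A) gl
      in true-eq⁺ r p q gl gt
        -- The argument is the current value of `x`, so the update made by `val-β` changes nothing.
        (⊢-cast (cong (appS (⟦ lam x A t ⟧ ρ) (ρ (hV x A)) ≐_) (subT-cong ⌈ t ⌉ (λ {w} _ → upd-self ρ (hV x A) w)))
          (val-β {t = t} r ⦃ at r (hV x A) ⦄ (validD gλ) (typedV gλ) (typedV gx (here refl))))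
  where
  upd-self : ∀ ρ v w → (ρ [ v ↦ ρ v ]) w ≡ ρ w
  upd-self ρ v w with eqFV v w | eqFV-R v w
  ... | true | ofʸ refl = refl
  ... | false | _ = refl
mainTheorem1 (ASSUME p) [] wf [] =
  Semantic.provable [] (p ∷ []) p (λ ()) wf λ r inh gts ghs gc ths → ths (here refl)
mainTheorem1 (EQ-MP Γ Δ p p' q α) ((wΓ , w₁@(tapp (tapp teqc a) b)) ∷ (wΔ , w₂) ∷ []) wf (d ∷ e ∷ []) =
  Semantic.provable (mkEq bool p q ∷ p' ∷ []) (Γ ++ Δ) q
    (λ { (here refl) → bool , w₁ ; (there (here refl)) → bool , w₂ }) wf
    λ r inh gts ghs gc ths →
      let g₁ = gts (here refl) ; gp' = gts (there (here refl)) ; gp = good-lhs bool p q g₁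
      in True-resp (lcV r p) (lcV r q)
          (true-eq⁻ r a b gp gc (premise Γ (mkEq bool p q) r d (ghs ∘ ∈-++⁺ˡ) g₁ (ths ∘ ∈-++⁺ˡ)))
          (≐-trans ⦃ lcV r p ⦄ ⦃ lcV r p' ⦄ (alpha-val r α a w₂ gp gp')
            (premise Δ p' r e (ghs ∘ ∈-++⁺ʳ Γ) gp' (ths ∘ ∈-++⁺ʳ Γ)))
mainTheorem1 (DEDUCT-ANTISYM Γ Δ p q) (w₁ ∷ w₂ ∷ []) wf@(_ , tapp (tapp teqc a) b) (d ∷ e ∷ []) =
  Semantic.provable [] (Γ ++ Δ) (mkEq bool p q) (λ ()) wf
    λ {Θ} {ρ} r inh gts ghs gc ths →
      let gp = good-lhs bool p q gc ; gq = good-rhs bool p q gc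
      in true-eq⁺ r a b gp gq
        -- Elements of `𝔹` are equal once each is `topS` whenever the other is. Each direction uses
        -- a premise in the context extended by the truth of its discharged formula.
        (bool-ext ⦃ lcV r p ⦄ ⦃ lcV r q ⦄ (good-typed r a gp) (good-typed r b gq)
          (λ w h → premise (p ∷ Δ) q r e
            (λ { (here refl) → good-wk w gp ; (there i) → good-wk w (ghs (∈-++⁺ʳ Γ i)) }) (good-wk w gq)
            (λ { (here refl) → h ; (there i) → w (ths (∈-++⁺ʳ Γ i)) }))
          (λ w h → premise (q ∷ Γ) p r d
            (λ { (here refl) → good-wk w gq ; (there i) → good-wk w (ghs (∈-++⁺ˡ i)) }) (good-wk w gp)
            (λ { (here refl) → h ; (there i) → w (ths (∈-++⁺ˡ i)) })))
mainTheorem1 (INST Γ p σ typed) (w ∷ []) wf (d ∷ []) =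
  Substitution.provable tvar (instLookup σ)
    (λ x A → subst (Typed (instLookup σ x A)) (sym (tsub-id A)) (instLookup-typed σ typed x A))
    Γ p w wf d
mainTheorem1 (INSTTYPE Γ p θ) (w ∷ []) wf (d ∷ []) =
  -- Variables with the same name and different types may coincide after instantiation. This causes
  -- no conflict, since an assignment may give two variables the same value.
  Substitution.provable (tyLookup θ) (λ y B → var y (tsub (tyLookup θ) B)) (λ x A → tvarT) Γ p w wf d
mainTheorem1 (ETA A B x t fresh) [] wf@(_ , tapp (tapp teqc p) q) [] =
  Semantic.provable [] [] (mkEq (A ⇛ B) (lam x A (app t (var x A))) t) (λ ()) wf
    λ {Θ} {ρ} r inh gts ghs gc ths →
      let l = lam x A (app t (var x A))
          gl = good-lhs (A ⇛ B) l t gc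
          gt = good-rhs (A ⇛ B) l t gc
      in true-eq⁺ r p q gl gt
        -- At `y` the abstraction takes the value of `app t (var x A)` with `x` updated to `y`; `x`
        -- is not free in `t`, so this is the value of `t` applied to `y`.
        (fun-ext ⦃ lcY r A ⦄ ⦃ lcY r B ⦄ ⦃ lcV r l ⦄ ⦃ lcV r t ⦄ (good-typed r p gl) (good-typed r q gt) λ w y m →
          ⊢-cast (cong (appS (⟦ l ⟧ ρ) (fvar y) ≐_)
              (cong₂ appS (sym (val-cong t (λ _ → refl) (λ _ → refl) (upd-fresh {ρ} x∉))) (upd-same ρ (hV x A) (fvar y))))
            (val-β {t = app t (var x A)} r (w ∘ validD gl) (w ∘ typedV gl) m))
  where
  x∉ : (x , A) ∉ fv t
  x∉ = falseR (elemHV-R (x , A) (fv t)) fresh
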